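{- If the Orthogonal Vectors Conjecture is false, then the Hitting Set Conjecture is also false.
   Context: Orthogonal Vectors (OV) Conjecture: there is no $\varepsilon>0$ such that for all $c\ge 1$ there is an algorithm that, given two lists $A,B\subseteq\{0,1\}^d$ of $n$ boolean vectors with $d=c\log n$, determines in $O(n^{2-\varepsilon})$ time whether there is an orthogonal pair $a\in A$, $b\in B$. Hitting Set (HS) Conjecture: there is no $\varepsilon>0$ such that for all $c\ge 1$ there is an algorithm that, given two lists of $n$ subsets of a universe $U$ of size $c\log n$, decides in $O(n^{2-\varepsilon})$ time whether there is a set in the first list that intersects every set in the second list. Running times are in the standard word-RAM model with $O(\log n)$-bit words. -}

module Defs where

open import Data.Bool.Base using (Bool; true; false; if_then_else_; _∧_; _∨_; _xor_)
open import Data.Fin.Subset using (Subset; Nonempty; _∩_)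
open import Data.Integer.Base using (∣_∣)
open import Data.List.Base as List using (List; []; _∷_)
open import Data.Maybe.Base using (Maybe; just; nothing; fromMaybe)
open import Data.Nat.Base using (ℕ; zero; suc; _+_; _*_; _∸_; _^_; _≤_; _≥_; NonZero; _≡ᵇ_; _<ᵇ_; _/_; _%_)
open import Data.Nat.Logarithm using (⌊log₂_⌋)
open import Data.Nat.Properties using (m^n≢0)
open import Data.Product.Base using (Σ-syntax; ∃; ∃-syntax; ∃₂; _×_)
open import Data.Rational.Base as ℚ using (ℚ; 0ℚ; 1ℚ; ↥_; ↧ₙ_)
open import Data.Sum.Base using (_⊎_)
open import Data.Vec.Base as Vec using (Vec)
open import Data.Vec.Membership.Propositional using (_∈_)
open import Relation.Binary.PropositionalEquality.Core using (_≡_)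
open import Relation.Nullary.Negation.Core using (¬_)

------------------------------------------------------------------------
-- The word RAM with w-bit words
--
-- Words are natural numbers below 2 ^ w; every value written to a register
-- is reduced modulo 2 ^ w.  Each instruction takes one time unit.

truncate : ℕ → ℕ → ℕ
truncate w a = _%_ a (2 ^ w) {{m^n≢0 2 w}}

bit : Bool → ℕ
bit b = if b then 1 else 0

data Op : Set where
  add sub mul div mod and or xor shl shr eq lt : Op

-- Combines the w least significant binary digits of a and b.
bitwise : (Bool → Bool → Bool) → ℕ → ℕ → ℕ → ℕ
bitwise f zero    a b = 0
bitwise f (suc w) a b =
  bit (f (a % 2 ≡ᵇ 1) (b % 2 ≡ᵇ 1)) + 2 * bitwise f w (a / 2) (b / 2)

-- Division by zero yields 0, and a modulo zero yields a.
quotient remainder : ℕ → ℕ → ℕ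
quotient a zero        = 0
quotient a b@(suc _)   = a / b
remainder a zero       = a
remainder a b@(suc _)  = a % b

-- The arguments are meant to be words; subtraction wraps around, so it is
-- computed as a + (2 ^ w - b) before truncation.
⟦_⟧ : Op → ℕ → ℕ → ℕ → ℕ
⟦ add ⟧ w a b = truncate w (a + b)
⟦ sub ⟧ w a b = truncate w (a + (2 ^ w ∸ b))
⟦ mul ⟧ w a b = truncate w (a * b)
⟦ div ⟧ w a b = truncate w (quotient a b)
⟦ mod ⟧ w a b = truncate w (remainder a b)
⟦ and ⟧ w a b = bitwise _∧_ w a b
⟦ or  ⟧ w a b = bitwise _∨_ w a b
⟦ xor ⟧ w a b = bitwise _xor_ w a b
⟦ shl ⟧ w a b = truncate w (a * 2 ^ b)
⟦ shr ⟧ w a b = truncate w (_/_ a (2 ^ b) {{m^n≢0 2 b}})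
⟦ eq  ⟧ w a b = truncate w (bit (a ≡ᵇ b))
⟦ lt  ⟧ w a b = truncate w (bit (a <ᵇ b))

-- A program mentions only finitely many registers, so drawing their names
-- from ℕ still gives each program a constant number of registers.
Reg Label : Set
Reg   = ℕ
Label = ℕ

data Instr : Set where
  const : (r : Reg) (v : ℕ) → Instr              -- r := v
  arith : (o : Op) (r x y : Reg) → Instr         -- r := x o y
  load  : (r x : Reg) → Instr                    -- r := M[x]
  store : (x y : Reg) → Instr                    -- M[x] := y
  jump  : (ℓ : Label) → Instr                    -- goto ℓ
  jzero : (x : Reg) (ℓ : Label) → Instr          -- if x = 0 then goto ℓ

Program : Set
Program = List Instr

record State : Set where
  constructor ⟨_,_,_⟩
  field
    pc   : Label
    regs : Reg → ℕ
    mem  : ℕ → ℕ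

open State public

_[_≔_] : (ℕ → ℕ) → ℕ → ℕ → (ℕ → ℕ)
(f [ a ≔ v ]) b = if b ≡ᵇ a then v else f b

exec : ℕ → Instr → State → State
exec w (const r v)     ⟨ i , ρ , μ ⟩ = ⟨ suc i , ρ [ r ≔ truncate w v ] , μ ⟩
exec w (arith o r x y) ⟨ i , ρ , μ ⟩ = ⟨ suc i , ρ [ r ≔ ⟦ o ⟧ w (ρ x) (ρ y) ] , μ ⟩
exec w (load r x)      ⟨ i , ρ , μ ⟩ = ⟨ suc i , ρ [ r ≔ μ (ρ x) ] , μ ⟩
exec w (store x y)     ⟨ i , ρ , μ ⟩ = ⟨ suc i , ρ , μ [ ρ x ≔ ρ y ] ⟩
exec w (jump ℓ)        ⟨ i , ρ , μ ⟩ = ⟨ ℓ , ρ , μ ⟩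
exec w (jzero x ℓ)     ⟨ i , ρ , μ ⟩ = ⟨ (if ρ x ≡ᵇ 0 then ℓ else suc i) , ρ , μ ⟩

_‼_ : ∀ {A : Set} → List A → ℕ → Maybe A
[]       ‼ _     = nothing
(x ∷ _)  ‼ zero  = just x
(_ ∷ xs) ‼ suc i = xs ‼ i

-- w , p ⊢ s ⇓[ t ] s′ : started in s on a machine with w-bit words, p halts
-- in s′ after exactly t steps.  A program halts when control leaves its text.
data _,_⊢_⇓[_]_ (w : ℕ) (p : Program) : State → ℕ → State → Set where
  halt : ∀ {s} → p ‼ pc s ≡ nothing → w , p ⊢ s ⇓[ 0 ] s
  step : ∀ {s s′ t i} → p ‼ pc s ≡ just i →
         w , p ⊢ exec w i s ⇓[ t ] s′ → w , p ⊢ s ⇓[ suc t ] s′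

------------------------------------------------------------------------
-- Decision problems on two lists of n vectors in {0,1}^d

-- A vector in {0,1}^d is also a subset of a d-element universe, through its
-- characteristic vector: Subset d is Vec Bool d.
Problem : Set₁
Problem = ∀ {n d} → Vec (Vec Bool d) n → Vec (Vec Bool d) n → Set

-- Registers 0 and 1 hold n and d.  Memory holds the rows of A followed by the
-- rows of B from address 0 on, one coordinate per cell.  Everything else is 0.
module _ {n d : ℕ} (w : ℕ) (A B : Vec (Vec Bool d) n) where

  inputRegs : Reg → ℕ
  inputRegs 0 = truncate w n
  inputRegs 1 = truncate w d
  inputRegs _ = 0

  inputCells : List ℕ
  inputCells = List.map (λ b → truncate w (bit b))
    (Vec.toList (Vec.concat A) List.++ Vec.toList (Vec.concat B))

  input : State
  input = ⟨ 0 , inputRegs , (λ a → fromMaybe 0 (inputCells ‼ a)) ⟩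

-- The answer is returned in register 0.
Answers : State → Set → Set
Answers s P = (regs s 0 ≡ 1 × P) ⊎ (regs s 0 ≡ 0 × ¬ P)

-- T(n) = O(n^(2-ε)), for rational ε = p/q > 0: the bound T(n) ≤ C n^(2-p/q) is
-- raised to the power q and multiplied by n^p.
_∈O[n^2-_] : (ℕ → ℕ) → ℚ → Set
T ∈O[n^2- ε ] = ∃₂ λ C n₀ → ∀ n → n ≥ n₀ →
    T n ^ q * n ^ p ≤ C ^ q * n ^ (2 * q)
  where
  p = ∣ ↥ ε ∣
  q = ↧ₙ ε

-- ⌊c log₂ n⌋, for rational c = p/q ≥ 0 and n ≥ 1, as ⌊⌊log₂ (n^p)⌋ / q⌋.
⌊_·log₂_⌋ : ℚ → ℕ → ℕ
⌊ c@record{} ·log₂ n ⌋ = ⌊log₂ n ^ ∣ ↥ c ∣ ⌋ / ↧ₙ c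

-- k times the length of n in binary: O(log n) for constant k.
wordSize : ℕ → ℕ → ℕ
wordSize k n = k * suc ⌊log₂ n ⌋

-- On every instance with n vectors per list and d = c log n, the program p
-- answers correctly within T(n) steps, on a machine with wordSize k n bits.
Solves : Problem → ℚ → Program → ℕ → (ℕ → ℕ) → Set
Solves P c p k T =
  ∀ n .{{_ : NonZero n}} (A B : Vec (Vec Bool ⌊ c ·log₂ n ⌋) n) →
  ∃₂ λ t s → t ≤ T n
           × wordSize k n , p ⊢ input (wordSize k n) A B ⇓[ t ] s
           × Answers s (P A B)

-- "For all c ≥ 1 there is an O(n^(2-ε)) time algorithm for d = c log n";
-- the program, its word length and the constant in O may depend on c.
SolvableIn[n^2-_] : ℚ → Problem → Set
SolvableIn[n^2- ε ] P = ∀ c → 1ℚ ℚ.≤ c →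
  Σ[ p ∈ Program ] Σ[ k ∈ ℕ ] Σ[ T ∈ (ℕ → ℕ) ]
    T ∈O[n^2- ε ] × Solves P c p k T

TrulySubquadratic : Problem → Set
TrulySubquadratic P = ∃[ ε ] 0ℚ ℚ.< ε × SolvableIn[n^2- ε ] P

------------------------------------------------------------------------
-- The two conjectures

infix 7 _·_

_·_ : ∀ {d} → Vec Bool d → Vec Bool d → ℕ
a · b = Vec.sum (Vec.zipWith (λ x y → bit x * bit y) a b)

OrthogonalVectors : Problem
OrthogonalVectors A B = ∃₂ λ a b → a ∈ A × b ∈ B × a · b ≡ 0

Intersects : ∀ {d} → Subset d → Subset d → Set
Intersects a b = Nonempty (a ∩ b)

HittingSet : Problem
HittingSet A B = ∃ λ a → a ∈ A × (∀ b → b ∈ B → Intersects a b)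

OVConjecture HSConjecture : Set
OVConjecture = ¬ TrulySubquadratic OrthogonalVectors
HSConjecture = ¬ TrulySubquadratic HittingSet

{-# OPTIONS --safe #-}
module Submission where

-- Split both lists into g groups of size s ≈ n^(1/4) and run the algorithm for orthogonal vectors
-- on all pairs of groups.  If it finds nothing in (Aᵢ , Bⱼ), every set in Aᵢ meets every set in Bⱼ.
-- Otherwise a brute-force search flags the sets in Aᵢ that miss some set in Bⱼ.  The flag is an
-- additional coordinate, equal to 1 throughout B, so a flagged set no longer takes part in an
-- orthogonal pair; hence every positive answer flags a new set, and there are at most g s of them.
-- The unflagged sets that remain are the hitting sets.  With an OV algorithm of running time
-- T(s) = O(s^(2-p/q)), the time g² (2 T(s) + O(s log n)) + g s · O(s² log n) is O(n^(2-1/(8q))).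
--
-- The OV algorithm runs on words of O(log s) bits and expects an empty memory.  On the longer words
-- of the machine at hand its results are reduced modulo 2^w after every instruction, and each call
-- is given a region of memory that has not been touched before, so that nothing has to be erased.

open import Defs
open import Data.Bool.Base using (Bool; true; false; if_then_else_; T; _∧_; not)
open import Data.Bool.Properties using (¬-not)
open import Data.Empty using (⊥; ⊥-elim)
open import Data.Fin.Base as Fin using (Fin; toℕ; fromℕ<)
open import Data.Fin.Properties using (toℕ<n; toℕ-fromℕ<)
open import Data.Fin.Subset.Properties using (x∈p∩q⁺; x∈p∩q⁻)
open import Data.Integer.Base as ℤ using (∣_∣)
import Data.Integer.Properties as ℤ
open import Data.List.Base using (List; []; _∷_; _++_; length; map; replicate; applyUpTo)
open import Data.List.Properties using (length-++; length-applyUpTo)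
open import Data.Maybe.Base as Maybe using (Maybe; just; nothing; fromMaybe)
open import Data.Nat.Base
open import Data.Nat.Coprimality using (1-coprimeTo) renaming (sym to coprime-sym)
open import Data.Nat.Divisibility using (divides)
open import Data.Nat.DivMod hiding (_mod_; _div_; _divMod_)
open import Data.Nat.Induction using (<-rec)
open import Data.Nat.Logarithm
open import Data.Nat.Properties
open import Data.Nat.Tactic.RingSolver using (solve-∀)
open import Data.Product.Base using (∃₂; ∃-syntax; _×_; _,_; proj₁; proj₂)
open import Data.Rational.Base as ℚ using (ℚ; mkℚ; 0ℚ; ↥_; ↧ₙ_)
import Data.Rational.Properties as ℚ
open import Data.Sum.Base using (_⊎_; inj₁; inj₂)
open import Data.Unit.Base using (tt)
open import Data.Vec.Base using (Vec; []; _∷_; toList; concat; tabulate; lookup)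
open import Data.Vec.Membership.Propositional using (_∈_)
open import Data.Vec.Membership.Propositional.Properties using (∈-tabulate⁺)
open import Data.Vec.Properties
  using (toList-++; length-toList; tabulate-cong; lookup∘tabulate; []=⇒lookup; lookup⇒[]=)
open import Data.Vec.Relation.Unary.Any.Properties using (tabulate⁻)
open import Function.Base using (_∘_; _$_; id; case_of_)
open import Relation.Binary.PropositionalEquality
open import Relation.Nullary.Decidable.Core using (yes; no)
open import Relation.Nullary.Negation.Core using (¬_; contradiction)

-- Relocatable code

-- The OV hypothesis covers only instances whose dimension is exactly a constant times the logarithm
-- of their own size, but the constant is free. Since log n < 4 log s, the dimension C log s with C
-- = 4a + 1, where a is the numerator of c, has room for the c log n original coordinates and at
-- least one spare one. Spare coordinates are 0 in A and 1 in B, hence change no intersection, and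
-- one of them holds the flag. Making s a power of two keeps dimension and word length exact, and
-- lets the program find them by repeated doubling, although the machine has no logarithm
-- instruction.
--
-- Up to constants the OV calls cost n^2 / s^(p/q), the bookkeeping for all pairs of groups n^2 (log
-- s) / s, and the searches n s^2 log s, so any fixed power of n below n^(1/2) could serve as s.
-- Estimating log s by the square root of s leaves a saving of s^(1/2) ≥ n^(1/8) in the bookkeeping.
-- The OV calls save at least s^(1/q) ≥ n^(1/(4q)). The exponent 1/(8q) lies below both.

Regs Mem Store : Set
Regs  = ℕ → ℕ
Mem   = ℕ → ℕ
Store = Regs × Mem

record At (p : Program) (o : Label) (c : List Instr) : Set where
  constructor placed
  field fetch : ∀ i {x} → c ‼ i ≡ just x → p ‼ (o + i) ≡ just x

open At public

‼-++ˡ : ∀ {A : Set} (xs : List A) {ys i x} → xs ‼ i ≡ just x → (xs ++ ys) ‼ i ≡ just x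
‼-++ˡ (_ ∷ _)  {i = zero}  e = e
‼-++ˡ (_ ∷ xs) {i = suc i} e = ‼-++ˡ xs e

‼-++ʳ : ∀ {A : Set} (xs : List A) {ys} i → (xs ++ ys) ‼ (length xs + i) ≡ ys ‼ i
‼-++ʳ []       i = refl
‼-++ʳ (_ ∷ xs) i = ‼-++ʳ xs i

At-++ˡ : ∀ {p o} c {c′} → At p o (c ++ c′) → At p o c
At-++ˡ c at = placed λ i e → fetch at i (‼-++ˡ c e)

At-++ʳ : ∀ {p o} c {c′ m} → length c ≡ m → At p o (c ++ c′) → At p (o + m) c′
At-++ʳ {p} {o} c refl at = placed λ i e →
  trans (cong (p ‼_) (+-assoc o (length c) i)) (fetch at _ (trans (‼-++ʳ c i) e))

At-head : ∀ {p o i c} → At p o (i ∷ c) → p ‼ o ≡ just i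
At-head {p} {o} at = trans (cong (p ‼_) (sym (+-identityʳ o))) (fetch at 0 refl)

At-tail : ∀ {p o i c} → At p o (i ∷ c) → At p (suc o) c
At-tail {p} {o} at = placed λ i e → trans (cong (p ‼_) (sym (+-suc o i))) (fetch at (suc i) e)

-- Without η and defined by copatterns, the combinators below are injective for unification.
record Block : Set where
  no-eta-equality
  field
    size      : ℕ
    code      : Label → List Instr
    code-size : ∀ o → length (code o) ≡ size

open Block public

infixr 5 _⨾_

straight : List Instr → Block
straight is .size        = length is
straight is .code      o = is
straight is .code-size o = refl

_⨾_ : Block → Block → Block
(b ⨾ b′) .size        = size b + size b′
(b ⨾ b′) .code      o = code b o ++ code b′ (o + size b)
(b ⨾ b′) .code-size o = trans (length-++ (code b o)) (cong₂ _+_ (code-size b o) (code-size b′ _))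

when : Reg → Block → Block
when x b .size        = suc (size b)
when x b .code      o = jzero x (o + suc (size b)) ∷ code b (suc o)
when x b .code-size o = cong suc (code-size b _)

while : Block → Reg → Block → Block
while c x b .size = size c + suc (size b + 1)
while c x b .code o =
  code c o ++ jzero x (o + (size c + suc (size b + 1))) ∷ code b (suc (o + size c)) ++ jump o ∷ []
while c x b .code-size o = trans (length-++ (code c o)) (cong₂ _+_ (code-size c o)
  (cong suc (trans (length-++ (code b (suc (o + size c)))) (cong (_+ 1) (code-size b _)))))

-- Stated in continuation-passing style, so that no small-step closure is needed.
record Runs (w : ℕ) (b : Block) (σ : Store) (t : ℕ) (σ′ : Store) : Set where
  constructor running
  field
    resume : ∀ {p o u s} → At p o (code b o) →
      w , p ⊢ ⟨ o + size b , proj₁ σ′ , proj₂ σ′ ⟩ ⇓[ u ] s →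
      w , p ⊢ ⟨ o , proj₁ σ , proj₂ σ ⟩ ⇓[ t + u ] s

open Runs public

module _ {w : ℕ} where

  ⇓-pc : ∀ {p o o′ ρ μ t s} → o ≡ o′ → w , p ⊢ ⟨ o , ρ , μ ⟩ ⇓[ t ] s → w , p ⊢ ⟨ o′ , ρ , μ ⟩ ⇓[ t ] s
  ⇓-pc refl r = r

  ⇓-time : ∀ {p s s′ t t′} → t ≡ t′ → w , p ⊢ s ⇓[ t ] s′ → w , p ⊢ s ⇓[ t′ ] s′
  ⇓-time refl r = r

  runs-[] : ∀ {σ} → Runs w (straight []) σ 0 σ
  runs-[] = running λ {p} {o} _ h → ⇓-pc (+-identityʳ o) h

  runs-∷ : ∀ {i is ρ μ ρ′ μ′ t σ} →
    (∀ o → exec w i ⟨ o , ρ , μ ⟩ ≡ ⟨ suc o , ρ′ , μ′ ⟩) →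
    Runs w (straight is) (ρ′ , μ′) t σ → Runs w (straight (i ∷ is)) (ρ , μ) (suc t) σ
  runs-∷ {is = is} e r = running λ {p} {o} at h → step (At-head at)
    (subst (w , p ⊢_⇓[ _ ] _) (sym (e o)) (resume r (At-tail at) (⇓-pc (+-suc o (length is)) h)))

  runs-⨾ : ∀ {b b′ σ σ₁ σ₂ t t′} → Runs w b σ t σ₁ → Runs w b′ σ₁ t′ σ₂ →
    Runs w (b ⨾ b′) σ (t + t′) σ₂
  runs-⨾ {b} {b′} {t = t} {t′} r r′ = running λ {p} {o} {u} at h → ⇓-time (sym (+-assoc t t′ u))
    (resume r (At-++ˡ (code b o) at) (resume r′ (At-++ʳ (code b o) (code-size b o) at)
      (⇓-pc (sym (+-assoc o (size b) (size b′))) h)))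

  jzero-taken : ∀ {p o x ℓ ρ μ t s} → p ‼ o ≡ just (jzero x ℓ) → ρ x ≡ 0 →
    w , p ⊢ ⟨ ℓ , ρ , μ ⟩ ⇓[ t ] s → w , p ⊢ ⟨ o , ρ , μ ⟩ ⇓[ suc t ] s
  jzero-taken {o = o} {ℓ = ℓ} e z h =
    step e (⇓-pc (cong (λ v → if v ≡ᵇ 0 then ℓ else suc o) (sym z)) h)

  jzero-passed : ∀ {p o x ℓ ρ μ t s v} → p ‼ o ≡ just (jzero x ℓ) → ρ x ≡ suc v →
    w , p ⊢ ⟨ suc o , ρ , μ ⟩ ⇓[ t ] s → w , p ⊢ ⟨ o , ρ , μ ⟩ ⇓[ suc t ] s
  jzero-passed {o = o} {ℓ = ℓ} e z h =
    step e (⇓-pc (cong (λ v → if v ≡ᵇ 0 then ℓ else suc o) (sym z)) h)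

  when-skip : ∀ {x b ρ μ} → ρ x ≡ 0 → Runs w (when x b) (ρ , μ) 1 (ρ , μ)
  when-skip z = running λ at h → jzero-taken (At-head at) z h

  when-take : ∀ {x b ρ μ v t σ} → ρ x ≡ suc v → Runs w b (ρ , μ) t σ →
    Runs w (when x b) (ρ , μ) (suc t) σ
  when-take {b = b} z r = running λ {p} {o} at h →
    jzero-passed (At-head at) z (resume r (At-tail at) (⇓-pc (+-suc o (size b)) h))

  while-exit : ∀ {c x b σ t ρ₁ μ₁} → Runs w c σ t (ρ₁ , μ₁) → ρ₁ x ≡ 0 →
    Runs w (while c x b) σ (t + 1) (ρ₁ , μ₁)
  while-exit {c} {t = t} r z = running λ {p} {o} {u} at h → ⇓-time (sym (+-assoc t 1 u))
    (resume r (At-++ˡ (code c o) at)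
       (jzero-taken (At-head (At-++ʳ (code c o) (code-size c o) at)) z h))

  while-iterate : ∀ {c x b σ t ρ₁ μ₁ v t₁ σ₂ t₂ σ₃} →
    Runs w c σ t (ρ₁ , μ₁) → ρ₁ x ≡ suc v → Runs w b (ρ₁ , μ₁) t₁ σ₂ →
    Runs w (while c x b) σ₂ t₂ σ₃ → Runs w (while c x b) σ (t + suc (t₁ + suc t₂)) σ₃
  while-iterate {c} {b = b} {t = t} {t₁ = t₁} {t₂ = t₂} r z rb rw = running λ {p} {o} {u} at h →
    let at′ = At-tail (At-++ʳ (code c o) (code-size c o) at)
        o′  = suc (o + size c)
    in ⇓-time (trans (cong (λ k → t + suc k) (sym (+-assoc t₁ (suc t₂) u)))
                     (sym (+-assoc t (suc (t₁ + suc t₂)) u)))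
       (resume r (At-++ˡ (code c o) at)
          (jzero-passed (At-head (At-++ʳ (code c o) (code-size c o) at)) z
            (resume rb (At-++ˡ (code b o′) at′)
              (step (At-head (At-++ʳ (code b o′) (code-size b o′) at′)) (resume rw at h)))))

-- Symbolic execution with degree bounds on register contents

<ᵇ-true : ∀ {m n} → m < n → (m <ᵇ n) ≡ true
<ᵇ-true {m} {n} h with m <ᵇ n | <⇒<ᵇ h
... | true | _ = refl

<ᵇ-true⁻¹ : ∀ m n → (m <ᵇ n) ≡ true → m < n
<ᵇ-true⁻¹ m n q = <ᵇ⇒< m n (subst T (sym q) tt)

<ᵇ-false : ∀ {m n} → n ≤ m → (m <ᵇ n) ≡ false
<ᵇ-false h = ¬-not λ q → ≤⇒≯ h (<ᵇ-true⁻¹ _ _ q)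

truncate-< : ∀ w {a} → a < 2 ^ w → truncate w a ≡ a
truncate-< w a< = m<n⇒m%n≡m ⦃ m^n≢0 2 w ⦄ a<

-- What an operation computes when nothing overflows (junk for the operations that the
-- symbolic execution below rejects), and a bound on the degree of the result in terms of
-- the degrees of the operands, where v has degree e if v ≤ B ^ e.

value : Op → ℕ → ℕ → ℕ
value add a b = a + b
value mul a b = a * b
value div a b = quotient a b
value mod a b = remainder a b
value eq  a b = bit (a ≡ᵇ b)
value lt  a b = bit (a <ᵇ b)
value _   a b = 0

degree : Op → ℕ → ℕ → Maybe ℕ
degree add i j = just (suc (i ⊔ j))
degree mul i j = just (i + j)
degree div i j = just i
degree mod i j = just i
degree eq  i j = just 0
degree lt  i j = just 0
degree _   i j = nothing

value-exact : ∀ o {w i j e a b} → degree o i j ≡ just e → value o a b < 2 ^ w →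
  ⟦ o ⟧ w a b ≡ value o a b
value-exact add {w} _ h = truncate-< w h
value-exact mul {w} _ h = truncate-< w h
value-exact div {w} _ h = truncate-< w h
value-exact mod {w} _ h = truncate-< w h
value-exact eq  {w} _ h = truncate-< w h
value-exact lt  {w} _ h = truncate-< w h

bit≤1 : ∀ b → bit b ≤ 1
bit≤1 true  = s≤s z≤n
bit≤1 false = z≤n

quotient≤ : ∀ a b → quotient a b ≤ a
quotient≤ a zero    = z≤n
quotient≤ a (suc b) = m/n≤m a (suc b)

remainder≤ : ∀ a b → remainder a b ≤ a
remainder≤ a zero    = ≤-refl
remainder≤ a (suc b) = m%n≤m a (suc b)

-- The entry just (v , e) claims that the register holds v and v ≤ B ^ e.

Entry Env : Set
Entry = Maybe (ℕ × ℕ)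
Env   = List Entry

infix 8 _!_

_!_ : Env → Reg → Entry
[]       ! r     = nothing
(x ∷ xs) ! zero  = x
(x ∷ xs) ! suc r = xs ! r

put : Env → Reg → Entry → Env
put []       r       y = []
put (x ∷ xs) zero    y = y ∷ xs
put (x ∷ xs) (suc r) y = x ∷ put xs r y

-- Words are taken so long that every value of degree less than D fits.
D : ℕ
D = 20

-- Rejection is `⊥`. Degrees in concrete code are numerals, so the comparison with `D` normalises
-- away and an accepted instruction leaves no overflow obligation.
checked : Maybe ℕ → (ℕ → Set) → Set
checked (just e) K = if e <ᵇ D then K e else ⊥
checked nothing  K = ⊥

arithVC : Op → Entry → Entry → (Entry → Set) → Set
arithVC o (just (a , i)) (just (b , j)) K = checked (degree o i j) λ e → K (just (value o a b , e))
arithVC _ _ _ _ = ⊥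

loadVC : Entry → Mem → (Entry → Set) → Set
loadVC (just (a , _)) μ K = K (just (μ a , 1))
loadVC nothing        μ K = ⊥

-- Stored values must have degree at most 1. This keeps every memory cell below `B`, which in turn
-- justifies the degree 1 that `loadVC` gives to whatever it reads.
storeVC : Entry → Entry → Mem → (Mem → Set) → Set
storeVC (just (a , _)) (just (b , i)) μ K = if i <ᵇ 2 then K (μ [ a ≔ b ]) else ⊥
storeVC _ _ _ _ = ⊥

Post : Set₁
Post = ℕ → Env → Mem → Set

module Logic (w B : ℕ) (2^w≡B^D : 2 ^ w ≡ B ^ D) (2≤B : 2 ≤ B) where

  -- On concrete code and a concrete environment this reduces to Q for the final state, together
  -- with bounds on the constants: the degrees dispose of all overflow conditions.
  VC : List Instr → (Env → Mem → Set) → Env → Mem → Set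
  VC []                   Q e μ = Q e μ
  VC (const r v ∷ is)     Q e μ = v ≤ B × VC is Q (put e r (just (v , 1))) μ
  VC (arith o r x y ∷ is) Q e μ = arithVC o (e ! x) (e ! y) λ z → VC is Q (put e r z) μ
  VC (load r x ∷ is)      Q e μ = loadVC (e ! x) μ λ z → VC is Q (put e r z) μ
  VC (store x y ∷ is)     Q e μ = storeVC (e ! x) (e ! y) μ λ μ′ → VC is Q e μ′
  VC (jump _ ∷ _)         Q e μ = ⊥
  VC (jzero _ _ ∷ _)      Q e μ = ⊥

  Meets : ℕ → Entry → Set
  Meets a z = ∀ {v i} → z ≡ just (v , i) → a ≡ v × v ≤ B ^ i

  infix 4 _⊨_ _⊒_

  _⊨_ : Regs → Env → Set
  ρ ⊨ e = ∀ r → Meets (ρ r) (e ! r)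

  Bounded : Mem → Set
  Bounded μ = ∀ a → μ a ≤ B

  instance
    B≢0 : NonZero B
    B≢0 = >-nonZero (≤-trans (s≤s z≤n) 2≤B)

  degree-sound : ∀ o {i j e a b} → degree o i j ≡ just e → a ≤ B ^ i → b ≤ B ^ j → value o a b ≤ B ^ e
  degree-sound add {i} {j} {a = a} {b} refl a≤ b≤ = begin
    a + b                          ≤⟨ +-mono-≤ (≤-trans a≤ (^-monoʳ-≤ B (m≤m⊔n i j))) (≤-trans b≤ (^-monoʳ-≤ B (m≤n⊔m i j))) ⟩
    B ^ (i ⊔ j) + B ^ (i ⊔ j)      ≡⟨ cong (B ^ (i ⊔ j) +_) (+-identityʳ _) ⟨
    2 * B ^ (i ⊔ j)                ≤⟨ *-monoˡ-≤ _ 2≤B ⟩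
    B * B ^ (i ⊔ j)                ∎
    where open ≤-Reasoning
  degree-sound mul {i} {j} refl a≤ b≤ = ≤-trans (*-mono-≤ a≤ b≤) (≤-reflexive (sym (^-distribˡ-+-* B i j)))
  degree-sound div {a = a} {b} refl a≤ b≤ = ≤-trans (quotient≤ a b) a≤
  degree-sound mod {a = a} {b} refl a≤ b≤ = ≤-trans (remainder≤ a b) a≤
  degree-sound eq refl a≤ b≤ = bit≤1 _
  degree-sound lt refl a≤ b≤ = bit≤1 _

  degree-fits : ∀ {v i} → i < D → v ≤ B ^ i → v < 2 ^ w
  degree-fits {v} {i} i<D v≤ = begin-strict
    v        ≤⟨ v≤ ⟩
    B ^ i    <⟨ ^-monoʳ-< B 2≤B i<D ⟩
    B ^ D    ≡⟨ 2^w≡B^D ⟨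
    2 ^ w    ∎
    where open ≤-Reasoning

  meets-just : ∀ {a v i} → a ≡ v → v ≤ B ^ i → Meets a (just (v , i))
  meets-just p q refl = p , q

  ⊨-put : ∀ {ρ e} r {v z} → ρ ⊨ e → Meets v z → (ρ [ r ≔ v ]) ⊨ put e r z
  ⊨-put {e = []} r ⊨e _ _ ()
  ⊨-put {e = x ∷ e} zero    ⊨e m zero    q = m q
  ⊨-put {e = x ∷ e} zero    ⊨e m (suc s) q = ⊨e (suc s) q
  ⊨-put {e = x ∷ e} (suc r) ⊨e m zero    q = ⊨e zero q
  ⊨-put {ρ} {e = x ∷ e} (suc r) ⊨e m (suc s) q = ⊨-put {ρ ∘ suc} {e} r (⊨e ∘ suc) m s q

  bounded-≔ : ∀ {μ a v} → Bounded μ → v ≤ B → Bounded (μ [ a ≔ v ])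
  bounded-≔ {a = a} b v≤ x with x ≡ᵇ a
  ... | true  = v≤
  ... | false = b x

  -- Needed to close loops. Incrementing a counter raises its degree, and `bump` lowers it again by
  -- means of the bound on the loop limit; it also replaces a value by a propositionally equal one,
  -- such as `y + 1` by `suc y`. `drop` forgets scratch registers.
  data _⊒_ : Env → Env → Set where
    none : ∀ {e} → e ⊒ []
    same : ∀ {x e e′} → e ⊒ e′ → (x ∷ e) ⊒ (x ∷ e′)
    drop : ∀ {x e e′} → e ⊒ e′ → (x ∷ e) ⊒ (nothing ∷ e′)
    bump : ∀ {u v i j e e′} → u ≡ v → v ≤ B ^ j → e ⊒ e′ → (just (u , i) ∷ e) ⊒ (just (v , j) ∷ e′)

  ⊒-refl : ∀ {e} → e ⊒ e
  ⊒-refl {[]}    = none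
  ⊒-refl {_ ∷ _} = same ⊒-refl

  ⊨-⊒ : ∀ {ρ e e′} → e ⊒ e′ → ρ ⊨ e → ρ ⊨ e′
  ⊨-⊒ none         ⊨e r       ()
  ⊨-⊒ (same h)     ⊨e zero    q = ⊨e zero q
  ⊨-⊒ (bump p b h) ⊨e zero    refl = trans (proj₁ (⊨e zero refl)) p , b
  ⊨-⊒ {ρ} (same h)     ⊨e (suc r) q = ⊨-⊒ {ρ ∘ suc} h (⊨e ∘ suc) r q
  ⊨-⊒ {ρ} (drop h)     ⊨e (suc r) q = ⊨-⊒ {ρ ∘ suc} h (⊨e ∘ suc) r q
  ⊨-⊒ {ρ} (bump _ _ h) ⊨e (suc r) q = ⊨-⊒ {ρ ∘ suc} h (⊨e ∘ suc) r q

  record Ends (b : Block) (Q : Post) (ρ : Regs) (μ : Mem) : Set where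
    constructor ends
    field
      {time}    : ℕ
      {regs′}   : Regs
      {mem′}    : Mem
      env′      : Env
      runs      : Runs w b (ρ , μ) time (regs′ , mem′)
      models    : regs′ ⊨ env′
      bounded   : Bounded mem′
      satisfies : Q time env′ mem′

  open Ends public

  record wp (b : Block) (Q : Post) (e : Env) (μ : Mem) : Set where
    constructor mkWp
    field start : ∀ {ρ} → ρ ⊨ e → Bounded μ → Ends b Q ρ μ

  open wp public

  wp-⇒ : ∀ {b Q Q′ e μ} → wp b Q e μ → (∀ t e′ μ′ → Q t e′ μ′ → Q′ t e′ μ′) → wp b Q′ e μ
  wp-⇒ h f = mkWp λ m bd → let r = start h m bd in
    ends (env′ r) (runs r) (models r) (bounded r) (f _ _ _ (satisfies r))

  wp-⊒ : ∀ {b Q e e′ μ} → e ⊒ e′ → wp b Q e′ μ → wp b Q e μ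
  wp-⊒ h r = mkWp λ {ρ} m bd → start r (⊨-⊒ {ρ} h m) bd

  -- Recovers the bound that an environment entry claims. Applied to the register of a loop limit,
  -- it supplies the bound on the incremented counter.
  wp-known : ∀ {b Q e μ v i} r → e ! r ≡ just (v , i) → (v ≤ B ^ i → wp b Q e μ) → wp b Q e μ
  wp-known r er f = mkWp λ m bd → start (f (proj₂ (m r er))) m bd

  ⊒-++ : ∀ e {e₁ e₂} → e₁ ⊒ e₂ → (e ++ e₁) ⊒ (e ++ e₂)
  ⊒-++ []      h = h
  ⊒-++ (_ ∷ e) h = same (⊒-++ e h)

  wp-⨾ : ∀ {b b′ Q R e μ} → wp b Q e μ →
    (∀ t e₁ μ₁ → Q t e₁ μ₁ → wp b′ (λ t′ → R (t + t′)) e₁ μ₁) → wp (b ⨾ b′) R e μ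
  wp-⨾ h f = mkWp λ m bd →
    let r  = start h m bd
        r′ = start (f _ _ _ (satisfies r)) (models r) (bounded r)
    in ends (env′ r′) (runs-⨾ (runs r) (runs r′)) (models r′) (bounded r′) (satisfies r′)

  private
    within : ∀ {i n} {X : Set} → (if i <ᵇ n then X else ⊥) → i < n × X
    within {i} {n} x with i <ᵇ n in q
    ... | true = <ᵇ-true⁻¹ i n q , x

    straight-ends : ∀ is {Q e μ ρ} → VC is Q e μ → ρ ⊨ e → Bounded μ →
      Ends (straight is) (λ t e′ μ′ → t ≡ length is × Q e′ μ′) ρ μ

    prepend : ∀ {i is} {Q : Env → Mem → Set} {ρ μ ρ′ μ′} →
      (∀ o → exec w i ⟨ o , ρ , μ ⟩ ≡ ⟨ suc o , ρ′ , μ′ ⟩) →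
      Ends (straight is) (λ t e′ μ′ → t ≡ length is × Q e′ μ′) ρ′ μ′ →
      Ends (straight (i ∷ is)) (λ t e′ μ′ → t ≡ suc (length is) × Q e′ μ′) ρ μ
    prepend {is = is} {Q} h r = ends (env′ r) (runs-∷ h (runs r)) (models r) (bounded r)
      (cong suc (proj₁ (satisfies r)) , proj₂ (satisfies r))

    straight-ends [] q m bd = ends _ runs-[] m bd (refl , q)
    straight-ends (const r v ∷ is) {Q} {e = e} {ρ = ρ} (v≤ , vc) m bd = prepend {is = is} {Q} (λ _ → refl)
      (straight-ends is {Q} vc
        (⊨-put {ρ} {e} r m (meets-just (truncate-< w (degree-fits (s≤s (s≤s z≤n)) v≤¹)) v≤¹)) bd)
      where v≤¹ = ≤-trans v≤ (≤-reflexive (sym (*-identityʳ B)))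
    straight-ends (arith o r x y ∷ is) {Q} {e = e} {ρ = ρ} vc m bd
      with e ! x in ex | e ! y in ey
    ... | just (a , i) | just (b , j) with degree o i j in ed
    ... | just k with refl , a≤ ← m x ex | refl , b≤ ← m y ey | k<D , vc′ ← within {k} {D} vc =
      prepend {is = is} {Q} (λ _ → refl) (straight-ends is {Q} vc′ (⊨-put {ρ} {e} r m
        (meets-just (value-exact o ed (degree-fits k<D bound)) bound)) bd)
      where bound = degree-sound o ed a≤ b≤
    straight-ends (load r x ∷ is) {Q} {e = e} {μ} {ρ} vc m bd with e ! x in ex
    ... | just (a , i) with refl , _ ← m x ex = prepend {is = is} {Q} (λ _ → refl)
      (straight-ends is {Q} vc (⊨-put {ρ} {e} r m
        (meets-just refl (≤-trans (bd _) (≤-reflexive (sym (*-identityʳ B)))))) bd)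
    straight-ends (store x y ∷ is) {Q} {e = e} {μ} {ρ} vc m bd with e ! x in ex | e ! y in ey
    ... | just (a , i) | just (b , j)
      with refl , _ ← m x ex | refl , b≤ ← m y ey | j<2 , vc′ ← within {j} {2} vc =
      prepend {is = is} {Q} (λ _ → refl) (straight-ends is {Q} vc′ m (bounded-≔ bd
        (≤-trans b≤ (≤-trans (^-monoʳ-≤ B (s≤s⁻¹ j<2)) (≤-reflexive (*-identityʳ B))))))

  wp-straight : ∀ is {Q e μ} → VC is (Q (length is)) e μ → wp (straight is) Q e μ
  wp-straight is {Q} vc = mkWp λ m bd → let r = straight-ends is {Q (length is)} vc m bd in
    ends (env′ r) (runs r) (models r) (bounded r)
      (subst (λ t → Q t (env′ r) (mem′ r)) (sym (proj₁ (satisfies r))) (proj₂ (satisfies r)))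

  wp-when : ∀ {b x Q e μ v i} → e ! x ≡ just (v , i) →
    (v ≡ 0 → Q 1 e μ) → (v ≢ 0 → wp b (λ t → Q (suc t)) e μ) → wp (when x b) Q e μ
  wp-when {x = x} {v = zero} ex f _ = mkWp λ m bd →
    ends _ (when-skip (proj₁ (m x ex))) m bd (f refl)
  wp-when {x = x} {v = suc v} ex _ f = mkWp λ m bd → let r = start (f λ ()) m bd in
    ends (env′ r) (when-take (proj₁ (m x ex)) (runs r)) (models r) (bounded r) (satisfies r)

  -- I x u μ relates the number x of completed iterations, the time u so far and the memory.
  wp-while : ∀ {C r b M i} (E F : ℕ → Env) (I : ℕ → ℕ → Mem → Set) →
    (∀ x μ → VC C (λ e μ′ → e ≡ F x × μ′ ≡ μ) (E x) μ) →
    (∀ x → F x ! r ≡ just (bit (x <ᵇ M) , i)) →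
    (∀ x u μ → x < M → I x u μ →
      wp b (λ u′ e μ′ → e ⊒ E (suc x) × I (suc x) (u + (length C + (u′ + 2))) μ′) (F x) μ) →
    ∀ {u μ} → I 0 u μ →
    wp (while (straight C) r b)
       (λ u′ e μ′ → e ≡ F M × ∃[ v ] I M v μ′ × u + u′ ≡ v + (length C + 1)) (E 0) μ
  wp-while {C} {r} {b} {M} E F I test flag body = λ i → mkWp λ m bd → go M 0 refl i m bd
    where
    Q : ℕ → Post
    Q u u′ e μ′ = e ≡ F M × ∃[ v ] I M v μ′ × u + u′ ≡ v + (length C + 1)

    go : ∀ k x → x + k ≡ M → ∀ {u μ ρ} → I x u μ → ρ ⊨ E x → Bounded μ →
      Ends (while (straight C) r b) (Q u) ρ μ
    go k x xk {u} {μ} inv m bd with straight-ends C (test x μ) m bd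
    go zero x xk {u} {μ} inv m bd | ends e₁ rn m₁ bd₁ (refl , refl , refl)
      with refl ← trans (sym (+-identityʳ x)) xk =
      ends _ (while-exit rn (trans (proj₁ (m₁ r (flag x))) (cong bit (<ᵇ-false (≤-refl {x}))))) m₁ bd₁
        (refl , u , inv , refl)
    go (suc k) x xk {u} {μ} inv m bd | ends e₁ rn m₁ bd₁ (refl , refl , refl) =
      ends (env′ r₂)
        (while-iterate rn (trans (proj₁ (m₁ r (flag x))) (cong bit (<ᵇ-true x<M))) (runs r₁) (runs r₂))
        (models r₂) (bounded r₂)
        (proj₁ (satisfies r₂) , v , proj₁ (proj₂ (proj₂ (satisfies r₂))) ,
         trans (shuffle u (length C) (time r₁) (time r₂)) (proj₂ (proj₂ (proj₂ (satisfies r₂)))))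
      where
      x<M = subst (x <_) xk (m<m+n x (s≤s z≤n))
      r₁ = start (body x u μ x<M inv) m₁ bd₁
      r₂ = go k (suc x) (trans (sym (+-suc x k)) xk) (proj₂ (satisfies r₁))
             (⊨-⊒ {regs′ r₁} (proj₁ (satisfies r₁)) (models r₁)) (bounded r₁)
      v = proj₁ (proj₂ (satisfies r₂))
      shuffle : ∀ u c t₁ t₂ → u + (c + suc (t₁ + suc t₂)) ≡ u + (c + (t₁ + 2)) + t₂
      shuffle = solve-∀

  wp-while-const : ∀ {C r b M i} (E F : ℕ → Env) (K : ℕ) (J : ℕ → Mem → Set) →
    (∀ x μ → VC C (λ e μ′ → e ≡ F x × μ′ ≡ μ) (E x) μ) →
    (∀ x → F x ! r ≡ just (bit (x <ᵇ M) , i)) →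
    (∀ x μ → x < M → J x μ →
      wp b (λ u e μ′ → e ⊒ E (suc x) × length C + (u + 2) ≤ K × J (suc x) μ′) (F x) μ) →
    ∀ {μ} → J 0 μ →
    wp (while (straight C) r b)
       (λ u e μ′ → e ≡ F M × u ≤ M * K + (length C + 1) × J M μ′) (E 0) μ
  wp-while-const {C} {M = M} E F K J test flag body {μ} j =
    wp-⇒ (wp-while {C} E F (λ x u μ′ → u ≤ x * K × J x μ′) test flag
           (λ x u μ′ x<M (u≤ , j) → wp-⇒ (body x μ′ x<M j)
              λ t _ _ (h , t≤ , j′) → h , ≤-trans (+-mono-≤ u≤ t≤) (≤-reflexive (+-comm (x * K) K)) , j′)
           (z≤n , j))
      λ t _ _ (h , v , (v≤ , j′) , q) → h , ≤-trans (≤-reflexive q) (+-monoˡ-≤ _ v≤) , j′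

-- Arithmetic modulo 2 ^ w on a machine with longer words

2^≢0 : ∀ w → NonZero (2 ^ w)
2^≢0 w = m^n≢0 2 w

truncate-≤ : ∀ w a → truncate w a < 2 ^ w
truncate-≤ w a = m%n<n a (2 ^ w) ⦃ 2^≢0 w ⦄

truncate-+* : ∀ w a k → truncate w (a + k * 2 ^ w) ≡ truncate w a
truncate-+* w a k = [m+kn]%n≡m%n a k (2 ^ w) ⦃ 2^≢0 w ⦄

2^-split : ∀ {w W} → w ≤ W → 2 ^ W ≡ 2 ^ (W ∸ w) * 2 ^ w
2^-split {w} {W} w≤W = trans (cong (2 ^_) (sym (m∸n+n≡m w≤W))) (^-distribˡ-+-* 2 (W ∸ w) w)

truncate-truncate : ∀ {w W} a → w ≤ W → truncate w (truncate W a) ≡ truncate w a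
truncate-truncate {w} {W} a w≤W =
  m∣n⇒o%n%m≡o%m (2 ^ w) (2 ^ W) a ⦃ 2^≢0 w ⦄ ⦃ 2^≢0 W ⦄ (divides (2 ^ (W ∸ w)) (2^-split w≤W))

bitwise-< : ∀ f w a b → bitwise f w a b < 2 ^ w
bitwise-< f zero    a b = s≤s z≤n
bitwise-< f (suc w) a b = ≤-trans
  (s≤s (+-mono-≤ (bit≤1 (f (a % 2 ≡ᵇ 1) (b % 2 ≡ᵇ 1))) ≤-refl))
  (≤-trans (≤-reflexive (lemma _)) (*-monoʳ-≤ 2 (bitwise-< f w (a / 2) (b / 2))))
  where
  lemma : ∀ x → suc (1 + 2 * x) ≡ 2 * suc x
  lemma = solve-∀

bitwise-low : ∀ f {w W} a b → w ≤ W → ∃[ k ] bitwise f W a b ≡ bitwise f w a b + k * 2 ^ w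
bitwise-low f {W = W} a b z≤n = bitwise f W a b , sym (*-identityʳ _)
bitwise-low f {suc w} {suc W} a b (s≤s h) with k , e ← bitwise-low f (a / 2) (b / 2) h =
  k , trans (cong (λ x → bit (f (a % 2 ≡ᵇ 1) (b % 2 ≡ᵇ 1)) + 2 * x) e)
    (lemma (bit (f (a % 2 ≡ᵇ 1) (b % 2 ≡ᵇ 1))) (bitwise f w (a / 2) (b / 2)) k (2 ^ w))
  where
  lemma : ∀ c x k p → c + 2 * (x + k * p) ≡ c + 2 * x + k * (2 * p)
  lemma = solve-∀

truncate-bitwise : ∀ f {w W} a b → w ≤ W → truncate w (bitwise f W a b) ≡ bitwise f w a b
truncate-bitwise f {w} {W} a b w≤W with k , e ← bitwise-low f a b w≤W =
  trans (cong (truncate w) e) (trans (truncate-+* w _ k) (truncate-< w (bitwise-< f w a b)))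

-- As 2 ^ w divides 2 ^ W, truncating twice is truncating once, which settles every operation that
-- truncates a number not depending on the word length. The bitwise operations agree in their low
-- digits. For `sub`, the numbers 2 ^ W ∸ b and 2 ^ w ∸ b differ by a multiple of 2 ^ w; this is
-- where `b < 2 ^ w` enters.
⟦⟧-truncate : ∀ o {w W a b} → w ≤ W → b < 2 ^ w → truncate w (⟦ o ⟧ W a b) ≡ ⟦ o ⟧ w a b
⟦⟧-truncate add h _ = truncate-truncate _ h
⟦⟧-truncate mul h _ = truncate-truncate _ h
⟦⟧-truncate div h _ = truncate-truncate _ h
⟦⟧-truncate mod h _ = truncate-truncate _ h
⟦⟧-truncate shl h _ = truncate-truncate _ h
⟦⟧-truncate shr h _ = truncate-truncate _ h
⟦⟧-truncate eq  h _ = truncate-truncate _ h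
⟦⟧-truncate lt  h _ = truncate-truncate _ h
⟦⟧-truncate and h _ = truncate-bitwise _ _ _ h
⟦⟧-truncate or  h _ = truncate-bitwise _ _ _ h
⟦⟧-truncate xor h _ = truncate-bitwise _ _ _ h
⟦⟧-truncate sub {w} {W} {a} {b} h b< = trans (truncate-truncate _ h)
  (trans (cong (truncate w) wrap) (truncate-+* w _ (pred (2 ^ (W ∸ w)))))
  where
  open ≡-Reasoning
  instance _ = 2^≢0 (W ∸ w)
  wrap : a + (2 ^ W ∸ b) ≡ a + (2 ^ w ∸ b) + pred (2 ^ (W ∸ w)) * 2 ^ w
  wrap = begin
    a + (2 ^ W ∸ b)                                      ≡⟨ cong (λ x → a + (x ∸ b)) (2^-split h) ⟩
    a + (2 ^ (W ∸ w) * 2 ^ w ∸ b)                        ≡⟨ cong (λ x → a + (x * 2 ^ w ∸ b)) (suc-pred (2 ^ (W ∸ w))) ⟨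
    a + (2 ^ w + pred (2 ^ (W ∸ w)) * 2 ^ w ∸ b)         ≡⟨ cong (a +_) (+-∸-comm _ (<⇒≤ b<)) ⟩
    a + ((2 ^ w ∸ b) + pred (2 ^ (W ∸ w)) * 2 ^ w)       ≡⟨ +-assoc a _ _ ⟨
    a + (2 ^ w ∸ b) + pred (2 ^ (W ∸ w)) * 2 ^ w         ∎

remainder-% : ∀ a b .⦃ nz : NonZero b ⦄ → remainder a b ≡ a % b
remainder-% a (suc b) = refl

quotient-/ : ∀ a b .⦃ nz : NonZero b ⦄ → quotient a b ≡ a / b
quotient-/ a (suc b) = refl

mod-2^ : ∀ {w W} a → w ≤ W → ⟦ mod ⟧ W a (2 ^ w) ≡ truncate w a
mod-2^ {w} {W} a w≤W = trans (cong (truncate W) (remainder-% a (2 ^ w) ⦃ 2^≢0 w ⦄))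
  (truncate-< W (≤-trans (truncate-≤ w a) (^-monoʳ-≤ 2 w≤W)))

exec-< : ∀ o w a b → ⟦ o ⟧ w a b < 2 ^ w
exec-< add w a b = truncate-≤ w _
exec-< sub w a b = truncate-≤ w _
exec-< mul w a b = truncate-≤ w _
exec-< div w a b = truncate-≤ w _
exec-< mod w a b = truncate-≤ w _
exec-< and w a b = bitwise-< _ w a b
exec-< or  w a b = bitwise-< _ w a b
exec-< xor w a b = bitwise-< _ w a b
exec-< shl w a b = truncate-≤ w _
exec-< shr w a b = truncate-≤ w _
exec-< eq  w a b = truncate-≤ w _
exec-< lt  w a b = truncate-≤ w _

≔-same : ∀ {f : ℕ → ℕ} {a v} → (f [ a ≔ v ]) a ≡ v
≔-same {a = a} with a ≡ᵇ a in q
... | true  = refl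
... | false = ⊥-elim (subst T q (≡⇒≡ᵇ a a refl))

≔-other : ∀ (f : ℕ → ℕ) {a v b} → b ≢ a → (f [ a ≔ v ]) b ≡ f b
≔-other f {a = a} {b = b} b≢a with b ≡ᵇ a in q
... | true  = contradiction (≡ᵇ⇒≡ b a (subst T (sym q) tt)) b≢a
... | false = refl

≔-pred : ∀ (P : ℕ → Set) (f : ℕ → ℕ) {a v} b → P v → P (f b) → P ((f [ a ≔ v ]) b)
≔-pred P f {a = a} b pv pf with b ≡ᵇ a
... | true  = pv
... | false = pf

-- rEA and rEB hold the addresses of the two arrays of groups, rBase the address of the memory of the
-- next simulated run; from rX on, registers are reused.

rN rD rOne rS rP rDD rG rSD rND rNN rEA rEB rStride rGG rSS rRows : Reg
rN = 0 ; rD = 1 ; rOne = 2 ; rS = 3 ; rP = 4 ; rDD = 5 ; rG = 6 ; rSD = 7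
rND = 8 ; rNN = 9 ; rEA = 10 ; rEB = 11 ; rStride = 12 ; rGG = 13 ; rSS = 14 ; rRows = 15

rBase rQ rX rC rIA rJB rT rU rV rAcc rW rK : Reg
rBase = 16 ; rQ = 17 ; rX = 18 ; rC = 19 ; rIA = 20 ; rJB = 21 ; rT = 22 ; rU = 23
rV = 24 ; rAcc = 25 ; rW = 26 ; rK = 27

-- Register r of a simulated program is kept in register 28 + r.
K : ℕ
K = 28

-- Simulating a program on w-bit words, with its memory moved to the address in rBase and
-- 2 ^ w in rP; every instruction becomes two.

maxReg : Instr → ℕ
maxReg (const r v)     = r
maxReg (arith o r x y) = r ⊔ (x ⊔ y)
maxReg (load r x)      = r ⊔ x
maxReg (store x y)     = x ⊔ y
maxReg (jump ℓ)        = 0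
maxReg (jzero x ℓ)     = x

-- The floor 2 covers the input registers 0 and 1, even if the program does not name them; the
-- answer is read from register 0.
regBound : Program → ℕ
regBound []       = 2
regBound (i ∷ is) = suc (maxReg i) ⊔ regBound is

2≤regBound : ∀ p → 2 ≤ regBound p
2≤regBound []      = ≤-refl
2≤regBound (i ∷ p) = ≤-trans (2≤regBound p) (m≤n⊔m _ _)

maxReg<regBound : ∀ p j {i} → p ‼ j ≡ just i → maxReg i < regBound p
maxReg<regBound (i ∷ p) zero    refl = m≤m⊔n _ (regBound p)
maxReg<regBound (_ ∷ p) (suc j) e    = ≤-trans (maxReg<regBound p j e) (m≤n⊔m _ (regBound p))

module Translation (len : ℕ) (o : Label) where

  -- Every jump out of the text halts the simulated program, wherever it leads. All such labels are
  -- therefore sent to the end of the block, where the surrounding program continues.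
  target : Label → Label
  target ℓ = o + (ℓ ⊓ len) * 2

  -- A fixed length of two keeps label arithmetic linear. The filler after a `jump` is never
  -- reached, and the one after a `jzero` only spoils the scratch register `rT`. A `load` needs no
  -- reduction because the cells of the simulated memory are kept below 2 ^ w.
  first second : Instr → Instr
  first (const r v)      = const (K + r) v
  first (arith op r x y) = arith op (K + r) (K + x) (K + y)
  first (load r x)       = arith add rT rBase (K + x)
  first (store x y)      = arith add rT rBase (K + x)
  first (jump ℓ)         = jump (target ℓ)
  first (jzero x ℓ)      = jzero (K + x) (target ℓ)
  second (const r v)      = arith mod (K + r) (K + r) rP
  second (arith op r x y) = arith mod (K + r) (K + r) rP
  second (load r x)       = load (K + r) rT
  second (store x y)      = store rT (K + y)
  second (jump ℓ)         = const rT 0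
  second (jzero x ℓ)      = const rT 0

  translate : Program → Program
  translate []      = []
  translate (i ∷ p) = first i ∷ second i ∷ translate p

  length-translate : ∀ p → length (translate p) ≡ length p * 2
  length-translate []      = refl
  length-translate (_ ∷ p) = cong (suc ∘ suc) (length-translate p)

  fetch-first : ∀ p j {i} → p ‼ j ≡ just i → translate p ‼ (j * 2) ≡ just (first i)
  fetch-first (i ∷ p) zero    refl = refl
  fetch-first (_ ∷ p) (suc j) e    = fetch-first p j e

  fetch-second : ∀ p j {i} → p ‼ j ≡ just i → translate p ‼ suc (j * 2) ≡ just (second i)
  fetch-second (i ∷ p) zero    refl = refl
  fetch-second (_ ∷ p) (suc j) e    = fetch-second p j e

translated : Program → Block
translated p .size        = length p * 2
translated p .code      o = Translation.translate (length p) o p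
translated p .code-size o = Translation.length-translate (length p) o p

-- Registers, unlike memory, are reused by successive calls. Only those below `regBound p` matter,
-- so zeroing them costs a constant.
clear : ℕ → List Instr
clear zero    = []
clear (suc r) = const (K + r) 0 ∷ clear r

‼-< : ∀ {A : Set} (p : List A) j {i} → p ‼ j ≡ just i → j < length p
‼-< (_ ∷ p) zero    e = s≤s z≤n
‼-< (_ ∷ p) (suc j) e = s≤s (‼-< p j e)

‼-≥ : ∀ {A : Set} (p : List A) j → p ‼ j ≡ nothing → length p ≤ j
‼-≥ []      j       e = z≤n
‼-≥ (_ ∷ p) (suc j) e = s≤s (‼-≥ p j e)

K+≢ : ∀ {s} r → s < K → s ≢ K + r
K+≢ r s<K refl = <⇒≱ s<K (m≤m+n K r)

module Simulation (W w base : ℕ) (p : Program) (w≤W : w ≤ W) (fits : base + 2 ^ w ≤ 2 ^ W)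
                  (ρ₀ : Regs) (μ₀ : Mem) (ρ₀-P : ρ₀ rP ≡ 2 ^ w) (ρ₀-base : ρ₀ rBase ≡ base) where

  R = regBound p
  len = length p

  -- The simulated machine owns the 2 ^ w cells from `base` on. Its registers stay below 2 ^ w,
  -- hence so do its addresses, and it cannot leave that region; this is what makes `frame` an
  -- invariant. `mem<` is there so that a load preserves `regs<`.
  record Simulates (s : State) (ρ : Regs) (μ : Mem) : Set where
    field
      regs≡ : ∀ {r} → r < R → ρ (K + r) ≡ regs s r
      regs< : ∀ {r} → r < R → regs s r < 2 ^ w
      mem≡  : ∀ {a} → a < 2 ^ w → μ (base + a) ≡ mem s a
      mem<  : ∀ {a} → a < 2 ^ w → mem s a < 2 ^ w
      own   : ∀ {r} → r < K → r ≢ rT → ρ r ≡ ρ₀ r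
      frame : ∀ {a} → a < base ⊎ base + 2 ^ w ≤ a → μ a ≡ μ₀ a

  open Simulates public

  record Moves (s s′ : State) (ρ : Regs) (μ : Mem) (n : ℕ) : Set where
    field
      {dur}   : ℕ
      {ρ′ μ′} : ℕ → ℕ
      dur≤    : dur ≤ n
      after   : Simulates s′ ρ′ μ′
      moves   : ∀ {prog o u fin} → At prog o (code (translated p) o) →
        W , prog ⊢ ⟨ o + (pc s′ ⊓ len) * 2 , ρ′ , μ′ ⟩ ⇓[ u ] fin →
        W , prog ⊢ ⟨ o + (pc s ⊓ len) * 2 , ρ , μ ⟩ ⇓[ dur + u ] fin

  open Moves public

  private
    two-steps : ∀ {s i ρ μ ρ₁ μ₁ ρ₂ μ₂} → p ‼ pc s ≡ just i →
      (∀ o → Translation.first len o i ≡ Translation.first len 0 i) →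
      (∀ o → Translation.second len o i ≡ Translation.second len 0 i) →
      (∀ j → exec W (Translation.first len 0 i) ⟨ j , ρ , μ ⟩ ≡ ⟨ suc j , ρ₁ , μ₁ ⟩) →
      (∀ j → exec W (Translation.second len 0 i) ⟨ j , ρ₁ , μ₁ ⟩ ≡ ⟨ suc j , ρ₂ , μ₂ ⟩) →
      ∀ {prog o u fin} → At prog o (code (translated p) o) →
      W , prog ⊢ ⟨ o + (suc (pc s) ⊓ len) * 2 , ρ₂ , μ₂ ⟩ ⇓[ u ] fin →
      W , prog ⊢ ⟨ o + (pc s ⊓ len) * 2 , ρ , μ ⟩ ⇓[ 2 + u ] fin
    two-steps {s} e f₁ f₂ e₁ e₂ {prog} {o} at h =
      ⇓-pc (cong (λ x → o + x * 2) (sym (m≤n⇒m⊓n≡m (<⇒≤ pc<))))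
        (step (fetch at _ (trans (Translation.fetch-first len o p _ e) (cong just (f₁ o))))
          (subst (W , prog ⊢_⇓[ _ ] _) (sym (e₁ _))
            (⇓-pc (+-suc o _)
              (step (fetch at _ (trans (Translation.fetch-second len o p _ e) (cong just (f₂ o))))
                (subst (W , prog ⊢_⇓[ _ ] _) (sym (e₂ _))
                  (⇓-pc (trans (cong (λ x → o + x * 2) (m≤n⇒m⊓n≡m pc<))
                               (+-suc o (suc (pc s * 2)))) h))))))
      where pc< = ‼-< p (pc s) e

    below : ∀ {i} j → p ‼ j ≡ just i → ∀ {r} → r ≤ maxReg i → r < R
    below j e r≤ = ≤-<-trans r≤ (maxReg<regBound p j e)

    own< : ∀ {ρ s} r {v} → s < K → ρ s ≡ ρ₀ s → (ρ [ K + r ≔ v ]) s ≡ ρ₀ s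
    own< {ρ} r s<K e = trans (≔-other ρ (K+≢ r s<K)) e

    at-P : ∀ {s ρ μ} → Simulates s ρ μ → ρ rP ≡ 2 ^ w
    at-P sm = trans (own sm (<ᵇ⇒< rP K tt) (λ ())) ρ₀-P

    at-base : ∀ {s ρ μ} → Simulates s ρ μ → ρ rBase ≡ base
    at-base sm = trans (own sm (<ᵇ⇒< rBase K tt) (λ ())) ρ₀-base

    reduced : ∀ {ρ : Regs} r a → ρ rP ≡ 2 ^ w →
      ⟦ mod ⟧ W ((ρ [ K + r ≔ a ]) (K + r)) (ρ rP) ≡ truncate w a
    reduced {ρ} r a e = trans (cong₂ (⟦ mod ⟧ W) (≔-same {ρ} {K + r}) e) (mod-2^ a w≤W)

    write : ∀ {s ρ μ} r j a {v v′} → v ≡ v′ → v′ < 2 ^ w → Simulates s ρ μ →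
      Simulates ⟨ j , regs s [ r ≔ v′ ] , mem s ⟩ ((ρ [ K + r ≔ a ]) [ K + r ≔ v ]) μ
    write {s} {ρ} r j a {v} {v′} e v′< sm = record
      { regs≡ = λ {r′} → match r′
      ; regs< = λ {r′} h → ≔-pred (_< 2 ^ w) (regs s) r′ v′< (regs< sm h)
      ; mem≡ = mem≡ sm ; mem< = mem< sm ; frame = frame sm
      ; own = λ h h′ → own< {ρ [ K + r ≔ a ]} r h (own< {ρ} r h (own sm h h′))
      }
      where
      match : ∀ r′ → r′ < R → ((ρ [ K + r ≔ a ]) [ K + r ≔ v ]) (K + r′) ≡ (regs s [ r ≔ v′ ]) r′
      match r′ h with r′ ≡ᵇ r
      ... | true  = e
      ... | false = regs≡ sm h

    scratch : ∀ {s ρ μ} j a → Simulates s ρ μ → Simulates ⟨ j , regs s , mem s ⟩ (ρ [ rT ≔ a ]) μ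
    scratch {s} {ρ} j a sm = record
      { regs≡ = regs≡ sm ; regs< = regs< sm ; mem≡ = mem≡ sm ; mem< = mem< sm ; frame = frame sm
      ; own = λ h h′ → trans (≔-other ρ h′) (own sm h h′)
      }

    address : ∀ {s ρ μ} → Simulates s ρ μ → ∀ {x} → x < R →
      ⟦ add ⟧ W (ρ rBase) (ρ (K + x)) ≡ base + regs s x
    address sm x<R = trans (cong₂ (⟦ add ⟧ W) (at-base sm) (regs≡ sm x<R))
      (truncate-< W (<-≤-trans (+-monoʳ-< base (regs< sm x<R)) fits))

    read : ∀ {s ρ μ} r x j → x < R → Simulates s ρ μ →
      Simulates ⟨ j , regs s [ r ≔ mem s (regs s x) ] , mem s ⟩
                ((ρ [ rT ≔ ⟦ add ⟧ W (ρ rBase) (ρ (K + x)) ])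
                   [ K + r ≔ μ (⟦ add ⟧ W (ρ rBase) (ρ (K + x))) ]) μ
    read {s} {ρ} {μ} r x j x<R sm = record
      { regs≡ = λ {r′} → match r′
      ; regs< = λ {r′} h → ≔-pred (_< 2 ^ w) (regs s) r′ (mem< sm (regs< sm x<R)) (regs< sm h)
      ; mem≡ = mem≡ sm ; mem< = mem< sm ; frame = frame sm
      ; own = λ h h′ → own< {ρ [ rT ≔ _ ]} r h (trans (≔-other ρ h′) (own sm h h′))
      }
      where
      addr = ⟦ add ⟧ W (ρ rBase) (ρ (K + x))
      match : ∀ r′ → r′ < R →
        ((ρ [ rT ≔ addr ]) [ K + r ≔ μ addr ]) (K + r′) ≡ (regs s [ r ≔ mem s (regs s x) ]) r′
      match r′ h with r′ ≡ᵇ r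
      ... | true  = trans (cong μ (address sm x<R)) (mem≡ sm (regs< sm x<R))
      ... | false = regs≡ sm h

    written : ∀ {s ρ μ} x y j → x < R → y < R → Simulates s ρ μ →
      Simulates ⟨ j , regs s , mem s [ regs s x ≔ regs s y ] ⟩
                (ρ [ rT ≔ ⟦ add ⟧ W (ρ rBase) (ρ (K + x)) ])
                (μ [ ⟦ add ⟧ W (ρ rBase) (ρ (K + x)) ≔ ρ (K + y) ])
    written {s} {ρ} {μ} x y j x<R y<R sm
      rewrite address sm x<R | regs≡ sm y<R = record
      { regs≡ = regs≡ sm ; regs< = regs< sm
      ; mem≡ = λ {a} → match a
      ; mem< = λ {a} h → ≔-pred (_< 2 ^ w) (mem s) a (regs< sm y<R) (mem< sm h)
      ; frame = λ {a} h → trans (≔-other μ (outside a h)) (frame sm h)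
      ; own = λ h h′ → trans (≔-other ρ h′) (own sm h h′)
      }
      where
      match : ∀ a → a < 2 ^ w →
        (μ [ base + regs s x ≔ regs s y ]) (base + a) ≡ (mem s [ regs s x ≔ regs s y ]) a
      match a h with a ≡ᵇ regs s x in q
      ... | true  rewrite ≡ᵇ⇒≡ a _ (subst T (sym q) tt) = ≔-same {μ} {base + regs s x}
      ... | false = trans (≔-other μ λ h′ → subst T q (≡⇒≡ᵇ a _ (+-cancelˡ-≡ base a _ h′))) (mem≡ sm h)
      outside : ∀ a → a < base ⊎ base + 2 ^ w ≤ a → a ≢ base + regs s x
      outside a (inj₁ h) refl = <⇒≱ h (m≤m+n base _)
      outside a (inj₂ h) refl = <⇒≱ (regs< sm x<R) (+-cancelˡ-≤ base _ _ h)

  move : ∀ {s ρ μ} i → p ‼ pc s ≡ just i → Simulates s ρ μ → Moves s (exec w i s) ρ μ 2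
  move {s} {ρ} {μ} (const r v) e sm = record
    { dur≤  = ≤-refl
    ; after = write {s} {ρ} r _ (truncate W v)
        (trans (reduced {ρ} r (truncate W v) (at-P sm)) (truncate-truncate v w≤W)) (truncate-≤ w v) sm
    ; moves = two-steps {s} e (λ _ → refl) (λ _ → refl) (λ _ → refl) (λ _ → refl)
    }
  move {s} {ρ} {μ} (arith op r x y) e sm = record
    { dur≤  = ≤-refl
    ; after = write {s} {ρ} r _ (⟦ op ⟧ W (ρ (K + x)) (ρ (K + y)))
        (trans (reduced {ρ} r _ (at-P sm))
          (trans (cong₂ (λ a b → truncate w (⟦ op ⟧ W a b)) (regs≡ sm x<R) (regs≡ sm y<R))
            (⟦⟧-truncate op w≤W (regs< sm y<R))))
        (exec-< op w (regs s x) (regs s y)) sm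
    ; moves = two-steps {s} e (λ _ → refl) (λ _ → refl) (λ _ → refl) (λ _ → refl)
    }
    where
    x<R = below (pc s) e (≤-trans (m≤m⊔n x y) (m≤n⊔m r (x ⊔ y)))
    y<R = below (pc s) e (≤-trans (m≤n⊔m x y) (m≤n⊔m r (x ⊔ y)))
  move {s} {ρ} {μ} (load r x) e sm = record
    { dur≤  = ≤-refl
    ; after = read {s} {ρ} r x _ (below (pc s) e (m≤n⊔m r x)) sm
    ; moves = two-steps {s} e (λ _ → refl) (λ _ → refl) (λ _ → refl) (λ _ → refl)
    }
  move {s} {ρ} {μ} (store x y) e sm = record
    { dur≤  = ≤-refl
    ; after = written {s} {ρ} x y _ (below (pc s) e (m≤m⊔n x y)) (below (pc s) e (m≤n⊔m x y)) sm
    ; moves = two-steps {s} e (λ _ → refl) (λ _ → refl) (λ _ → refl) (λ _ → refl)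
    }
  move {s} {ρ} {μ} (jump ℓ) e sm = record
    { dur≤  = s≤s z≤n
    ; after = record { Simulates sm }
    ; moves = λ {prog} {o} at h →
        ⇓-pc (cong (λ x → o + x * 2) (sym (m≤n⇒m⊓n≡m (<⇒≤ (‼-< p (pc s) e)))))
          (step (fetch at _ (Translation.fetch-first len o p _ e)) h)
    }
  move {s} {ρ} {μ} (jzero x ℓ) e sm with regs s x in z
  ... | zero = record
    { dur≤  = s≤s z≤n
    ; after = record { Simulates sm }
    ; moves = λ {prog} {o} at h →
        ⇓-pc (cong (λ x → o + x * 2) (sym (m≤n⇒m⊓n≡m (<⇒≤ (‼-< p (pc s) e)))))
          (jzero-taken (fetch at _ (Translation.fetch-first len o p _ e))
            (trans (regs≡ sm (below (pc s) e ≤-refl)) z) h)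
    }
  ... | suc v = record
    { dur≤  = ≤-refl
    ; after = scratch {s} _ (truncate W 0) sm
    ; moves = λ {prog} {o} at h →
        ⇓-pc (cong (λ x → o + x * 2) (sym (m≤n⇒m⊓n≡m (<⇒≤ (‼-< p (pc s) e)))))
          (jzero-passed (fetch at _ (Translation.fetch-first len o p _ e))
            (trans (regs≡ sm (below (pc s) e ≤-refl)) z)
            (⇓-pc (+-suc o _)
              (step (fetch at _ (Translation.fetch-second len o p _ e))
                (⇓-pc (trans (cong (λ x → o + x * 2) (m≤n⇒m⊓n≡m (‼-< p (pc s) e)))
                             (+-suc o (suc (pc s * 2)))) h))))
    }

  simulate : ∀ {s t s′ ρ μ} → w , p ⊢ s ⇓[ t ] s′ → Simulates s ρ μ →
    ∃[ n ] ∃[ ρ′ ] ∃[ μ′ ] n ≤ t * 2 × Simulates s′ ρ′ μ′ ×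
      (∀ {prog o u fin} → At prog o (code (translated p) o) →
        W , prog ⊢ ⟨ o + len * 2 , ρ′ , μ′ ⟩ ⇓[ u ] fin →
        W , prog ⊢ ⟨ o + (pc s ⊓ len) * 2 , ρ , μ ⟩ ⇓[ n + u ] fin)
  simulate {s} (halt e) sm = 0 , _ , _ , z≤n , sm , λ {prog} {o} _ h →
    ⇓-pc (cong (λ x → o + x * 2) (sym (m≥n⇒m⊓n≡n (‼-≥ p (pc s) e)))) h
  simulate (step {i = i} e r) sm =
    let m = move i e sm
        n , ρ′ , μ′ , n≤ , sm′ , f = simulate r (after m)
    in dur m + n , ρ′ , μ′ , +-mono-≤ (dur≤ m) n≤ , sm′ ,
       λ {u = u} at h → ⇓-time (sym (+-assoc (dur m) n u)) (moves m at (f at h))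

-- The size and the dimension are reduced because `input` holds them truncated and they need not fit
-- into w bits. The last instruction is merely a move, as the answer is already below 2 ^ w.
simulated : Program → Block
simulated p =
  straight (clear (regBound p)) ⨾
  straight (arith mod (K + 0) rS rP ∷ arith mod (K + 1) rDD rP ∷ []) ⨾
  translated p ⨾
  straight (arith mod rU (K + 0) rP ∷ [])

clear-runs : ∀ {W} R ρ μ → ∃[ ρ′ ] Runs W (straight (clear R)) (ρ , μ) R (ρ′ , μ) ×
  (∀ {r} → r < R → ρ′ (K + r) ≡ 0) × (∀ {r} → R ≤ r → ρ′ (K + r) ≡ ρ (K + r)) ×
  (∀ {r} → r < K → ρ′ r ≡ ρ r)
clear-runs zero ρ μ = ρ , runs-[] , (λ ()) , (λ _ → refl) , λ _ → refl
clear-runs {W} (suc R) ρ μ with ρ′ , rn , z , k , o ← clear-runs R (ρ [ K + R ≔ truncate W 0 ]) μ =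
  ρ′ , runs-∷ (λ _ → refl) rn , zeroed , (λ h → trans (k (<⇒≤ h)) (≔-other ρ (λ q → <⇒≢ h (sym (+-cancelˡ-≡ K _ _ q))))) ,
  λ h → trans (o h) (≔-other ρ (K+≢ R h))
  where
  zeroed : ∀ {r} → r < suc R → ρ′ (K + r) ≡ 0
  zeroed {r} h with r <? R
  ... | yes r<R = z r<R
  ... | no  r≮R with refl ← ≤-antisym (s≤s⁻¹ h) (≮⇒≥ r≮R) =
    trans (k ≤-refl) (trans (≔-same {ρ} {K + R}) (truncate-< W (m^n>0 2 W)))

!-≥ : ∀ e {r z} → length e ≤ r → e ! r ≢ just z
!-≥ []      _       ()
!-≥ (_ ∷ e) (s≤s h) q = !-≥ e h q

map-‼-< : ∀ {A : Set} (f : A → ℕ) {b} → (∀ x → f x < b) → 0 < b → ∀ xs a → fromMaybe 0 (map f xs ‼ a) < b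
map-‼-< f h z []       a       = z
map-‼-< f h z (x ∷ xs) zero    = h x
map-‼-< f h z (x ∷ xs) (suc a) = map-‼-< f h z xs a

module _ (W B : ℕ) (2^W≡B^D : 2 ^ W ≡ B ^ D) (2≤B : 2 ≤ B) where

  open Logic W B 2^W≡B^D 2≤B

  -- The control flow of `p` is arbitrary, so verification conditions do not apply and the run is
  -- assembled by hand. The environment claims nothing about `rT` or about registers from `K` on,
  -- which are the ones overwritten before `rU` receives the answer.
  wp-simulated : ∀ {p w s d t s′ e μ base i j i′ j′} {A C : Vec (Vec Bool d) s} →
    w ≤ W → 2 ^ w ≤ B → base + 2 ^ w ≤ 2 ^ W → length e ≤ K →
    e ! rP ≡ just (2 ^ w , i) → e ! rBase ≡ just (base , j) →
    e ! rS ≡ just (s , i′) → e ! rDD ≡ just (d , j′) → e ! rT ≡ nothing →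
    (∀ {a} → a < 2 ^ w → μ (base + a) ≡ mem (input w A C) a) →
    w , p ⊢ input w A C ⇓[ t ] s′ →
    wp (simulated p)
      (λ n e′ μ′ → n ≤ regBound p + (2 + (t * 2 + 1)) × e′ ≡ put e rU (just (regs s′ 0 , 1)) ×
         (∀ a → a < base ⊎ base + 2 ^ w ≤ a → μ′ a ≡ μ a)) e μ
  wp-simulated {p} {w} {s} {d} {t} {s′} {e} {μ} {base} {A = A} {C}
    w≤W 2^w≤B fits len≤ e-P e-base e-S e-DD e-T input≡ run = mkWp go
    where
    go : ∀ {ρ} → ρ ⊨ e → Bounded μ → Ends (simulated p) _ ρ μ
    go {ρ} m bd = ends _
        (runs-⨾ rn₁ (runs-⨾ (runs-∷ (λ _ → refl) (runs-∷ (λ _ → refl) runs-[])) (runs-⨾ rn₃ (runs-∷ (λ _ → refl) runs-[]))))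
        (⊨-put {ρ₃} {e} rU m₃ (meets-just answer (≤-trans (<⇒≤ answer<) (≤-trans 2^w≤B (≤-reflexive (sym (*-identityʳ B)))))))
        bd₃
        (+-monoʳ-≤ (regBound p) (+-monoʳ-≤ 2 (+-monoˡ-≤ 1 n≤)) , refl , λ _ → frame sm₃)
      where
      cl = clear-runs {W} (regBound p) ρ μ
      ρ₁ = proj₁ cl
      rn₁ = proj₁ (proj₂ cl)
      z₁ = proj₁ (proj₂ (proj₂ cl))
      o₁ : ∀ {r} → r < K → ρ₁ r ≡ ρ r
      o₁ = proj₂ (proj₂ (proj₂ (proj₂ cl)))
      ρ₂′ = ρ₁ [ K + 0 ≔ ⟦ mod ⟧ W (ρ₁ rS) (ρ₁ rP) ]
      ρ₂ = ρ₂′ [ K + 1 ≔ ⟦ mod ⟧ W (ρ₂′ rDD) (ρ₂′ rP) ]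
      ρ-P : ρ rP ≡ 2 ^ w
      ρ-P = proj₁ (m rP e-P)
      open Simulation W w base p w≤W fits ρ μ ρ-P (proj₁ (m rBase e-base))
      reduces : ∀ r {v k} → r < K → e ! r ≡ just (v , k) →
        ⟦ mod ⟧ W (ρ₁ r) (ρ₁ rP) ≡ truncate w v
      reduces r {v} r<K q = trans
        (cong₂ (⟦ mod ⟧ W) (trans (o₁ r<K) (proj₁ (m r q))) (trans (o₁ (<ᵇ⇒< rP K tt)) ρ-P))
        (mod-2^ v w≤W)
      regs₂ : ∀ {r} → r < regBound p → ρ₂ (K + r) ≡ inputRegs w A C r
      regs₂ {zero}        h = reduces rS (<ᵇ⇒< rS K tt) e-S
      regs₂ {suc zero}    h = reduces rDD (<ᵇ⇒< rDD K tt) e-DD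
      regs₂ {suc (suc r)} h = z₁ h
      regs₂< : ∀ {r} → r < regBound p → inputRegs w A C r < 2 ^ w
      regs₂< {zero}        h = truncate-≤ w s
      regs₂< {suc zero}    h = truncate-≤ w d
      regs₂< {suc (suc r)} h = m^n>0 2 w
      sm₂ : Simulates (input w A C) ρ₂ μ
      sm₂ = record
        { regs≡ = regs₂
        ; regs< = regs₂<
        ; mem≡ = input≡
        ; mem< = λ {a} _ → map-‼-< _ (λ b → truncate-≤ w (bit b)) (m^n>0 2 w)
            (toList (concat A) ++ toList (concat C)) a
        ; own = λ {r} h _ → trans (≔-other ρ₂′ (K+≢ 1 h)) (trans (≔-other ρ₁ (K+≢ 0 h)) (o₁ h))
        ; frame = λ _ → refl
        }
      sim = simulate run sm₂
      n = proj₁ sim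
      ρ₃ = proj₁ (proj₂ sim)
      μ₃ = proj₁ (proj₂ (proj₂ sim))
      n≤ = proj₁ (proj₂ (proj₂ (proj₂ sim)))
      sm₃ : Simulates s′ ρ₃ μ₃
      sm₃ = proj₁ (proj₂ (proj₂ (proj₂ (proj₂ sim))))
      rn₃ : Runs W (translated p) (ρ₂ , μ) n (ρ₃ , μ₃)
      rn₃ = running λ {prog} {o} at h →
        ⇓-pc (+-identityʳ o) (proj₂ (proj₂ (proj₂ (proj₂ (proj₂ sim)))) at h)
      answer< : regs s′ 0 < 2 ^ w
      answer< = regs< sm₃ (≤-trans (s≤s z≤n) (2≤regBound p))
      answer : ⟦ mod ⟧ W (ρ₃ (K + 0)) (ρ₃ rP) ≡ regs s′ 0
      answer = trans (cong₂ (⟦ mod ⟧ W) (regs≡ sm₃ (≤-trans (s≤s z≤n) (2≤regBound p)))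
                 (trans (own sm₃ (<ᵇ⇒< rP K tt) (λ ())) ρ-P))
               (trans (mod-2^ _ w≤W) (truncate-< w answer<))
      m₃ : ρ₃ ⊨ e
      m₃ r q with r <? K
      ... | no r≮K = contradiction q (!-≥ e (≤-trans len≤ (≮⇒≥ r≮K)))
      ... | yes r<K with r ≟ rT
      ...   | yes refl = contradiction (trans (sym q) e-T) λ ()
      ...   | no  r≢T  = trans (own sm₃ r<K r≢T) (proj₁ (m r q)) , proj₂ (m r q)
      bd₃ : Bounded μ₃
      bd₃ a with a <? base | base + 2 ^ w ≤? a
      ... | yes h | _     = ≤-trans (≤-reflexive (frame sm₃ (inj₁ h))) (bd a)
      ... | no _  | yes h = ≤-trans (≤-reflexive (frame sm₃ (inj₂ h))) (bd a)
      ... | no h  | no h′ = ≤-trans (<⇒≤ (subst (λ x → μ₃ x < 2 ^ w) (m+[n∸m]≡n (≮⇒≥ h))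
          (subst (_< 2 ^ w) (sym (mem≡ sm₃ a<)) (mem< sm₃ a<)))) 2^w≤B
        where a< = +-cancelˡ-< base _ _ (subst (_< base + 2 ^ w) (sym (m+[n∸m]≡n (≮⇒≥ h))) (≰⇒> h′))

-- Quotients and remainders of numbers given by their digits

module _ {b c : ℕ} (a : ℕ) (c<b : c < b) where

  private instance
    b≢0 : NonZero b
    b≢0 = >-nonZero (≤-trans (s≤s z≤n) c<b)

  remainder-digits : remainder (a * b + c) b ≡ c
  remainder-digits = trans (remainder-% _ b)
    (trans (cong (_% b) (+-comm (a * b) c)) (trans ([m+kn]%n≡m%n c a b) (m<n⇒m%n≡m c<b)))

  quotient-digits : quotient (a * b + c) b ≡ a
  quotient-digits = trans (quotient-/ _ b) (trans (+-distrib-/ (a * b) c small)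
    (trans (cong₂ _+_ (m*n/n≡m a b) (m<n⇒m/n≡0 c<b)) (+-identityʳ a)))
    where
    small : (a * b) % b + c % b < b
    small = subst (_< b) (sym (cong₂ _+_ (m*n%n≡0 a b) (m<n⇒m%n≡m c<b))) c<b

quotient-< : ∀ {x a b} → x < a * b → quotient x b < a
quotient-< {x} {a} {zero}  h = contradiction (subst (x <_) (*-zeroʳ a) h) λ ()
quotient-< {x} {a} {suc b} h = m<n*o⇒m/o<n h

remainder-< : ∀ x {b} → 0 < b → remainder x b < b
remainder-< x {suc b} _ = m%n<n x (suc b)

digits : ∀ x {b} → 0 < b → x ≡ quotient x b * b + remainder x b
digits x {suc b} _ = trans (m≡m%n+[m/n]*n x (suc b)) (+-comm (x % suc b) _)

digits-< : ∀ {i g j s} → i < g → j < s → i * s + j < g * s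
digits-< {i} {g} {j} {s} i<g j<s = ≤-trans (+-monoʳ-< (i * s) j<s)
  (≤-trans (≤-reflexive (+-comm (i * s) s)) (*-monoˡ-≤ s i<g))

-- Bit arrays

disjoint : (f g : ℕ → Bool) → ℕ → ℕ → ℕ → Bool
disjoint f g a b zero    = true
disjoint f g a b (suc c) = disjoint f g a b c ∧ not (f (a + c) ∧ g (b + c))

_⊑_ : (f f′ : ℕ → Bool) → Set
f ⊑ f′ = ∀ {x} → f x ≡ true → f′ x ≡ true

disjoint-cong : ∀ {f f′ g g′ a a′ b b′} c →
  (∀ {y} → y < c → f (a + y) ≡ f′ (a′ + y)) → (∀ {y} → y < c → g (b + y) ≡ g′ (b′ + y)) →
  disjoint f g a b c ≡ disjoint f′ g′ a′ b′ c
disjoint-cong zero    h h′ = refl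
disjoint-cong (suc c) h h′ = cong₂ (λ x y → x ∧ not y)
  (disjoint-cong c (h ∘ m≤n⇒m≤1+n) (h′ ∘ m≤n⇒m≤1+n)) (cong₂ _∧_ (h ≤-refl) (h′ ≤-refl))

disjoint-true : ∀ {f g a b} c → disjoint f g a b c ≡ true →
  ∀ {y} → y < c → f (a + y) ≡ true → g (b + y) ≡ true → ⊥
disjoint-true {f} {g} {a} {b} (suc c) h {y} y< fy gy
  with disjoint f g a b c in p | y ≟ c
... | true | yes refl rewrite fy | gy = case h of λ ()
... | true | no  y≢c = disjoint-true {f} {g} {a} {b} c p (≤∧≢⇒< (s≤s⁻¹ y<) y≢c) fy gy

disjoint-false : ∀ {f g a b} c → disjoint f g a b c ≡ false →
  ∃[ y ] y < c × f (a + y) ≡ true × g (b + y) ≡ true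
disjoint-false {f} {g} {a} {b} (suc c) h
  with disjoint f g a b c in p | f (a + c) in q | g (b + c) in r
... | false | _    | _    = let y , y< , e = disjoint-false {f} {g} {a} {b} c p in y , m≤n⇒m≤1+n y< , e
... | true  | true | true = c , ≤-refl , q , r

disjoint-hit : ∀ {f g a b} c {y} → y < c → f (a + y) ≡ true → g (b + y) ≡ true →
  disjoint f g a b c ≡ false
disjoint-hit {f} {g} {a} {b} c y< fy gy with disjoint f g a b c in p
... | false = refl
... | true  = ⊥-elim (disjoint-true {f} {g} {a} {b} c p y< fy gy)

disjoint-mono : ∀ {f f′ g a b} c → f ⊑ f′ → disjoint f g a b c ≡ false → disjoint f′ g a b c ≡ false
disjoint-mono {f} {f′} {g} {a} {b} c h p with y , y< , fy , gy ← disjoint-false {f} {g} {a} {b} c p =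
  disjoint-hit {f′} {g} {a} {b} c y< (h fy) gy

-- Rows of width dd; column d of f holds the flag of a row.
module Flags (dd d rows : ℕ) (d<dd : d < dd) (f₀ g : ℕ → Bool) (g-top : ∀ r → g (r * dd + d) ≡ true) where

  flag : (ℕ → Bool) → ℕ → Bool
  flag f r = f (r * dd + d)

  -- The reason for a flag refers to the original `f₀`, not to the current array, so it survives
  -- later changes and yields a missed set at the end.
  record Valid (f : ℕ → Bool) : Set where
    field
      alive : ∀ r → flag f r ≡ false → ∀ {c} → c < dd → f (r * dd + c) ≡ f₀ (r * dd + c)
      dead  : ∀ r → r < rows → flag f r ≡ true →
              ∃[ v ] v < rows × disjoint f₀ g (r * dd) (v * dd) dd ≡ true

  open Valid public

  mark : (ℕ → Bool) → ℕ → (ℕ → Bool)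
  mark f r x = if x ≡ᵇ r * dd + d then true else f x

  ⊑-mark : ∀ f r → f ⊑ mark f r
  ⊑-mark f r {x} h with x ≡ᵇ r * dd + d
  ... | true  = refl
  ... | false = h

  mark-flag : ∀ f r → flag (mark f r) r ≡ true
  mark-flag f r with r * dd + d ≡ᵇ r * dd + d in q
  ... | true  = refl
  ... | false = ⊥-elim (subst T q (≡⇒≡ᵇ (r * dd + d) _ refl))

  mark-other : ∀ f r {x} → x ≢ r * dd + d → mark f r x ≡ f x
  mark-other f r {x} h with x ≡ᵇ r * dd + d in q
  ... | true  = contradiction (≡ᵇ⇒≡ x _ (subst T (sym q) _)) h
  ... | false = refl

  cell-row : ∀ {r r′ c c′} → c < dd → c′ < dd → r * dd + c ≡ r′ * dd + c′ → r ≡ r′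
  cell-row {r} {r′} h h′ q = trans (sym (quotient-digits r h)) (trans (cong (λ x → quotient x dd) q) (quotient-digits r′ h′))

  disjoint⇒unflagged : ∀ f r v → disjoint f g (r * dd) (v * dd) dd ≡ true → flag f r ≡ false
  disjoint⇒unflagged f r v h = ¬-not λ p →
    disjoint-true {f} {g} {r * dd} {v * dd} dd h d<dd p (g-top v)

  disjoint-alive : ∀ {f} r v → Valid f → flag f r ≡ false →
    disjoint f g (r * dd) (v * dd) dd ≡ disjoint f₀ g (r * dd) (v * dd) dd
  disjoint-alive r v val h = disjoint-cong {b = v * dd} dd (alive val r h) (λ _ → refl)

  valid-mark : ∀ {f} r v → Valid f → v < rows → disjoint f g (r * dd) (v * dd) dd ≡ true → Valid (mark f r)
  valid-mark {f} r v val v< h = record { alive = alive′ ; dead = dead′ }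
    where
    alive′ : ∀ r′ → flag (mark f r) r′ ≡ false → ∀ {c} → c < dd → mark f r (r′ * dd + c) ≡ f₀ (r′ * dd + c)
    alive′ r′ p {c} c< with r′ ≟ r
    ... | yes refl = contradiction (trans (sym p) (mark-flag f r)) λ ()
    ... | no  r′≢r = trans (mark-other f r (r′≢r ∘ cell-row c< d<dd))
      (alive val r′ (trans (sym (mark-other f r (r′≢r ∘ cell-row d<dd d<dd))) p) c<)
    dead′ : ∀ r′ → r′ < rows → flag (mark f r) r′ ≡ true → ∃[ v ] v < rows × disjoint f₀ g (r′ * dd) (v * dd) dd ≡ true
    dead′ r′ r′< p with r′ ≟ r
    ... | yes refl = v , v< , trans (sym (disjoint-alive r v val (disjoint⇒unflagged f r v h))) h
    ... | no  r′≢r = dead val r′ r′< (trans (sym (mark-other f r (r′≢r ∘ cell-row d<dd d<dd))) p)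

  count : (ℕ → Bool) → ℕ → ℕ
  count f zero    = 0
  count f (suc r) = bit (flag f r) + count f r

  count≤ : ∀ f r → count f r ≤ r
  count≤ f zero    = z≤n
  count≤ f (suc r) = +-mono-≤ (bit≤1 (flag f r)) (count≤ f r)

  bit-mono : ∀ {x y} → (x ≡ true → y ≡ true) → bit x ≤ bit y
  bit-mono {true}  h rewrite h refl = ≤-refl
  bit-mono {false} h = z≤n

  count-mono : ∀ {f f′} → f ⊑ f′ → ∀ r → count f r ≤ count f′ r
  count-mono h zero    = z≤n
  count-mono h (suc r) = +-mono-≤ (bit-mono h) (count-mono h r)

  count-strict : ∀ {f f′} → f ⊑ f′ → ∀ {r n} → r < n → flag f r ≡ false → flag f′ r ≡ true →
    count f n < count f′ n
  count-strict {f} {f′} h {r} {suc n} r< p p′ with r ≟ n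
  ... | yes refl rewrite p | p′ = s≤s (count-mono h n)
  ... | no  r≢n  = ≤-trans (≤-reflexive (sym (+-suc (bit (flag f n)) _)))
    (+-mono-≤ (bit-mono h) (count-strict h (≤∧≢⇒< (s≤s⁻¹ r<) r≢n) p p′))

  -- An unflagged row has its original entries in `f` as well as in `f′`, so the outcome of the
  -- comparison can change only through the flag. Together with `count-strict` this gives the
  -- progress that pays for a search.
  newly-flagged : ∀ {f f′} r v → Valid f → Valid f′ → f ⊑ f′ →
    disjoint f g (r * dd) (v * dd) dd ≡ true → disjoint f′ g (r * dd) (v * dd) dd ≡ false →
    flag f′ r ≡ true
  newly-flagged {f} {f′} r v val val′ h p p′ with flag f′ r in q
  ... | true  = refl
  ... | false = case trans (sym p) (trans (disjoint-alive r v val (disjoint⇒unflagged f r v p))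
      (trans (sym (disjoint-alive r v val′ q)) p′)) of λ ()

-- Matrices as bit arrays

row : ∀ {d} → (ℕ → Bool) → ℕ → Vec Bool d
row f a = tabulate λ c → f (a + toℕ c)

matrix : ∀ {n d} → (ℕ → Bool) → Vec (Vec Bool d) n
matrix {d = d} f = tabulate λ u → row f (toℕ u * d)

applyUpTo-+ : ∀ (f : ℕ → Bool) m n → applyUpTo f (m + n) ≡ applyUpTo f m ++ applyUpTo (λ x → f (m + x)) n
applyUpTo-+ f zero    n = refl
applyUpTo-+ f (suc m) n = cong (f 0 ∷_) (applyUpTo-+ (f ∘ suc) m n)

toList-tabulate : ∀ (f : ℕ → Bool) n → toList (tabulate {n = n} (f ∘ toℕ)) ≡ applyUpTo f n
toList-tabulate f zero    = refl
toList-tabulate f (suc n) = cong (f 0 ∷_) (toList-tabulate (f ∘ suc) n)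

toList-matrix : ∀ n d f → toList (concat (matrix {n} {d} f)) ≡ applyUpTo f (n * d)
toList-matrix zero    d f = refl
toList-matrix (suc n) d f = trans (toList-++ (row {d} f 0) (concat (tabulate {n = n} λ u → row f (suc (toℕ u) * d))))
  (trans (cong₂ _++_ (toList-tabulate f d)
    (trans (cong (toList ∘ concat) (tabulate-cong {n = n} λ u → tabulate-cong λ c → cong f (+-assoc d (toℕ u * d) (toℕ c))))
           (toList-matrix n d (λ x → f (d + x)))))
  (sym (applyUpTo-+ f d (n * d))))

flatten : ∀ {n d} → Vec (Vec Bool d) n → ℕ → Bool
flatten A x = fromMaybe false (toList (concat A) ‼ x)

tabulate-flat : ∀ {d} (xs : Vec Bool d) ys → tabulate (λ c → fromMaybe false ((toList xs ++ ys) ‼ toℕ c)) ≡ xs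
tabulate-flat []       ys = refl
tabulate-flat (x ∷ xs) ys = cong (x ∷_) (tabulate-flat xs ys)

-- Every instance is the `matrix` of a bit function, so the algorithm has to be verified only for
-- bit functions, where groups and rows are mere offsets.
matrix-flatten : ∀ {n d} (A : Vec (Vec Bool d) n) → matrix (flatten A) ≡ A
matrix-flatten []                = refl
matrix-flatten {suc n} {d} (r ∷ A) = cong₂ _∷_
  (trans (tabulate-cong λ c → cong (λ l → fromMaybe false (l ‼ toℕ c)) (toList-++ r (concat A)))
         (tabulate-flat r (toList (concat A))))
  (trans (tabulate-cong {n = n} λ u → tabulate-cong λ c →
           trans (cong (flatten (r ∷ A)) (+-assoc d (toℕ u * d) (toℕ c))) (shift (toℕ u * d + toℕ c)))
         (matrix-flatten A))
  where
  shift : ∀ x → flatten (r ∷ A) (d + x) ≡ flatten A x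
  shift x = cong (fromMaybe false) (trans (cong (_‼ (d + x)) (toList-++ r (concat A)))
    (trans (cong (λ l → (toList r ++ toList (concat A)) ‼ (l + x)) (sym (length-toList r))) (‼-++ʳ (toList r) x)))

applyUpTo-‼ : ∀ {A : Set} (f : ℕ → A) {n x} → x < n → applyUpTo f n ‼ x ≡ just (f x)
applyUpTo-‼ f {suc n} {zero}  h       = refl
applyUpTo-‼ f {suc n} {suc x} (s≤s h) = applyUpTo-‼ (f ∘ suc) h

‼-beyond : ∀ {A : Set} (xs : List A) {x} → length xs ≤ x → xs ‼ x ≡ nothing
‼-beyond []       h       = refl
‼-beyond (_ ∷ xs) (s≤s h) = ‼-beyond xs h

map-‼ : ∀ {A B : Set} (f : A → B) xs x → map f xs ‼ x ≡ Maybe.map f (xs ‼ x)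
map-‼ f []       x       = refl
map-‼ f (_ ∷ xs) zero    = refl
map-‼ f (_ ∷ xs) (suc x) = map-‼ f xs x

module _ {n d : ℕ} (w : ℕ) (f g : ℕ → Bool) where

  private
    cells : inputCells w (matrix {n} {d} f) (matrix g) ≡
      map (λ b → truncate w (bit b)) (applyUpTo f (n * d) ++ applyUpTo g (n * d))
    cells = cong₂ (λ xs ys → map _ (xs ++ ys)) (toList-matrix n d f) (toList-matrix n d g)

    cell : ∀ x {z} → (applyUpTo f (n * d) ++ applyUpTo g (n * d)) ‼ x ≡ z →
      mem (input w (matrix {n} {d} f) (matrix g)) x ≡ fromMaybe 0 (Maybe.map (λ b → truncate w (bit b)) z)
    cell x refl = cong (fromMaybe 0) (trans (cong (_‼ x) cells) (map-‼ _ (applyUpTo f (n * d) ++ applyUpTo g (n * d)) x))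

  input-left : ∀ {x} → x < n * d → mem (input w (matrix {n} {d} f) (matrix g)) x ≡ truncate w (bit (f x))
  input-left {x} h = cell x (‼-++ˡ (applyUpTo f (n * d)) (applyUpTo-‼ f h))

  input-right : ∀ {x} → x < n * d → mem (input w (matrix {n} {d} f) (matrix g)) (n * d + x) ≡ truncate w (bit (g x))
  input-right {x} h = cell (n * d + x)
    (trans (cong (λ l → (applyUpTo f (n * d) ++ applyUpTo g (n * d)) ‼ (l + x)) (sym (length-applyUpTo f (n * d))))
      (trans (‼-++ʳ (applyUpTo f (n * d)) x) (applyUpTo-‼ g h)))

  input-beyond : ∀ {x} → n * d + n * d ≤ x → mem (input w (matrix {n} {d} f) (matrix g)) x ≡ 0
  input-beyond {x} h = cell x (‼-beyond (applyUpTo f (n * d) ++ applyUpTo g (n * d))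
    (≤-trans (≤-reflexive (trans (length-++ (applyUpTo f (n * d)))
      (cong₂ _+_ (length-applyUpTo f (n * d)) (length-applyUpTo g (n * d))))) h))

dot-zero : ∀ {d} (a b : Vec Bool d) → a · b ≡ 0 → ∀ i → lookup a i ≡ true → lookup b i ≡ true → ⊥
dot-zero (true ∷ a) (true ∷ b) ()
dot-zero (true  ∷ a) (false ∷ b) h (Fin.suc i) = dot-zero a b h i
dot-zero (false ∷ a) (_     ∷ b) h (Fin.suc i) = dot-zero a b h i

zero-dot : ∀ {d} (a b : Vec Bool d) → (∀ i → lookup a i ≡ true → lookup b i ≡ true → ⊥) → a · b ≡ 0
zero-dot []          []          h = refl
zero-dot (true  ∷ a) (true  ∷ b) h = ⊥-elim (h Fin.zero refl refl)
zero-dot (true  ∷ a) (false ∷ b) h = zero-dot a b (h ∘ Fin.suc)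
zero-dot (false ∷ a) (_     ∷ b) h = zero-dot a b (h ∘ Fin.suc)

lookup-row : ∀ {d} f a (i : Fin d) → lookup (row f a) i ≡ f (a + toℕ i)
lookup-row f a i = lookup∘tabulate (λ c → f (a + toℕ c)) i

module _ {f g : ℕ → Bool} {a b : ℕ} {d : ℕ} where

  disjoint⇒dot : disjoint f g a b d ≡ true → row {d} f a · row g b ≡ 0
  disjoint⇒dot h = zero-dot (row f a) (row g b) λ i p q → disjoint-true {f} {g} {a} {b} d h (toℕ<n i)
    (trans (sym (lookup-row f a i)) p) (trans (sym (lookup-row g b i)) q)

  dot⇒disjoint : row {d} f a · row g b ≡ 0 → disjoint f g a b d ≡ true
  dot⇒disjoint h = ¬-not λ p → case disjoint-false {f} {g} {a} {b} d p of
    λ (y , y< , fy , gy) → dot-zero (row f a) (row g b) h (fromℕ< y<)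
      (trans (lookup-row f a (fromℕ< y<)) (trans (cong (λ y → f (a + y)) (toℕ-fromℕ< y<)) fy))
      (trans (lookup-row g b (fromℕ< y<)) (trans (cong (λ y → g (b + y)) (toℕ-fromℕ< y<)) gy))

  disjoint⇒¬intersects : disjoint f g a b d ≡ true → ¬ Intersects (row {d} f a) (row g b)
  disjoint⇒¬intersects h (i , i∈) with p , q ← x∈p∩q⁻ (row f a) (row g b) i∈ =
    disjoint-true {f} {g} {a} {b} d h (toℕ<n i)
      (trans (sym (lookup-row f a i)) ([]=⇒lookup p)) (trans (sym (lookup-row g b i)) ([]=⇒lookup q))

  ¬disjoint⇒intersects : disjoint f g a b d ≡ false → Intersects (row {d} f a) (row g b)
  ¬disjoint⇒intersects h with y , y< , fy , gy ← disjoint-false {f} {g} {a} {b} d h =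
    i , x∈p∩q⁺ ( lookup⇒[]= i (row f a) (trans (lookup-row f a i) (trans (cong (λ y → f (a + y)) (toℕ-fromℕ< y<)) fy))
               , lookup⇒[]= i (row g b) (trans (lookup-row g b i) (trans (cong (λ y → g (b + y)) (toℕ-fromℕ< y<)) gy)))
    where i = fromℕ< y<

∈-matrix⁺ : ∀ {n d} f {u} → u < n → row f (u * d) ∈ matrix {n} {d} f
∈-matrix⁺ {n} {d} f u< = subst (λ u → row f (u * d) ∈ matrix {n} {d} f) (toℕ-fromℕ< u<) (∈-tabulate⁺ _ (fromℕ< u<))

∈-matrix⁻ : ∀ {n d} f {a} → a ∈ matrix {n} {d} f → ∃[ u ] u < n × a ≡ row f (u * d)
∈-matrix⁻ f h with i , refl ← tabulate⁻ h = toℕ i , toℕ<n i , refl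

-- The program of the reduction

reset : Reg → List Instr
reset r = arith lt r rOne rOne ∷ []

forTo : Reg → Reg → Block → Block
forTo c b body = straight (reset c) ⨾ while (straight (arith lt rT c b ∷ [])) rT body

-- The comparison clears rAcc as soon as rT is 1, so rAcc ends as 1 iff the two rows are disjoint.
dotBody : List Instr
dotBody =
  arith add rT rV rC ∷ load rT rT ∷ arith add rU rW rC ∷ load rU rU ∷ arith mul rT rT rU ∷
  arith lt rAcc rT rAcc ∷ arith add rC rC rOne ∷ []

dotLoop : Block
dotLoop = forTo rC rDD (straight dotBody)

-- The bits are reduced modulo 2 ^ w because the input cells of a w-bit machine hold
-- `truncate w (bit b)`, which is 0 for every b when w is 0.
copyBody : List Instr
copyBody =
  arith add rT rIA rX ∷ load rU rT ∷ arith mod rU rU rP ∷ arith add rV rBase rX ∷ store rV rU ∷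
  arith add rT rJB rX ∷ load rU rT ∷ arith mod rU rU rP ∷ arith add rV rV rSD ∷ store rV rU ∷
  arith add rX rX rOne ∷ []

copyLoop : Block
copyLoop = forTo rX rSD (straight copyBody)

-- For bits u and v, eq (u * v) v is u if v is 1 and 1 if v is 0; the mask v tells whether the column
-- exists in the input.
extendBody : List Instr
extendBody =
  arith div rT rX rDD ∷ arith mod rT rT rN ∷ arith mul rT rT rD ∷ arith mod rU rX rDD ∷
  arith lt rV rU rD ∷ arith add rT rT rU ∷ load rU rT ∷ arith mul rU rU rV ∷
  arith add rW rEA rX ∷ store rW rU ∷ arith add rT rT rND ∷ load rU rT ∷ arith mul rU rU rV ∷
  arith eq rU rU rV ∷ arith add rW rEB rX ∷ store rW rU ∷ arith add rX rX rOne ∷ []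

extendLoop : Block
extendLoop = forTo rX rNN (straight extendBody)

locate : List Instr
locate =
  arith div rV rX rS ∷ arith mul rV rV rDD ∷ arith add rV rIA rV ∷
  arith mod rW rX rS ∷ arith mul rW rW rDD ∷ arith add rW rJB rW ∷ arith eq rAcc rOne rOne ∷ []

bruteBody : Block
bruteBody =
  straight locate ⨾ dotLoop ⨾ straight (arith add rV rV rD ∷ []) ⨾
  when rAcc (straight (store rV rOne ∷ [])) ⨾ straight (arith add rX rX rOne ∷ [])

bruteLoop : Block
bruteLoop = forTo rX rSS bruteBody

-- On bits, the first `lt` negates the flag and the second computes "`rAcc` and not `rT`", so `rAcc`
-- stays 1 as long as every row is flagged.
scanBody : List Instr
scanBody =
  arith mul rT rX rDD ∷ arith add rT rT rD ∷ arith add rT rEA rT ∷ load rT rT ∷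
  arith lt rT rT rOne ∷ arith lt rAcc rT rAcc ∷ arith add rX rX rOne ∷ []

scanLoop : Block
scanLoop = forTo rX rRows (straight scanBody)

pick : List Instr
pick =
  arith div rIA rQ rG ∷ arith mul rIA rIA rSD ∷ arith add rIA rEA rIA ∷
  arith mod rJB rQ rG ∷ arith mul rJB rJB rSD ∷ arith add rJB rEB rJB ∷ []

mainBody : Program → Block
mainBody p =
  straight pick ⨾ copyLoop ⨾ simulated p ⨾ straight (arith add rBase rBase rStride ∷ []) ⨾
  when rU bruteLoop ⨾ straight (arith add rQ rQ rOne ∷ [])

mainLoop : Program → Block
mainLoop p = forTo rQ rGG (mainBody p)

-- The values for s = 2, where `wordSize k 2` is `k * 2`. Doubling s adds k to the word length and C
-- to the dimension, so 2 ^ w is multiplied by the constant 2 ^ k kept in `rK`, and C is kept in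
-- `rW`.
setup : ℕ → ℕ → List Instr
setup k C =
  const rOne 1 ∷ const rS 2 ∷ const rP (2 ^ (k * 2)) ∷ const rDD C ∷ const rK (2 ^ k) ∷ const rW C ∷ []

tooSmall : List Instr
tooSmall = arith mul rT rS rS ∷ arith mul rT rT rT ∷ arith lt rT rN rT ∷ arith lt rT rT rOne ∷ []

double : List Instr
double = arith add rS rS rS ∷ arith mul rP rP rK ∷ arith add rDD rDD rW ∷ []

layout : List Instr
layout =
  arith div rT rN rS ∷ arith add rG rT rOne ∷ arith mul rSD rS rDD ∷ arith mul rND rN rD ∷
  arith mul rNN rG rSD ∷ arith add rEA rND rND ∷ arith add rEB rEA rNN ∷ arith add rStride rP rSD ∷
  arith add rStride rStride rSD ∷ arith mul rGG rG rG ∷ arith mul rSS rS rS ∷ arith mul rRows rG rS ∷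
  arith add rBase rEB rNN ∷ []

hittingSetBlock : Program → ℕ → ℕ → Block
hittingSetBlock p k C =
  straight (setup k C) ⨾ while (straight tooSmall) rT (straight double) ⨾ straight layout ⨾
  extendLoop ⨾ mainLoop p ⨾ straight (arith eq rAcc rOne rOne ∷ []) ⨾ scanLoop ⨾
  straight (arith lt rN rAcc rOne ∷ [])

record Decides (p : Program) (w s dd T : ℕ) (F G : ℕ → Bool) : Set where
  field
    {steps} : ℕ
    {final} : State
    steps≤  : steps ≤ T
    run     : w , p ⊢ input w (matrix {s} {dd} F) (matrix G) ⇓[ steps ] final
    verdict : (regs final 0 ≡ 1 × ∃[ u ] ∃[ v ] u < s × v < s × disjoint F G (u * dd) (v * dd) dd ≡ true)
            ⊎ (regs final 0 ≡ 0 × (∀ {u v} → u < s → v < s → disjoint F G (u * dd) (v * dd) dd ≡ false))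

open Decides public

<-suc-cases : (P : ℕ → Set) → ∀ {x} → (∀ {y} → y < x → P y) → P x → ∀ {y} → y < suc x → P y
<-suc-cases P {x} h hx {y} y< with y ≟ x
... | yes refl = hx
... | no  y≢x  = h (≤∧≢⇒< (s≤s⁻¹ y<) y≢x)

-- Correctness and cost of the inner loops

module Loops (W B : ℕ) (2^W≡B^D : 2 ^ W ≡ B ^ D) (2≤B : 2 ≤ B)
             (n d s w dd : ℕ) where

  open Logic W B 2^W≡B^D 2≤B

  g sd nd nn EA EB base₀ stride gg ss rows : ℕ
  -- One more than the quotient covers all n rows without a test for divisibility. A surplus group
  -- does no harm, since it only repeats rows of the input.
  g      = quotient n s + 1
  sd     = s * dd
  nd     = n * d
  nn     = g * sd
  EA     = nd + nd
  EB     = EA + nn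
  base₀  = EB + nn
  -- A call may touch 2 ^ w cells, and its instance fills `sd + sd`. Neither number is known to
  -- dominate the other, so their sum is reserved.
  stride = 2 ^ w + sd + sd
  gg     = g * g
  ss     = s * s
  rows   = g * s

  -- The degrees are those that `degree` computes along `layout`, which is why the environment
  -- reached after `layout` matches by `refl`.
  params : Env
  params = just (n , 1) ∷ just (d , 1) ∷ just (1 , 1) ∷ just (s , 1) ∷ just (2 ^ w , 1) ∷ just (dd , 1) ∷
    just (g , 2) ∷ just (sd , 2) ∷ just (nd , 2) ∷ just (nn , 4) ∷ just (EA , 3) ∷ just (EB , 5) ∷
    just (stride , 4) ∷ just (gg , 4) ∷ just (ss , 2) ∷ just (rows , 3) ∷ []

  env : (base q x c ia jb t u v acc w k : Entry) → Env
  env base q x c ia jb t u v acc w k =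
    params ++ base ∷ q ∷ x ∷ c ∷ ia ∷ jb ∷ t ∷ u ∷ v ∷ acc ∷ w ∷ k ∷ []

  Stored : Mem → ℕ → (ℕ → Bool) → ℕ → Set
  Stored μ a f l = ∀ {x} → x < l → μ (a + x) ≡ bit (f x)

  -- The invariant sees the time accumulated so far, so single iterations need no uniform bound; the
  -- main loop depends on this. Each iteration adds 3 for the test, the conditional jump and the
  -- jump back. The final 3 stands for the reset, the last test and the exit.
  wp-forTo-amortised : ∀ {c b body M i e μ} (E F : ℕ → Env) (I : ℕ → ℕ → Mem → Set) →
    VC (reset c) (λ e′ μ′ → e′ ⊒ E 0 × μ′ ≡ μ) e μ →
    (∀ x μ → VC (arith lt rT c b ∷ []) (λ e μ′ → e ≡ F x × μ′ ≡ μ) (E x) μ) →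
    (∀ x → F x ! rT ≡ just (bit (x <ᵇ M) , i)) →
    (∀ x u μ → x < M → I x u μ → wp body (λ u′ e μ′ → e ⊒ E (suc x) × I (suc x) (u + (3 + u′)) μ′) (F x) μ) →
    I 0 0 μ →
    wp (forTo c b body) (λ u e μ′ → e ≡ F M × ∃[ v ] I M v μ′ × u ≤ v + 3) e μ
  wp-forTo-amortised {c} {b} {M = M} {e = e} {μ} E F I init test flag body j =
    wp-⨾ (wp-straight (reset c) {Q = λ u e μ′ → u ≡ 1 × e ⊒ E 0 × μ′ ≡ μ} (init′ e init))
    λ { _ _ _ (refl , h , refl) → wp-⊒ h $
      wp-⇒ (wp-while {arith lt rT c b ∷ []} E F I test flag
        (λ x u μ′ x<M j → wp-⇒ (body x u μ′ x<M j)
          λ { u′ _ μ″ (h , j) → h , subst (λ t → I (suc x) (u + t) μ″) (cong suc (+-comm 2 u′)) j }) j)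
        λ { _ _ _ (h , v , j , u≡) → h , v , j , ≤-reflexive (trans (cong suc u≡) (sym (+-suc v 2))) } }
    where
    init′ : ∀ e → VC (reset c) (λ e′ μ′ → e′ ⊒ E 0 × μ′ ≡ μ) e μ →
      VC (reset c) (λ e′ μ′ → 1 ≡ 1 × e′ ⊒ E 0 × μ′ ≡ μ) e μ
    init′ e h with e ! rOne
    ... | just _ = refl , h

  wp-forTo : ∀ {c b body M i e μ} (E F : ℕ → Env) (N : ℕ) (J : ℕ → Mem → Set) →
    VC (reset c) (λ e′ μ′ → e′ ⊒ E 0 × μ′ ≡ μ) e μ →
    (∀ x μ → VC (arith lt rT c b ∷ []) (λ e μ′ → e ≡ F x × μ′ ≡ μ) (E x) μ) →
    (∀ x → F x ! rT ≡ just (bit (x <ᵇ M) , i)) →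
    (∀ x μ → x < M → J x μ → wp body (λ u e μ′ → e ⊒ E (suc x) × 3 + u ≤ N × J (suc x) μ′) (F x) μ) →
    J 0 μ →
    wp (forTo c b body) (λ u e μ′ → e ≡ F M × u ≤ M * N + 3 × J M μ′) e μ
  wp-forTo E F N J init test flag body j =
    wp-⇒ (wp-forTo-amortised E F (λ x u μ → u ≤ x * N × J x μ) init test flag
           (λ x u μ x<M (u≤ , j) → wp-⇒ (body x μ x<M j)
              λ _ _ _ (h , u′≤ , j′) → h , ≤-trans (+-mono-≤ u≤ u′≤) (≤-reflexive (+-comm (x * N) N)) , j′)
           (z≤n , j))
      λ _ _ _ (h , v , (v≤ , j′) , u≤) → h , ≤-trans u≤ (+-monoˡ-≤ 3 v≤) , j′

  bit-step : ∀ a b c → bit (bit b * bit c <ᵇ bit a) ≡ bit (a ∧ not (b ∧ c))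
  bit-step true  true  true  = refl
  bit-step true  true  false = refl
  bit-step true  false true  = refl
  bit-step true  false false = refl
  bit-step false true  true  = refl
  bit-step false true  false = refl
  bit-step false false true  = refl
  bit-step false false false = refl

  wp-dot : ∀ {base q x ia jb t u c k f h a b ra rb μ} →
    Stored μ EA f nn → Stored μ EB h nn →
    ra ≡ EA + a → rb ≡ EB + b → a + dd ≤ nn → b + dd ≤ nn →
    wp dotLoop
      (λ n e μ′ → e ≡ env base q x (just (dd , 1)) ia jb (just (bit (dd <ᵇ dd) , 0)) nothing (just (ra , 8))
                    (just (bit (disjoint f h a b dd) , 0)) (just (rb , 8)) k × n ≤ dd * 10 + 3 × μ′ ≡ μ)
      (env base q x c ia jb t u (just (ra , 8)) (just (1 , 0)) (just (rb , 8)) k) μ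
  wp-dot {base} {q} {x} {ia} {jb} {k = k} {f} {h} {a} {b} {ra} {rb} {μ = μ} sA sB refl refl a≤ b≤ =
    wp-forTo E F 10 (λ _ μ′ → μ′ ≡ μ)
      (⊒-++ params (same (same (same (bump refl z≤n (same (same (drop (drop ⊒-refl)))))))) , refl)
      (λ _ _ → refl , refl) (λ _ → refl) body refl
    where
    E F : ℕ → Env
    E y = env base q x (just (y , 1)) ia jb nothing nothing (just (EA + a , 8))
            (just (bit (disjoint f h a b y) , 0)) (just (EB + b , 8)) k
    F y = env base q x (just (y , 1)) ia jb (just (bit (y <ᵇ dd) , 0)) nothing (just (EA + a , 8))
            (just (bit (disjoint f h a b y) , 0)) (just (EB + b , 8)) k
    body : ∀ y μ′ → y < dd → μ′ ≡ μ →
      wp (straight dotBody) (λ u e μ″ → e ⊒ E (suc y) × 3 + u ≤ 10 × μ″ ≡ μ) (F y) μ′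
    body y _ y<dd refl = wp-known {i = 1} rDD refl λ dd≤ →
      wp-straight dotBody
        ( ⊒-++ params (same (same (same (bump (+-comm y 1) (≤-trans y<dd dd≤) (same (same (drop (drop (same
            (bump acc-step (bit≤1 (disjoint f h a b (suc y))) ⊒-refl))))))))))
        , ≤-refl , refl)
      where
      cellA : μ (EA + a + y) ≡ bit (f (a + y))
      cellA = trans (cong μ (+-assoc EA a y)) (sA (≤-trans (+-monoʳ-< a y<dd) a≤))
      cellB : μ (EB + b + y) ≡ bit (h (b + y))
      cellB = trans (cong μ (+-assoc EB b y)) (sB (≤-trans (+-monoʳ-< b y<dd) b≤))
      acc-step : bit (μ (EA + a + y) * μ (EB + b + y) <ᵇ bit (disjoint f h a b y)) ≡ bit (disjoint f h a b (suc y))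
      acc-step = trans (cong₂ (λ p r → bit (p * r <ᵇ bit (disjoint f h a b y))) cellA cellB)
        (bit-step (disjoint f h a b y) (f (a + y)) (h (b + y)))

  EA<base₀ : ∀ {x} → x < nn → EA + x < base₀
  EA<base₀ h = ≤-trans (+-monoʳ-< EA h) (m≤m+n EB nn)

  EB<base₀ : ∀ {x} → x < nn → EB + x < base₀
  EB<base₀ h = +-monoʳ-< EB h

  record Copied (μ₀ : Mem) (f h : ℕ → Bool) (a b bs l : ℕ) (μ : Mem) : Set where
    field
      left   : ∀ {y} → y < l → μ (bs + y) ≡ truncate w (bit (f (a + y)))
      right  : ∀ {y} → y < l → μ (bs + y + sd) ≡ truncate w (bit (h (b + y)))
      frame  : ∀ z → z < bs ⊎ bs + (sd + sd) ≤ z → μ z ≡ μ₀ z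

  open Copied public

  wp-copy : ∀ {q x c t u v acc w′ k f h a b ia jb bs μ} →
    Stored μ EA f nn → Stored μ EB h nn →
    ia ≡ EA + a → jb ≡ EB + b → a + sd ≤ nn → b + sd ≤ nn → base₀ ≤ bs →
    wp copyLoop
      (λ n e μ′ → e ≡ env (just (bs , 9)) q (just (sd , 2)) c (just (ia , 7)) (just (jb , 7))
                    (just (bit (sd <ᵇ sd) , 0)) nothing nothing acc w′ k
                × n ≤ sd * 14 + 3 × Copied μ f h a b bs sd μ′)
      (env (just (bs , 9)) q x c (just (ia , 7)) (just (jb , 7)) t u v acc w′ k) μ
  wp-copy {q} {x} {c} {acc = acc} {w′} {k} {f} {h} {a} {b} {bs = bs} {μ} sA sB refl refl a≤ b≤ bs≥ =
    wp-forTo E F 14 (Copied μ f h a b bs)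
      (⊒-++ params (same (same (bump refl z≤n (same (same (same (drop (drop (drop ⊒-refl))))))))) , refl)
      (λ _ _ → refl , refl) (λ _ → refl) body
      (record { left = λ () ; right = λ () ; frame = λ _ _ → refl })
    where
    E F : ℕ → Env
    E y = env (just (bs , 9)) q (just (y , 2)) c (just (EA + a , 7)) (just (EB + b , 7))
            nothing nothing nothing acc w′ k
    F y = env (just (bs , 9)) q (just (y , 2)) c (just (EA + a , 7)) (just (EB + b , 7))
            (just (bit (y <ᵇ sd) , 0)) nothing nothing acc w′ k
    body : ∀ y μ′ → y < sd → Copied μ f h a b bs y μ′ →
      wp (straight copyBody) (λ u e μ″ → e ⊒ E (suc y) × 3 + u ≤ 14 × Copied μ f h a b bs (suc y) μ″) (F y) μ′
    body y μ′ y<sd cp = wp-known {i = 2} rSD refl λ sd≤ →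
      wp-straight copyBody
        ( ⊒-++ params (same (same (bump (+-comm y 1) (≤-trans y<sd sd≤)
            (same (same (same (drop (drop (drop ⊒-refl)))))))))
        , ≤-refl , record { left = left′ ; right = right′ ; frame = frame′ })
      where
      μ₁ μ₂ : Mem
      v₁ v₂ : ℕ
      v₁ = remainder (μ′ (EA + a + y)) (2 ^ w)
      μ₁ = μ′ [ bs + y ≔ v₁ ]
      v₂ = remainder (μ₁ (EB + b + y)) (2 ^ w)
      μ₂ = μ₁ [ bs + y + sd ≔ v₂ ]
      inA : EA + a + y < base₀
      inA = subst (_< base₀) (sym (+-assoc EA a y)) (EA<base₀ (≤-trans (+-monoʳ-< a y<sd) a≤))
      inB : EB + b + y < base₀
      inB = subst (_< base₀) (sym (+-assoc EB b y)) (EB<base₀ (≤-trans (+-monoʳ-< b y<sd) b≤))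
      outside : ∀ z → z < bs ⊎ bs + (sd + sd) ≤ z → μ₂ z ≡ μ′ z
      outside z (inj₁ z<) = trans
        (≔-other μ₁ (<⇒≢ (≤-trans z< (≤-trans (m≤m+n bs y) (m≤m+n (bs + y) sd)))))
        (≔-other μ′ (<⇒≢ (≤-trans z< (m≤m+n bs y))))
      outside z (inj₂ z≥) = trans
        (≔-other μ₁ (>⇒≢ (≤-trans (≤-trans (s≤s (≤-reflexive (+-assoc bs y sd))) (+-monoʳ-< bs (+-monoˡ-< sd y<sd))) z≥)))
        (≔-other μ′ (>⇒≢ (≤-trans (+-monoʳ-< bs (≤-trans y<sd (m≤m+n sd sd))) z≥)))
      v₁≡ : v₁ ≡ truncate w (bit (f (a + y)))
      v₁≡ = trans (remainder-% _ (2 ^ w) ⦃ 2^≢0 w ⦄) (cong (truncate w) (trans (frame cp _ (inj₁ (≤-trans inA bs≥)))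
        (trans (cong μ (+-assoc EA a y)) (sA (≤-trans (+-monoʳ-< a y<sd) a≤)))))
      v₂≡ : v₂ ≡ truncate w (bit (h (b + y)))
      v₂≡ = trans (remainder-% _ (2 ^ w) ⦃ 2^≢0 w ⦄) (cong (truncate w)
        (trans (≔-other μ′ (<⇒≢ (≤-trans inB (≤-trans bs≥ (m≤m+n bs y)))))
        (trans (frame cp _ (inj₁ (≤-trans inB bs≥)))
        (trans (cong μ (+-assoc EB b y)) (sB (≤-trans (+-monoʳ-< b y<sd) b≤))))))
      apart : ∀ y {z} → z < sd → bs + z ≢ bs + y + sd
      apart y {z} z<sd p = <⇒≢ (≤-trans z<sd (m≤n+m sd y)) (+-cancelˡ-≡ bs z _ (trans p (+-assoc bs y sd)))
      left′ : ∀ {z} → z < suc y → μ₂ (bs + z) ≡ truncate w (bit (f (a + z)))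
      left′ = <-suc-cases (λ z → μ₂ (bs + z) ≡ truncate w (bit (f (a + z))))
        (λ {z} z<y → trans (≔-other μ₁ (apart y (<-trans z<y y<sd)))
          (trans (≔-other μ′ (λ p → <⇒≢ z<y (+-cancelˡ-≡ bs z y p))) (left cp z<y)))
        (trans (≔-other μ₁ (apart y y<sd)) (trans (≔-same {μ′} {bs + y}) v₁≡))
      right′ : ∀ {z} → z < suc y → μ₂ (bs + z + sd) ≡ truncate w (bit (h (b + z)))
      right′ = <-suc-cases (λ z → μ₂ (bs + z + sd) ≡ truncate w (bit (h (b + z))))
        (λ {z} z<y → trans (≔-other μ₁ (λ p → <⇒≢ z<y (+-cancelˡ-≡ bs z y (+-cancelʳ-≡ sd _ _ p))))
          (trans (≔-other μ′ (≢-sym (apart z y<sd))) (right cp z<y)))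
        (trans (≔-same {μ₁} {bs + y + sd}) v₂≡)
      frame′ : ∀ z → z < bs ⊎ bs + (sd + sd) ≤ z → μ₂ z ≡ μ z
      frame′ z h = trans (outside z h) (frame cp z h)

  source : ℕ → ℕ
  source x = remainder (quotient x dd) n * d + remainder x dd

  -- The rows beyond the input repeat it cyclically, which changes neither list as a set.
  extendA extendB : (ℕ → Bool) → ℕ → Bool
  extendA f x = (remainder x dd <ᵇ d) ∧ f (source x)
  extendB f x = if remainder x dd <ᵇ d then f (source x) else true

  -- The content m of the loaded cell is known only under the mask. For a column that is not in the
  -- input, the computed address may be that of an unrelated cell, whose content the factor 0 wipes
  -- out.
  mask-∧ : ∀ b {m y} → (b ≡ true → m ≡ bit y) → m * bit b ≡ bit (b ∧ y)
  mask-∧ true  {m} h = trans (*-identityʳ m) (h refl)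
  mask-∧ false {m} h = *-zeroʳ m

  mask-if : ∀ b {m y} → (b ≡ true → m ≡ bit y) → bit (m * bit b ≡ᵇ bit b) ≡ bit (if b then y else true)
  mask-if true {y = true}  h rewrite h refl = refl
  mask-if true {y = false} h rewrite h refl = refl
  mask-if false {m}        h = cong (λ v → bit (v ≡ᵇ 0)) (*-zeroʳ m)

  record Extended (μ₀ : Mem) (fA fB : ℕ → Bool) (l : ℕ) (μ : Mem) : Set where
    field
      storedA : Stored μ EA (extendA fA) l
      storedB : Stored μ EB (extendB fB) l
      input≡  : ∀ {z} → z < EA → μ z ≡ μ₀ z
      fresh   : ∀ {z} → base₀ ≤ z → μ z ≡ 0

  open Extended public

  wp-extend : ∀ {base q x c ia jb t u v acc w′ k fA fB μ} → 0 < n →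
    Stored μ 0 fA nd → Stored μ nd fB nd → (∀ {z} → EA ≤ z → μ z ≡ 0) →
    wp extendLoop
      (λ n e μ′ → e ≡ env base q (just (nn , 4)) c ia jb (just (bit (nn <ᵇ nn) , 0)) nothing nothing acc nothing k
                × n ≤ nn * 20 + 3 × Extended μ fA fB nn μ′)
      (env base q x c ia jb t u v acc w′ k) μ
  wp-extend {base} {q} {x} {c} {ia} {jb} {acc = acc} {k = k} {fA} {fB} {μ} n>0 inA inB zero≥ =
    wp-forTo E F 20 (Extended μ fA fB)
      (⊒-++ params (same (same (bump refl z≤n (same (same (same (drop (drop (drop (same (drop ⊒-refl))))))))))) , refl)
      (λ _ _ → refl , refl) (λ _ → refl) body
      (record { storedA = λ () ; storedB = λ () ; input≡ = λ _ → refl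
              ; fresh = λ h → zero≥ (≤-trans (≤-trans (m≤m+n EA nn) (m≤m+n EB nn)) h) })
    where
    E F : ℕ → Env
    E y = env base q (just (y , 4)) c ia jb nothing nothing nothing acc nothing k
    F y = env base q (just (y , 4)) c ia jb (just (bit (y <ᵇ nn) , 0)) nothing nothing acc nothing k
    body : ∀ y μ′ → y < nn → Extended μ fA fB y μ′ →
      wp (straight extendBody) (λ u e μ″ → e ⊒ E (suc y) × 3 + u ≤ 20 × Extended μ fA fB (suc y) μ″) (F y) μ′
    body y μ′ y<nn ex = wp-known {i = 4} rNN refl λ nn≤ →
      wp-straight extendBody
        ( ⊒-++ params (same (same (bump (+-comm y 1) (≤-trans y<nn nn≤)
            (same (same (same (drop (drop (drop (same (drop ⊒-refl)))))))))))
        , ≤-refl , record { storedA = storedA′ ; storedB = storedB′ ; input≡ = input≡′ ; fresh = fresh′ })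
      where
      col : Bool
      col = remainder y dd <ᵇ d
      v₁ v₂ : ℕ
      μ₁ μ₂ : Mem
      v₁ = μ′ (source y) * bit col
      μ₁ = μ′ [ EA + y ≔ v₁ ]
      v₂ = bit (μ₁ (source y + nd) * bit col ≡ᵇ bit col)
      μ₂ = μ₁ [ EB + y ≔ v₂ ]
      source< : remainder y dd < d → source y < nd
      source< c< = digits-< (remainder-< (quotient y dd) n>0) c<
      src : col ≡ true → source y < nd
      src p = source< (<ᵇ-true⁻¹ (remainder y dd) d p)
      v₁≡ : v₁ ≡ bit (extendA fA y)
      v₁≡ = mask-∧ col λ p → trans (input≡ ex (≤-trans (src p) (m≤m+n nd nd))) (inA (src p))
      v₂≡ : v₂ ≡ bit (extendB fB y)
      v₂≡ = mask-if col λ p → trans (≔-other μ′ (<⇒≢ (≤-trans (+-monoˡ-< nd (src p)) (m≤m+n EA y))))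
          (trans (input≡ ex (+-monoˡ-< nd (src p))) (trans (cong μ (+-comm (source y) nd)) (inB (src p))))
      cross : ∀ {z z′} → z < nn → EA + z ≢ EB + z′
      cross {z} {z′} z< = <⇒≢ (≤-trans (+-monoʳ-< EA z<) (m≤m+n EB z′))
      storedA′ : Stored μ₂ EA (extendA fA) (suc y)
      storedA′ = <-suc-cases (λ z → μ₂ (EA + z) ≡ bit (extendA fA z))
        (λ {z} z<y → trans (≔-other μ₁ (cross (<-trans z<y y<nn)))
          (trans (≔-other μ′ (λ p → <⇒≢ z<y (+-cancelˡ-≡ EA z y p))) (storedA ex z<y)))
        (trans (≔-other μ₁ (cross y<nn)) (trans (≔-same {μ′} {EA + y}) v₁≡))
      storedB′ : Stored μ₂ EB (extendB fB) (suc y)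
      storedB′ = <-suc-cases (λ z → μ₂ (EB + z) ≡ bit (extendB fB z))
        (λ {z} z<y → trans (≔-other μ₁ (λ p → <⇒≢ z<y (+-cancelˡ-≡ EB z y p)))
          (trans (≔-other μ′ (≢-sym (cross y<nn))) (storedB ex z<y)))
        (trans (≔-same {μ₁} {EB + y}) v₂≡)
      input≡′ : ∀ {z} → z < EA → μ₂ z ≡ μ z
      input≡′ {z} z< = trans (≔-other μ₁ (<⇒≢ (≤-trans z< (≤-trans (m≤m+n EA nn) (m≤m+n EB y)))))
        (trans (≔-other μ′ (<⇒≢ (≤-trans z< (m≤m+n EA y)))) (input≡ ex z<))
      fresh′ : ∀ {z} → base₀ ≤ z → μ₂ z ≡ 0
      fresh′ {z} h = trans (≔-other μ₁ (>⇒≢ (≤-trans (EB<base₀ y<nn) h)))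
        (trans (≔-other μ′ (>⇒≢ (≤-trans (EA<base₀ y<nn) h))) (fresh ex h))

  nn≡ : nn ≡ rows * dd
  nn≡ = sym (*-assoc g s dd)

  row-offset : ∀ i u → i * sd + u * dd ≡ (i * s + u) * dd
  row-offset i u = trans (cong (_+ u * dd) (sym (*-assoc i s dd))) (sym (*-distribʳ-+ dd (i * s) u))

  row-fits : ∀ {r} → r < rows → r * dd + dd ≤ nn
  row-fits {r} r< = ≤-trans (≤-reflexive (+-comm (r * dd) dd)) (≤-trans (*-monoˡ-≤ dd r<) (≤-reflexive (sym nn≡)))

  bit-cases : ∀ {b} → bit b ≡ 0 → b ≡ false
  bit-cases {false} _ = refl

  bit-cases′ : ∀ {b} → bit b ≢ 0 → b ≡ true
  bit-cases′ {true}  _ = refl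
  bit-cases′ {false} h = contradiction refl h

  module Flagged (d<dd : d < dd) (f₀ h : ℕ → Bool) (h-top : ∀ r → h (r * dd + d) ≡ true) where

    open Flags dd d rows d<dd f₀ h h-top

    record Arrays (f : ℕ → Bool) (μ : Mem) : Set where
      field
        storedA : Stored μ EA f nn
        storedB : Stored μ EB h nn
        valid   : Valid f

    open Arrays public

    -- The rows numbered u of group i of the first array and v of group j of the second.
    separated : (ℕ → Bool) → ℕ → ℕ → ℕ → ℕ → Set
    separated f i j u v = disjoint f h ((i * s + u) * dd) ((j * s + v) * dd) dd ≡ false

    -- `done` refers to the current flags. A pair found disjoint is separated by the flag it causes,
    -- and flags are never withdrawn, so a pair once dealt with stays so.
    record Scanned (fˢ : ℕ → Bool) (μˢ : Mem) (i j y : ℕ) (μ : Mem) : Set where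
      field
        current : ℕ → Bool
        arrays  : Arrays current μ
        grows   : fˢ ⊑ current
        done    : ∀ {y′} → y′ < y → separated current i j (quotient y′ s) (remainder y′ s)
        same≥   : ∀ {z} → base₀ ≤ z → μ z ≡ μˢ z

    open Scanned public

    store-flag : ∀ {f μ r v} → Arrays f μ → r < rows → v < rows →
      disjoint f h (r * dd) (v * dd) dd ≡ true →
      Arrays (mark f r) (μ [ EA + (r * dd + d) ≔ 1 ])
    store-flag {f} {μ} {r} {v} ar r< v< p = record
      { storedA = λ {x} → marked x
      ; storedB = λ {x} x< → trans (≔-other μ (>⇒≢ (≤-trans (+-monoʳ-< EA cell<) (m≤m+n EB x)))) (storedB ar x<)
      ; valid = valid-mark r v (valid ar) v< p
      }
      where
      cell< : r * dd + d < nn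
      cell< = ≤-trans (+-monoʳ-< (r * dd) d<dd) (row-fits r<)
      marked : ∀ x → x < nn → (μ [ EA + (r * dd + d) ≔ 1 ]) (EA + x) ≡ bit (mark f r x)
      marked x x< with x ≟ r * dd + d
      ... | yes refl = trans (≔-same {μ} {EA + x}) (cong bit (sym (mark-flag f r)))
      ... | no  x≢   = trans (≔-other μ (x≢ ∘ +-cancelˡ-≡ EA x _))
                             (trans (storedA ar x<) (cong bit (sym (mark-other f r x≢))))

    wp-brute : ∀ {q x c t u v acc w′ k f i j ia jb bs μ} → 0 < s → i < g → j < g → Arrays f μ →
      ia ≡ EA + i * sd → jb ≡ EB + j * sd →
      wp bruteLoop
        (λ n e μ′ → e ≡ env (just (bs , 9)) q (just (ss , 2)) nothing (just (ia , 7)) (just (jb , 7))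
                          (just (bit (ss <ᵇ ss) , 0)) nothing nothing nothing nothing k
                  × n ≤ ss * (dd * 10 + 17) + 3 × Scanned f μ i j ss μ′)
        (env (just (bs , 9)) q x c (just (ia , 7)) (just (jb , 7)) t u v acc w′ k) μ
    wp-brute {q} {k = k} {f} {i} {j} {bs = bs} {μ} s>0 i< j< ar refl refl =
      wp-forTo E F (dd * 10 + 17) (Scanned f μ i j)
        (⊒-++ params (same (same (bump refl z≤n (drop (same (same (drop (drop (drop (drop (drop ⊒-refl))))))))))) , refl)
        (λ _ _ → refl , refl) (λ _ → refl) body
        (record { current = f ; arrays = ar ; grows = id ; done = λ () ; same≥ = λ _ → refl })
      where
      ia = EA + i * sd
      jb = EB + j * sd
      E F : ℕ → Env
      E y = env (just (bs , 9)) q (just (y , 2)) nothing (just (ia , 7)) (just (jb , 7))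
              nothing nothing nothing nothing nothing k
      F y = env (just (bs , 9)) q (just (y , 2)) nothing (just (ia , 7)) (just (jb , 7))
              (just (bit (y <ᵇ ss) , 0)) nothing nothing nothing nothing k
      body : ∀ y μ′ → y < ss → Scanned f μ i j y μ′ →
        wp bruteBody (λ u e μ″ → e ⊒ E (suc y) × 3 + u ≤ dd * 10 + 17 × Scanned f μ i j (suc y) μ″) (F y) μ′
      body y μ′ y<ss sc = wp-known {i = 2} rSS refl λ ss≤ →
        wp-⨾ (wp-straight locate
          {Q = λ n e μ″ → n ≡ 7 × e ≡ env (just (bs , 9)) q (just (y , 2)) nothing (just (ia , 7)) (just (jb , 7))
             (just (bit (y <ᵇ ss) , 0)) nothing (just (ra , 8)) (just (1 , 0)) (just (rb , 8)) k × μ″ ≡ μ′}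
          (refl , refl , refl))
        λ { _ _ _ (refl , refl , refl) →
        wp-⨾ (wp-dot {f = f′} {h} {r * dd} {r′ * dd}
                (storedA (arrays sc)) (storedB (arrays sc)) ra≡ rb≡ (row-fits r<) (row-fits r′<))
        λ { n _ _ (refl , n≤ , refl) →
        wp-⨾ (wp-straight (arith add rV rV rD ∷ []) {Q = λ n e μ″ → n ≡ 1 × e ≡ E₁ × μ″ ≡ μ′} (refl , refl , refl))
        λ { _ _ _ (refl , refl , refl) →
        wp-⨾ (wp-when {Q = λ n e μ″ → n ≤ 2 × e ≡ E₁ × Scanned f μ i j (suc y) μ″} {i = 0} refl
          (λ z → s≤s z≤n , refl , skip (bit-cases z))
          (λ z → wp-straight (store rV rOne ∷ []) (≤-refl , refl , take (bit-cases′ z))))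
        λ { m _ _ (m≤ , refl , sc′) →
        wp-straight (arith add rX rX rOne ∷ [])
          ( ⊒-++ params (same (same (bump (+-comm y 1) (≤-trans y<ss ss≤)
              (drop (same (same (drop (drop (drop (drop (drop ⊒-refl)))))))))))
          , cost n≤ m≤ , sc′) } } } }
        where
        uᵢ = quotient y s
        vⱼ = remainder y s
        r  = i * s + uᵢ
        r′ = j * s + vⱼ
        ra = ia + uᵢ * dd
        rb = jb + vⱼ * dd
        f′ = current sc
        r< : r < rows
        r< = digits-< i< (quotient-< y<ss)
        r′< : r′ < rows
        r′< = digits-< j< (remainder-< y s>0)
        ra≡ : ra ≡ EA + r * dd
        ra≡ = trans (+-assoc EA _ _) (cong (EA +_) (row-offset i uᵢ))
        rb≡ : rb ≡ EB + r′ * dd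
        rb≡ = trans (+-assoc EB _ _) (cong (EB +_) (row-offset j vⱼ))
        E₁ : Env
        E₁ = env (just (bs , 9)) q (just (y , 2)) (just (dd , 1)) (just (ia , 7)) (just (jb , 7))
             (just (bit (dd <ᵇ dd) , 0)) nothing (just (ra + d , 9))
             (just (bit (disjoint f′ h (r * dd) (r′ * dd) dd) , 0)) (just (rb , 8)) k
        skip : disjoint f′ h (r * dd) (r′ * dd) dd ≡ false → Scanned f μ i j (suc y) μ′
        skip p = record
          { current = f′ ; arrays = arrays sc ; grows = grows sc
          ; done = <-suc-cases (λ y′ → separated f′ i j (quotient y′ s) (remainder y′ s)) (done sc) p
          ; same≥ = same≥ sc }
        addr≡ : EA + (r * dd + d) ≡ ra + d
        addr≡ = trans (sym (+-assoc EA _ d)) (cong (_+ d) (sym ra≡))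
        take : disjoint f′ h (r * dd) (r′ * dd) dd ≡ true → Scanned f μ i j (suc y) (μ′ [ ra + d ≔ 1 ])
        take p = record
          { current = mark f′ r
          ; arrays = subst (λ a → Arrays (mark f′ r) (μ′ [ a ≔ 1 ])) addr≡ (store-flag (arrays sc) r< r′< p)
          ; grows = λ q → ⊑-mark f′ r (grows sc q)
          ; done = <-suc-cases (λ y′ → separated (mark f′ r) i j (quotient y′ s) (remainder y′ s))
              (λ {y′} y′< → disjoint-mono {f′} {mark f′ r} {h} {(i * s + quotient y′ s) * dd} dd (⊑-mark f′ r) (done sc y′<))
              (disjoint-hit {mark f′ r} {h} {r * dd} {r′ * dd} dd d<dd (mark-flag f′ r) (h-top r′))
          ; same≥ = λ {z} z≥ → trans (≔-other μ′ (>⇒≢ (≤-trans (s≤s (≤-reflexive (sym addr≡)))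
              (≤-trans (EA<base₀ (≤-trans (+-monoʳ-< (r * dd) d<dd) (row-fits r<))) z≥)))) (same≥ sc z≥) }
        cost : ∀ {n m} → n ≤ dd * 10 + 3 → m ≤ 2 → 3 + (7 + (n + (1 + (m + 1)))) ≤ dd * 10 + 17
        cost n≤ m≤ = ≤-trans (+-monoʳ-≤ 10 (+-mono-≤ n≤ (s≤s (+-monoˡ-≤ 1 m≤)))) (≤-reflexive (eq′ (dd * 10)))
          where
          eq′ : ∀ x → 10 + (x + 3 + (1 + (2 + 1))) ≡ x + 17
          eq′ = solve-∀

    allFlagged : (ℕ → Bool) → ℕ → Bool
    allFlagged f zero    = true
    allFlagged f (suc r) = allFlagged f r ∧ flag f r

    wp-scan : ∀ {base q x c ia jb t u v w′ k f μ} → Stored μ EA f nn →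
      wp scanLoop
        (λ n e μ′ → e ≡ env base q (just (rows , 3)) c ia jb (just (bit (rows <ᵇ rows) , 0)) u v
                          (just (bit (allFlagged f rows) , 0)) w′ k
                  × n ≤ rows * 10 + 3 × μ′ ≡ μ)
        (env base q x c ia jb t u v (just (1 , 0)) w′ k) μ
    wp-scan {base} {q} {x} {c} {ia} {jb} {t} {u} {v} {w′} {k} {f} {μ} st =
      wp-forTo E F 10 (λ _ μ′ → μ′ ≡ μ)
        (⊒-++ params (same (same (bump refl z≤n (same (same (same (drop ⊒-refl))))))) , refl)
        (λ _ _ → refl , refl) (λ _ → refl) body refl
      where
      E F : ℕ → Env
      E y = env base q (just (y , 3)) c ia jb nothing u v (just (bit (allFlagged f y) , 0)) w′ k
      F y = env base q (just (y , 3)) c ia jb (just (bit (y <ᵇ rows) , 0)) u v (just (bit (allFlagged f y) , 0)) w′ k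
      body : ∀ y μ′ → y < rows → μ′ ≡ μ →
        wp (straight scanBody) (λ u e μ″ → e ⊒ E (suc y) × 3 + u ≤ 10 × μ″ ≡ μ) (F y) μ′
      body y _ y< refl = wp-known {i = 3} rRows refl λ rows≤ →
        wp-straight scanBody
          ( ⊒-++ params (same (same (bump (+-comm y 1) (≤-trans y< rows≤) (same (same (same (drop (same (same
              (bump acc≡ (bit≤1 (allFlagged f (suc y))) ⊒-refl))))))))))
          , ≤-refl , refl)
        where
        bits : ∀ a b → bit (bit (bit b <ᵇ 1) <ᵇ bit a) ≡ bit (a ∧ b)
        bits true  true  = refl
        bits true  false = refl
        bits false true  = refl
        bits false false = refl
        acc≡ : bit (bit (μ (EA + (y * dd + d)) <ᵇ 1) <ᵇ bit (allFlagged f y)) ≡ bit (allFlagged f (suc y))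
        acc≡ = trans (cong (λ v → bit (bit (v <ᵇ 1) <ᵇ bit (allFlagged f y)))
            (st (≤-trans (+-monoʳ-< (y * dd) d<dd) (row-fits y<))))
          (bits (allFlagged f y) (flag f y))

  -- The main loop over pairs of groups

  baseAt : ℕ → ℕ
  baseAt q = base₀ + q * stride

  baseAt-suc : ∀ q → baseAt q + stride ≡ baseAt (suc q)
  baseAt-suc q = trans (+-assoc base₀ (q * stride) stride) (cong (base₀ +_) (+-comm (q * stride) stride))

  -- The register grows by one addition per round, which taken literally would raise its degree each
  -- time. The closed form has degree 9 in all rounds: 6 for `base₀`, 4 + 4 for the product, and one
  -- more for their sum.
  baseAt-≤ : ∀ {q} → q ≤ gg → EB ≤ B ^ 5 → nn ≤ B ^ 4 → stride ≤ B ^ 4 → gg ≤ B ^ 4 → baseAt q ≤ B ^ 9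
  baseAt-≤ {q} q≤ EB≤ nn≤ st≤ gg≤ = degree-sound add {6} {8} {a = base₀} {q * stride} refl
    (degree-sound add {5} {4} {a = EB} {nn} refl EB≤ nn≤)
    (degree-sound mul {4} {4} {a = q} {stride} refl (≤-trans q≤ gg≤) st≤)

  module Decided (d<dd : d < dd) (f₀ h : ℕ → Bool) (h-top : ∀ r → h (r * dd + d) ≡ true)
                 (s>0 : 0 < s) (w≤W : w ≤ W) (2^w≤B : 2 ^ w ≤ B)
                 (p : Program) (T : ℕ) (oracle : ∀ F G → Decides p w s dd T F G) where

    open Flags dd d rows d<dd f₀ h h-top
    open Flagged d<dd f₀ h h-top

    bruteTime roundTime : ℕ
    bruteTime = ss * (dd * 10 + 17) + 3
    roundTime = sd * 14 + (regBound p + T * 2) + 18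

    -- The number of flagged rows serves as a potential. Searches may be spread unevenly over the
    -- rounds, but each is charged to a flag, and there are never more than `rows` flags.
    record Rounds (q u : ℕ) (μ : Mem) : Set where
      field
        current : ℕ → Bool
        arrays  : Arrays current μ
        fresh   : ∀ {z} → baseAt q ≤ z → μ z ≡ 0
        done    : ∀ {q′} → q′ < q → ∀ {u v} → u < s → v < s → separated current (quotient q′ g) (remainder q′ g) u v
        paid    : u ≤ q * roundTime + count current rows * bruteTime

    g>0 : 0 < g
    g>0 = ≤-trans (s≤s z≤n) (≤-reflexive (sym (+-comm (quotient n s) 1)))

    arrays-frame : ∀ {f μ μ′} → (∀ {z} → z < base₀ → μ′ z ≡ μ z) → Arrays f μ → Arrays f μ′
    arrays-frame kept ar = record
      { storedA = λ x< → trans (kept (EA<base₀ x<)) (storedA ar x<)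
      ; storedB = λ x< → trans (kept (EB<base₀ x<)) (storedB ar x<)
      ; valid = valid ar }

    shift : ∀ {f f′ : ℕ → Bool} i u → (∀ {x} → f x ≡ f′ (i * sd + x)) → ∀ {y} → f (u * dd + y) ≡ f′ ((i * s + u) * dd + y)
    shift {f′ = f′} i u h {y} = trans h (cong f′ (trans (sym (+-assoc (i * sd) (u * dd) y)) (cong (_+ y) (row-offset i u))))

    disjoint-group : ∀ f i j u v →
      disjoint (λ x → f (i * sd + x)) (λ x → h (j * sd + x)) (u * dd) (v * dd) dd ≡
      disjoint f h ((i * s + u) * dd) ((j * s + v) * dd) dd
    disjoint-group f i j u v = disjoint-cong {b = v * dd} {b′ = (j * s + v) * dd} dd
      (λ _ → shift {f′ = f} i u refl) (λ _ → shift {f′ = h} j v refl)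

    -- Round q once the simulated run has answered; f is the first array.
    module Round {q : ℕ} {f : ℕ → Bool} {μ₁ : Mem} (q< : q < gg) (arrays₁ : Arrays f μ₁)
                 (fresh₁ : ∀ {z} → baseAt (suc q) ≤ z → μ₁ z ≡ 0) where

      i j : ℕ
      i = quotient q g
      j = remainder q g

      i< : i < g
      i< = quotient-< q<

      j< : j < g
      j< = remainder-< q g>0

      group : Decides p w s dd T (λ x → f (i * sd + x)) (λ x → h (j * sd + x))
      group = oracle _ _

      E₂ : Env
      E₂ = env (just (baseAt (suc q) , 9)) (just (q , 4))
             nothing nothing nothing nothing nothing nothing nothing nothing nothing nothing

      -- A positive answer pays for the brute-force search with a newly flagged row.
      record After (m : ℕ) (μ : Mem) : Set where
        field
          current : ℕ → Bool
          arrays  : Arrays current μ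
          fresh   : ∀ {z} → baseAt (suc q) ≤ z → μ z ≡ 0
          grows   : f ⊑ current
          done    : ∀ {u v} → u < s → v < s → separated current i j u v
          paid    : m + count f rows * bruteTime ≤ 1 + count current rows * bruteTime

      none-found : regs (final group) 0 ≡ 0 → After 1 μ₁
      none-found z with verdict group
      ... | inj₁ (z′ , _) = contradiction (trans (sym z) z′) λ ()
      ... | inj₂ (_ , no-pair) = record
        { current = f ; arrays = arrays₁ ; fresh = fresh₁ ; grows = id
        ; done = λ {u} {v} u< v< → trans (sym (disjoint-group f i j u v)) (no-pair u< v<)
        ; paid = ≤-refl }

      some-found : ∀ {m μ} → regs (final group) 0 ≢ 0 → m ≤ bruteTime → Scanned f μ₁ i j ss μ → After (suc m) μ
      some-found {m} {μ} nz m≤ sc with verdict group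
      ... | inj₂ (z , _) = contradiction z nz
      ... | inj₁ (_ , u , v , u< , v< , p≡) = record
        { current = f′ ; arrays = arrays sc
        ; fresh = λ z≥ → trans (same≥ sc (≤-trans (m≤m+n base₀ _) z≥)) (fresh₁ z≥)
        ; grows = grows sc
        ; done = done′
        ; paid = s≤s (≤-trans (+-monoˡ-≤ _ m≤) (*-monoˡ-≤ bruteTime more)) }
        where
        f′ = Scanned.current sc
        done′ : ∀ {u v} → u < s → v < s → separated f′ i j u v
        done′ {u} {v} u< v< = subst₂ (separated f′ i j) (quotient-digits u v<) (remainder-digits u v<)
          (done sc (digits-< u< v<))
        found : disjoint f h ((i * s + u) * dd) ((j * s + v) * dd) dd ≡ true
        found = trans (sym (disjoint-group f i j u v)) p≡
        more : count f rows < count f′ rows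
        more = count-strict (grows sc) {i * s + u} {rows} (digits-< i< u<)
          (disjoint⇒unflagged f (i * s + u) (j * s + v) found)
          (newly-flagged (i * s + u) (j * s + v) (valid arrays₁) (valid (arrays sc)) (grows sc) found (done′ u< v<))

      wp-respond : ∀ {k l} →
        wp (when rU bruteLoop) (λ m e μ → e ⊒ E₂ × After m μ)
          (env (just (baseAt (suc q) , 9)) (just (q , 4)) (just (sd , 2)) nothing
               (just (EA + i * sd , 7)) (just (EB + j * sd , 7)) nothing (just (regs (final group) 0 , k)) nothing nothing nothing l) μ₁
      wp-respond = wp-when refl
        (λ z → ⊒-++ params (same (same (drop (same (drop (drop (same (drop (same (same (same (drop none))))))))))))
             , none-found z)
        λ nz → wp-⇒ (wp-brute {bs = baseAt (suc q)} s>0 i< j< arrays₁ refl refl)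
          λ { m _ _ (refl , m≤ , sc) →
            ⊒-++ params (same (same (drop (same (drop (drop (drop (same (same (same (same (drop none))))))))))))
            , some-found nz m≤ sc }

    open Rounds

    wp-main : ∀ {q x c ia jb t u v acc w′ k f μ} → Arrays f μ → (∀ {z} → base₀ ≤ z → μ z ≡ 0) →
      count f rows ≡ 0 →
      wp (mainLoop p)
        (λ n e μ′ → e ≡ env (just (baseAt gg , 9)) (just (gg , 4)) nothing nothing nothing nothing
                         (just (bit (gg <ᵇ gg) , 0)) nothing nothing nothing nothing nothing
                  × ∃[ n′ ] Rounds gg n′ μ′ × n ≤ n′ + 3)
        (env (just (base₀ , 6)) q x c ia jb t u v acc w′ k) μ
    wp-main {f = f} {μ} ar fr z =
      wp-known {i = 4} rNN refl λ nn≤ → wp-known {i = 5} rEB refl λ EB≤ →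
      wp-known {i = 4} rStride refl λ st≤ → wp-known {i = 4} rGG refl λ gg≤ →
      wp-forTo-amortised E F Rounds
        (⊒-++ params (bump (sym (+-identityʳ base₀)) (baseAt-≤ z≤n EB≤ nn≤ st≤ gg≤) (bump refl z≤n
           (drop (drop (drop (drop (drop (drop (drop (drop (drop (drop none)))))))))))) , refl)
        (λ _ _ → refl , refl) (λ _ → refl)
        (body EB≤ nn≤ st≤ gg≤)
        (record { current = f ; arrays = ar ; fresh = λ z≥ → fr (≤-trans (≤-reflexive (sym (+-identityʳ base₀))) z≥)
                ; done = λ () ; paid = z≤n })
      where
      E F : ℕ → Env
      E y = env (just (baseAt y , 9)) (just (y , 4))
              nothing nothing nothing nothing nothing nothing nothing nothing nothing nothing
      F y = env (just (baseAt y , 9)) (just (y , 4))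
              nothing nothing nothing nothing (just (bit (y <ᵇ gg) , 0)) nothing nothing nothing nothing nothing
      body : EB ≤ B ^ 5 → nn ≤ B ^ 4 → stride ≤ B ^ 4 → gg ≤ B ^ 4 →
        ∀ y n μ → y < gg → Rounds y n μ →
        wp (mainBody p) (λ n′ e μ′ → e ⊒ E (suc y) × Rounds (suc y) (n + (3 + n′)) μ′) (F y) μ
      body EB≤ nn≤ st≤ gg≤ y n μ y< rd =
        wp-⨾ (wp-straight pick {Q = λ m e μ′ → m ≡ 6 × e ≡ env (just (bs , 9)) (just (y , 4)) nothing nothing
             (just (EA + i * sd , 7)) (just (EB + j * sd , 7))
             (just (bit (y <ᵇ gg) , 0)) nothing nothing nothing nothing nothing × μ′ ≡ μ}
          (refl , refl , refl))
        λ { _ _ _ (refl , refl , refl) →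
        wp-⨾ (wp-copy {f = current rd} {h} (storedA (arrays rd)) (storedB (arrays rd)) refl refl
                (group≤ i<) (group≤ j<) (m≤m+n base₀ _))
        λ { n₁ _ μ₁ (refl , n₁≤ , cp) →
        wp-⊒ (⊒-++ params (same (same (same (same (same (same (drop ⊒-refl)))))))) $
        wp-⨾ (wp-simulated W B 2^W≡B^D 2≤B {A = matrix fᵢ} {matrix hⱼ}
               w≤W 2^w≤B fits (≤ᵇ⇒≤ 28 K tt) refl refl refl refl refl
               (λ {a} _ → instance≡ cp a) (run gr))
        λ { n₂ _ μ₂ (n₂≤ , refl , same₂) →
        wp-⨾ (wp-straight (arith add rBase rBase rStride ∷ []) {Q = λ m e μ′ → m ≡ 1 ×
              e ≡ env (just (bs + stride , 10)) (just (y , 4)) (just (sd , 2)) nothing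
               (just (EA + i * sd , 7)) (just (EB + j * sd , 7)) nothing (just (regs (final gr) 0 , 1)) nothing nothing nothing nothing × μ′ ≡ μ₂}
          (refl , refl , refl))
        λ { _ _ _ (refl , refl , refl) →
        wp-⊒ (⊒-++ params (bump (baseAt-suc y) (baseAt-≤ y< EB≤ nn≤ st≤ gg≤) ⊒-refl)) $
        wp-⨾ (Round.wp-respond y< (arrays₂ {μ₁} {μ₂} cp same₂) (fresh₂ {μ₁} {μ₂} cp same₂))
        λ { m e μ₃ (e⊒ , af) → let f′ = Round.After.current af in
        wp-⊒ e⊒ $ wp-straight (arith add rQ rQ rOne ∷ [])
          ( ⊒-++ params (same (bump (+-comm y 1) (≤-trans y< gg≤) ⊒-refl))
          , record
            { current = f′
            ; arrays = Round.After.arrays af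
            ; fresh = Round.After.fresh af
            ; done = <-suc-cases
                (λ q′ → ∀ {u v} → u < s → v < s → separated f′ (quotient q′ g) (remainder q′ g) u v)
                (λ {q′} q′< {u} {v} u< v< →
                  disjoint-mono {current rd} {f′} {h} {(quotient q′ g * s + u) * dd} dd
                    (Round.After.grows af) (done rd q′< u< v<))
                (Round.After.done af)
            ; paid = pay (paid rd) n₁≤
                (≤-trans n₂≤ (+-monoʳ-≤ (regBound p) (+-monoʳ-≤ 2 (+-monoˡ-≤ 1 (*-monoˡ-≤ 2 (steps≤ gr))))))
                (Round.After.paid af)
            }) } } } } }
        where
        i = quotient y g
        j = remainder y g
        bs = baseAt y
        fᵢ hⱼ : ℕ → Bool
        fᵢ x = current rd (i * sd + x)
        hⱼ x = h (j * sd + x)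
        i< : i < g
        i< = quotient-< y<
        j< : j < g
        j< = remainder-< y g>0
        gr : Decides p w s dd T fᵢ hⱼ
        gr = oracle fᵢ hⱼ
        group≤ : ∀ {i} → i < g → i * sd + sd ≤ nn
        group≤ {i} i< = ≤-trans (≤-reflexive (+-comm (i * sd) sd)) (*-monoˡ-≤ sd i<)
        fits : bs + 2 ^ w ≤ 2 ^ W
        fits = <⇒≤ (degree-fits (<ᵇ⇒< 10 D tt) (degree-sound add {9} {1} {a = bs} {2 ^ w} refl
          (baseAt-≤ (<⇒≤ y<) EB≤ nn≤ st≤ gg≤) (≤-trans 2^w≤B (≤-reflexive (sym (*-identityʳ B))))))
        instance≡ : ∀ {μ₁} → Copied μ (current rd) h (i * sd) (j * sd) bs sd μ₁ → ∀ a →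
          μ₁ (bs + a) ≡ mem (input w (matrix {s} {dd} fᵢ) (matrix hⱼ)) a
        instance≡ {μ₁} cp a with a <? sd | a <? sd + sd
        ... | yes a< | _ = trans (left cp a<) (sym (input-left {s} w fᵢ hⱼ a<))
        ... | no a≮ | yes a< = trans (cong μ₁ target≡) (trans (right cp y′<)
            (sym (trans (cong (mem (input w (matrix {s} {dd} fᵢ) (matrix hⱼ))) (sym split)) (input-right {s} w fᵢ hⱼ y′<))))
          where
          split : sd + (a ∸ sd) ≡ a
          split = m+[n∸m]≡n (≮⇒≥ a≮)
          target≡ : bs + a ≡ bs + (a ∸ sd) + sd
          target≡ = trans (cong (bs +_) (trans (sym split) (+-comm sd (a ∸ sd)))) (sym (+-assoc bs (a ∸ sd) sd))
          y′< : a ∸ sd < sd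
          y′< = +-cancelˡ-< sd _ _ (subst (_< sd + sd) (sym split) a<)
        -- Beyond the two copied groups the simulated machine expects zeros; here it matters that
        -- the region has never been written to.
        ... | no _ | no a≮ = trans (frame cp _ (inj₂ (+-monoʳ-≤ bs (≮⇒≥ a≮))))
            (trans (fresh rd (m≤m+n bs a)) (sym (input-beyond {s} w fᵢ hⱼ (≮⇒≥ a≮))))
        arrays₂ : ∀ {μ₁ μ₂} → Copied μ (current rd) h (i * sd) (j * sd) bs sd μ₁ →
          (∀ a → a < bs ⊎ bs + 2 ^ w ≤ a → μ₂ a ≡ μ₁ a) → Arrays (current rd) μ₂
        arrays₂ {μ₁} {μ₂} cp same₂ = arrays-frame {μ = μ} {μ₂} (λ z< → let z<bs = ≤-trans z< (m≤m+n base₀ _) in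
          trans (same₂ _ (inj₁ z<bs)) (frame cp _ (inj₁ z<bs))) (arrays rd)
        fresh₂ : ∀ {μ₁ μ₂} → Copied μ (current rd) h (i * sd) (j * sd) bs sd μ₁ →
          (∀ a → a < bs ⊎ bs + 2 ^ w ≤ a → μ₂ a ≡ μ₁ a) → ∀ {z} → baseAt (suc y) ≤ z → μ₂ z ≡ 0
        fresh₂ cp same₂ {z} z≥ = trans
          (same₂ z (inj₂ (≤-trans (+-monoʳ-≤ bs (≤-trans (m≤m+n (2 ^ w) sd) (m≤m+n (2 ^ w + sd) sd))) z≥′)))
          (trans (frame cp z (inj₂ (≤-trans (+-monoʳ-≤ bs (+-monoˡ-≤ sd (m≤n+m sd (2 ^ w)))) z≥′)))
            (fresh rd (≤-trans (m≤m+n bs stride) z≥′)))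
          where z≥′ = ≤-trans (≤-reflexive (baseAt-suc y)) z≥
        pay : ∀ {c c′ n₁ n₂ m} → n ≤ y * roundTime + c → n₁ ≤ sd * 14 + 3 → n₂ ≤ regBound p + (2 + (T * 2 + 1)) →
          m + c ≤ 1 + c′ → n + (3 + (6 + (n₁ + (n₂ + (1 + (m + 1)))))) ≤ suc y * roundTime + c′
        pay {c} {c′} {n₁} {n₂} {m} n≤ n₁≤ n₂≤ m≤ = begin
          n + (3 + (6 + (n₁ + (n₂ + (1 + (m + 1))))))
            ≤⟨ +-mono-≤ n≤ (+-monoʳ-≤ 9 (+-mono-≤ n₁≤ (+-monoˡ-≤ (1 + (m + 1)) n₂≤))) ⟩
          (y * roundTime + c) + (9 + ((sd * 14 + 3) + ((regBound p + (2 + (T * 2 + 1))) + (1 + (m + 1)))))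
            ≡⟨ lhs (y * roundTime) c (sd * 14) (regBound p) (T * 2) m ⟩
          (m + c) + (17 + (sd * 14 + (regBound p + T * 2)) + y * roundTime)
            ≤⟨ +-monoˡ-≤ _ m≤ ⟩
          (1 + c′) + (17 + (sd * 14 + (regBound p + T * 2)) + y * roundTime)
            ≡⟨ rhs c′ (sd * 14 + (regBound p + T * 2)) (y * roundTime) ⟩
          suc y * roundTime + c′ ∎
          where
          open ≤-Reasoning
          lhs : ∀ a c b r t m → (a + c) + (9 + ((b + 3) + ((r + (2 + (t + 1))) + (1 + (m + 1)))))
            ≡ (m + c) + (17 + (b + (r + t)) + a)
          lhs = solve-∀
          rhs : ∀ c k a → (1 + c) + (17 + k + a) ≡ (k + 18 + a) + c
          rhs = solve-∀

-- Correctness of the whole program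

nothing-! : ∀ m r {z : ℕ × ℕ} → replicate m nothing ! r ≢ just z
nothing-! zero    r       ()
nothing-! (suc m) zero    ()
nothing-! (suc m) (suc r) h = nothing-! m r h

run-block : ∀ {w b ρ μ t ρ′ μ′} → Runs w b (ρ , μ) t (ρ′ , μ′) →
  w , code b 0 ⊢ ⟨ 0 , ρ , μ ⟩ ⇓[ t ] ⟨ size b , ρ′ , μ′ ⟩
run-block {b = b} {t = t} r = ⇓-time (+-identityʳ t)
  (resume r (placed λ _ e → e) (halt (‼-beyond (code b 0) (≤-reflexive (code-size b 0)))))

module Algorithm (W B : ℕ) (2^W≡B^D : 2 ^ W ≡ B ^ D) (2≤B : 2 ≤ B) (n d M k C : ℕ) where

  s w dd : ℕ
  s  = 2 ^ suc M
  w  = k * (2 + M)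
  dd = C * suc M

  open Logic W B 2^W≡B^D 2≤B
  open Loops W B 2^W≡B^D 2≤B n d s w dd

  fourth : ℕ → ℕ
  fourth m = 2 ^ suc m * 2 ^ suc m * (2 ^ suc m * 2 ^ suc m)

  fourth-mono : ∀ {m m′} → m ≤ m′ → fourth m ≤ fourth m′
  fourth-mono h = *-mono-≤ (*-mono-≤ h′ h′) (*-mono-≤ h′ h′)
    where h′ = ^-monoʳ-≤ 2 (s≤s h)

  growing : ℕ → (t : Entry) → Env
  growing m t =
    just (n , 1) ∷ just (d , 1) ∷ just (1 , 1) ∷ just (2 ^ suc m , 1) ∷ just (2 ^ (k * (2 + m)) , 1) ∷
    just (C * suc m , 1) ∷ nothing ∷ nothing ∷ nothing ∷ nothing ∷ nothing ∷ nothing ∷ nothing ∷ nothing ∷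
    nothing ∷ nothing ∷ nothing ∷ nothing ∷ nothing ∷ nothing ∷ nothing ∷ nothing ∷ t ∷ nothing ∷ nothing ∷
    nothing ∷ just (C , 1) ∷ just (2 ^ k , 1) ∷ []

  start-env : Env
  start-env = just (n , 1) ∷ just (d , 1) ∷ replicate 26 nothing

  module Correct (n>0 : 0 < n) (d<dd : d < dd) (w≤W : w ≤ W) (s≤B : s ≤ B) (2^w≤B : 2 ^ w ≤ B) (dd≤B : dd ≤ B)
                 (below : ∀ {m} → m < M → fourth m ≤ n) (above : n < fourth M)
                 (p : Program) (T : ℕ) (oracle : ∀ F G → Decides p w s dd T F G)
                 (fA fB : ℕ → Bool) where

    f₀ h : ℕ → Bool
    f₀ = extendA fA
    h  = extendB fB

    h-top : ∀ r → h (r * dd + d) ≡ true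
    h-top r rewrite remainder-digits r d<dd | <ᵇ-false (≤-refl {d}) = refl

    open Flags dd d rows d<dd f₀ h h-top
    open Flagged d<dd f₀ h h-top

    s>0 : 0 < s
    s>0 = m^n>0 2 (suc M)

    open Decided d<dd f₀ h h-top s>0 w≤W 2^w≤B p T oracle

    unflagged : ∀ r → flag f₀ r ≡ false
    unflagged r rewrite remainder-digits r d<dd | <ᵇ-false (≤-refl {d}) = refl

    none-flagged : ∀ r → count f₀ r ≡ 0
    none-flagged zero    = refl
    none-flagged (suc r) rewrite unflagged r = none-flagged r

    valid₀ : Valid f₀
    valid₀ = record { alive = λ _ _ _ → refl ; dead = λ r _ q → contradiction (trans (sym (unflagged r)) q) λ () }

    -- `below` and `above` determine M as the number of doublings. By monotonicity of `fourth`, the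
    -- test on the fourth power of the group size is then a test of a counter against M, the form
    -- that the loop rule requires.
    test : ∀ m → bit (bit (n <ᵇ fourth m) <ᵇ 1) ≡ bit (m <ᵇ M)
    test m with m <? M
    ... | yes m<M = trans (cong (λ b → bit (bit b <ᵇ 1)) (<ᵇ-false (below m<M))) (cong bit (sym (<ᵇ-true m<M)))
    ... | no  m≮M = trans (cong (λ b → bit (bit b <ᵇ 1)) (<ᵇ-true (≤-trans above (fourth-mono (≮⇒≥ m≮M)))))
                          (cong bit (sym (<ᵇ-false (≮⇒≥ m≮M))))

    B≤B¹ : ∀ {x} → x ≤ B → x ≤ B ^ 1
    B≤B¹ h = ≤-trans h (≤-reflexive (sym (*-identityʳ B)))

    wp-grow : ∀ {μ} → wp (while (straight tooSmall) rT (straight double))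
      (λ t e μ′ → e ≡ growing M (just (bit (M <ᵇ M) , 0)) × t ≤ M * 9 + 5 × μ′ ≡ μ) (growing 0 nothing) μ
    wp-grow {μ} = wp-while-const {tooSmall} {M = M}
      (λ m → growing m nothing) (λ m → growing m (just (bit (m <ᵇ M) , 0))) 9
      (λ _ μ′ → μ′ ≡ μ) (λ m _ → cong (λ v → growing m (just (v , 0))) (test m) , refl) (λ _ → refl)
      (λ { m _ m<M refl → wp-straight double
        ( same (same (same (bump (cong (2 ^ suc m +_) (sym (+-identityʳ _))) (B≤B¹ (≤-trans (^-monoʳ-≤ 2 (s≤s m<M)) s≤B))
           (bump (P≡ m) (B≤B¹ (≤-trans (^-monoʳ-≤ 2 (*-monoʳ-≤ k (s≤s (s≤s m<M)))) 2^w≤B))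
           (bump (trans (+-comm (C * suc m) C) (sym (*-suc C (suc m)))) (B≤B¹ (≤-trans (*-monoʳ-≤ C (s≤s m<M)) dd≤B))
           (⊒-++ untouched (drop ⊒-refl)))))))
        , ≤-refl , refl) }) refl
      where
      untouched : Env
      untouched = replicate 16 nothing
      P≡ : ∀ m → 2 ^ (k * (2 + m)) * 2 ^ k ≡ 2 ^ (k * (3 + m))
      P≡ m = trans (sym (^-distribˡ-+-* 2 (k * (2 + m)) k)) (cong (2 ^_) (trans (+-comm _ k) (sym (*-suc k (2 + m)))))

    totalTime : ℕ
    totalTime = 6 + (M * 9 + 5 + (13 + (nn * 20 + 3 +
      (gg * roundTime + rows * bruteTime + 3 + (1 + (rows * 10 + 3 + 1))))))

    record Outcome (e : Env) : Set where
      field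
        marks  : ℕ → Bool
        valid′ : Valid marks
        all    : ∀ {r v} → r < rows → v < rows → disjoint marks h (r * dd) (v * dd) dd ≡ false
        answer : e ! 0 ≡ just (bit (bit (allFlagged marks rows) <ᵇ 1) , 0)

    -- The pair of rows r and v is treated in round `quotient r s * g + quotient v s`, at the
    -- positions `remainder r s` and `remainder v s` within the two groups.
    all-pairs : ∀ {u μ} (rd : Rounds gg u μ) → ∀ {r v} → r < rows → v < rows →
      disjoint (Rounds.current rd) h (r * dd) (v * dd) dd ≡ false
    all-pairs rd {r} {v} r< v< = subst₂ (λ x y → disjoint (Rounds.current rd) h (x * dd) (y * dd) dd ≡ false)
      (sym (digits r s>0)) (sym (digits v s>0))
      (subst₂ (λ i j → separated (Rounds.current rd) i j (remainder r s) (remainder v s))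
        (quotient-digits (quotient r s) j<) (remainder-digits (quotient r s) j<)
        (Rounds.done rd (digits-< {quotient r s} {g} {quotient v s} {g} (quotient-< r<) j<)
          (remainder-< r s>0) (remainder-< v s>0)))
      where
      j< : quotient v s < g
      j< = quotient-< v<

    wp-hittingSet : ∀ {μ} → 2 ^ (k * 2) ≤ B → C ≤ B → 2 ^ k ≤ B →
      Stored μ 0 fA nd → Stored μ nd fB nd → (∀ {z} → EA ≤ z → μ z ≡ 0) →
      wp (hittingSetBlock p k C) (λ t e _ → t ≤ totalTime × Outcome e) start-env μ
    wp-hittingSet {μ} P≤ C≤ pk≤ inA inB zero≥ =
      wp-⨾ (wp-straight (setup k C) {Q = λ t e μ′ → t ≡ 6 × e ⊒ growing 0 nothing × μ′ ≡ μ}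
        (1≤B , 2≤B , P≤ , C≤ , pk≤ , C≤ , refl ,
          same (same (same (same (same
            (bump (sym (*-identityʳ C)) (B≤B¹ (≤-trans (≤-reflexive (*-identityʳ C)) C≤)) ⊒-refl))))) , refl))
      λ { _ _ _ (refl , e⊒ , refl) → wp-⊒ e⊒ $
      wp-⨾ wp-grow
      λ { t₁ _ _ (refl , t₁≤ , refl) →
      wp-⨾ (wp-straight layout {Q = λ t e μ′ → t ≡ 13 × e ≡ env (just (base₀ , 6)) nothing nothing nothing nothing nothing
          (just (quotient n s , 1)) nothing nothing nothing (just (C , 1)) (just (2 ^ k , 1)) × μ′ ≡ μ}
        (refl , refl , refl))
      λ { _ _ _ (refl , refl , refl) →
      wp-⨾ (wp-extend n>0 inA inB zero≥)
      λ { t₂ _ _ (refl , t₂≤ , ex) →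
      wp-⨾ (wp-main {f = f₀} (record { storedA = storedA ex ; storedB = storedB ex ; valid = valid₀ })
              (fresh ex) (none-flagged rows))
      λ { t₃ _ _ (refl , u , rd , t₃≤) →
      wp-⨾ (wp-straight (arith eq rAcc rOne rOne ∷ []) {Q = λ t e μ′ → t ≡ 1 × e ≡
          env (just (baseAt gg , 9)) (just (gg , 4)) nothing nothing nothing nothing (just (bit (gg <ᵇ gg) , 0)) nothing nothing (just (1 , 0)) nothing nothing
            × Rounds gg u μ′}
        (refl , refl , rd))
      λ { _ _ _ (refl , refl , rd) →
      wp-⨾ (wp-scan {f = Rounds.current rd} (storedA (Rounds.arrays rd)))
      λ { t₄ _ _ (refl , t₄≤ , refl) →
      wp-straight (arith lt rN rAcc rOne ∷ [])
        ( +-monoʳ-≤ 6 (+-mono-≤ t₁≤ (+-monoʳ-≤ 13 (+-mono-≤ t₂≤ (+-mono-≤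
            (≤-trans t₃≤ (+-monoˡ-≤ 3 (≤-trans (Rounds.paid rd)
              (+-monoʳ-≤ (gg * roundTime) (*-monoˡ-≤ bruteTime (count≤ (Rounds.current rd) rows))))))
            (+-monoʳ-≤ 1 (+-monoˡ-≤ 1 t₄≤))))))
        , record { marks = Rounds.current rd ; valid′ = valid (Rounds.arrays rd) ; all = all-pairs rd
                 ; answer = refl }) } } } } } } }
      where
      1≤B : 1 ≤ B
      1≤B = ≤-trans (s≤s z≤n) 2≤B

    f₀-cell : ∀ r {y} → y < dd → f₀ (r * dd + y) ≡ (y <ᵇ d) ∧ fA (remainder r n * d + y)
    f₀-cell r {y} y< rewrite remainder-digits r y< | quotient-digits r y< = refl

    h-cell : ∀ r {y} → y < dd → h (r * dd + y) ≡ (if y <ᵇ d then fB (remainder r n * d + y) else true)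
    h-cell r {y} y< rewrite remainder-digits r y< | quotient-digits r y< = refl

    inner : ∀ {y x} → (y <ᵇ d) ∧ x ≡ true → y < d × x ≡ true
    inner {y} q with y <ᵇ d in r
    ... | true = <ᵇ-true⁻¹ y d r , q

    -- The columns from `d` on are 0 throughout `f₀`, so a common column of the padded rows is a
    -- column of the input.
    extended⇒ : ∀ {r v} → disjoint f₀ h (r * dd) (v * dd) dd ≡ false →
      disjoint fA fB (remainder r n * d) (remainder v n * d) d ≡ false
    extended⇒ {r} {v} q with y , y< , fy , hy ← disjoint-false {f₀} {h} {r * dd} {v * dd} dd q
      with y<d , fA≡ ← inner (trans (sym (f₀-cell r y<)) fy) =
      disjoint-hit {fA} {fB} {remainder r n * d} {remainder v n * d} d y<d fA≡
        (trans (sym (trans (h-cell v y<) (cong (λ b → if b then fB (remainder v n * d + y) else true) (<ᵇ-true y<d)))) hy)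

    extended⇐ : ∀ {r v} → disjoint fA fB (remainder r n * d) (remainder v n * d) d ≡ false →
      disjoint f₀ h (r * dd) (v * dd) dd ≡ false
    extended⇐ {r} {v} q with y , y<d , fy , gy ← disjoint-false {fA} {fB} {remainder r n * d} {remainder v n * d} d q =
      disjoint-hit {f₀} {h} {r * dd} {v * dd} dd y<
        (trans (f₀-cell r y<) (cong₂ _∧_ (<ᵇ-true y<d) fy))
        (trans (h-cell v y<) (trans (cong (λ b → if b then fB (remainder v n * d + y) else true) (<ᵇ-true y<d)) gy))
      where y< = <-trans y<d d<dd

    remainder-small : ∀ {u} → u < n → remainder u n ≡ u
    remainder-small {u} u< = remainder-digits {n} 0 u<

    n≤rows : n ≤ rows
    n≤rows = begin
      n                                        ≡⟨ digits n s>0 ⟩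
      quotient n s * s + remainder n s         ≤⟨ +-monoʳ-≤ (quotient n s * s) (<⇒≤ (remainder-< n s>0)) ⟩
      quotient n s * s + s                     ≡⟨ +-comm (quotient n s * s) s ⟩
      suc (quotient n s) * s                   ≡⟨ cong (_* s) (+-comm 1 (quotient n s)) ⟩
      rows                                     ∎
      where open ≤-Reasoning

    all-flagged : ∀ f r → allFlagged f r ≡ true → ∀ {u} → u < r → flag f u ≡ true
    all-flagged f (suc r) q {u} u< with allFlagged f r in a | u ≟ r
    ... | true | yes refl = q
    ... | true | no  u≢r  = all-flagged f r a (≤∧≢⇒< (s≤s⁻¹ u<) u≢r)

    some-unflagged : ∀ f r → allFlagged f r ≡ false → ∃[ u ] u < r × flag f u ≡ false
    some-unflagged f (suc r) q with allFlagged f r in a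
    ... | true  = r , ≤-refl , q
    ... | false = let u , u< , e = some-unflagged f r a in u , m≤n⇒m≤1+n u< , e

    HS : Set
    HS = HittingSet (matrix {n} {d} fA) (matrix fB)

    -- An unflagged row, and likewise the row missed by a flagged one, may lie in the padding. Its
    -- remainder modulo n names the input row that it repeats, so it stands for an actual set in
    -- either case.
    decode : ∀ {f} → Valid f → (∀ {r v} → r < rows → v < rows → disjoint f h (r * dd) (v * dd) dd ≡ false) →
      ∀ b → allFlagged f rows ≡ b → (bit (bit b <ᵇ 1) ≡ 1 × HS) ⊎ (bit (bit b <ᵇ 1) ≡ 0 × ¬ HS)
    decode {f} val all true q = inj₂ (refl , missed)
      where
      missed : ¬ HS
      missed (a , a∈ , hits) with u , u< , refl ← ∈-matrix⁻ fA a∈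
        with v , v< , dis ← dead val u (<-≤-trans u< n≤rows) (all-flagged f rows q (<-≤-trans u< n≤rows)) =
        disjoint⇒¬intersects {fA} {fB} {u * d} {remainder v n * d} {d}
          (subst (λ x → disjoint fA fB (x * d) (remainder v n * d) d ≡ true) (remainder-small u<)
            (¬-not λ z → case trans (sym (extended⇐ {u} {v} z)) dis of λ ()))
          (hits _ (∈-matrix⁺ fB (remainder-< v n>0)))
    decode {f} val all false q with r , r< , un ← some-unflagged f rows q =
      inj₁ (refl , row fA (remainder r n * d) , ∈-matrix⁺ fA (remainder-< r n>0) , hits)
      where
      hits : ∀ b → b ∈ matrix fB → Intersects (row fA (remainder r n * d)) b
      hits b b∈ with v , v< , refl ← ∈-matrix⁻ fB b∈ =
        ¬disjoint⇒intersects {fA} {fB} {remainder r n * d} {v * d} {d}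
          (subst (λ x → disjoint fA fB (remainder r n * d) (x * d) d ≡ false) (remainder-small v<)
            (extended⇒ {r} {v} (trans (sym (disjoint-alive r v val un)) (all r< (<-≤-trans v< n≤rows)))))

    d≤B : d ≤ B
    d≤B = ≤-trans (<⇒≤ d<dd) dd≤B

    fits : ∀ {x} → x ≤ B → x < 2 ^ W
    fits h = degree-fits (<ᵇ⇒< 1 D tt) (B≤B¹ h)

    conclude : ∀ {b N ρ μ} → Ends b (λ t e _ → t ≤ N × Outcome e) ρ μ →
      ∃[ t ] ∃[ s′ ] t ≤ N × W , code b 0 ⊢ ⟨ 0 , ρ , μ ⟩ ⇓[ t ] s′ × Answers s′ HS
    conclude {b} r = time r , ⟨ size b , regs′ r , mem′ r ⟩ , proj₁ (satisfies r) , run-block (runs r) , answers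
      where
      open Outcome (proj₂ (satisfies r))
      answers : Answers ⟨ size b , regs′ r , mem′ r ⟩ HS
      answers with decode valid′ all (allFlagged marks rows) refl | proj₁ (models r 0 answer)
      ... | inj₁ (e , y) | e′ = inj₁ (trans e′ e , y)
      ... | inj₂ (e , y) | e′ = inj₂ (trans e′ e , y)

    solves : n ≤ B → 2 ^ (k * 2) ≤ B → C ≤ B → 2 ^ k ≤ B →
      ∃[ t ] ∃[ s′ ] t ≤ totalTime ×
        W , code (hittingSetBlock p k C) 0 ⊢ input W (matrix {n} {d} fA) (matrix fB) ⇓[ t ] s′ × Answers s′ HS
    solves n≤B P≤ C≤ pk≤ = conclude (start (wp-hittingSet P≤ C≤ pk≤
        (λ {x} x< → trans (input-left {n} {d} W fA fB x<) (bit-fits (fA x)))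
        (λ {x} x< → trans (input-right {n} {d} W fA fB x<) (bit-fits (fB x)))
        (λ {z} z≥ → input-beyond {n} {d} W fA fB z≥)) models₀ bounded₀)
      where
      A₀ = matrix {n} {d} fA
      B₀ = matrix {n} {d} fB
      bit-fits : ∀ b → truncate W (bit b) ≡ bit b
      bit-fits b = truncate-< W (fits (≤-trans (bit≤1 b) (≤-trans (s≤s z≤n) 2≤B)))
      models₀ : inputRegs W A₀ B₀ ⊨ start-env
      models₀ zero          refl = truncate-< W (fits n≤B) , B≤B¹ n≤B
      models₀ (suc zero)    refl = truncate-< W (fits d≤B) , B≤B¹ d≤B
      models₀ (suc (suc r)) q    = contradiction q (nothing-! 26 r)
      bounded₀ : Bounded (mem (input W A₀ B₀))
      bounded₀ a = ≤-trans (s≤s⁻¹ (map-‼-< (λ b → truncate W (bit b))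
        (λ b → s≤s (≤-trans (≤-reflexive (bit-fits b)) (bit≤1 b))) (s≤s z≤n) (toList (concat A₀) ++ toList (concat B₀)) a))
        (≤-trans (s≤s z≤n) 2≤B)

-- Logarithms and running time

n<2^n : ∀ n → n < 2 ^ n
n<2^n zero    = s≤s z≤n
n<2^n (suc n) = ≤-trans (+-mono-≤ (m^n>0 2 n) (n<2^n n)) (≤-reflexive (cong (2 ^ n +_) (sym (+-identityʳ _))))

n<2^[1+log] : ∀ n → n < 2 ^ suc ⌊log₂ n ⌋
n<2^[1+log] n = ≰⇒> λ h → <⇒≱ (n<1+n ⌊log₂ n ⌋)
  (≤-trans (≤-reflexive (sym (⌊log₂[2^n]⌋≡n (suc ⌊log₂ n ⌋)))) (⌊log₂⌋-mono-≤ h))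

2^log≤n : ∀ n → 0 < n → 2 ^ ⌊log₂ n ⌋ ≤ n
2^log≤n = <-rec _ go
  where
  go : ∀ n → (∀ {m} → m < n → 0 < m → 2 ^ ⌊log₂ m ⌋ ≤ m) → 0 < n → 2 ^ ⌊log₂ n ⌋ ≤ n
  go 1                 rec _ = ≤-refl
  go n@(suc (suc n-2)) rec _ = begin
    2 ^ ⌊log₂ n ⌋                     ≡⟨ cong (2 ^_) (m+[n∸m]≡n {1} (⌊log₂⌋-mono-≤ {2} {n} (s≤s (s≤s z≤n)))) ⟨
    2 * 2 ^ (⌊log₂ n ⌋ ∸ 1)           ≡⟨ cong (λ x → 2 * 2 ^ x) (⌊log₂⌊n/2⌋⌋≡⌊log₂n⌋∸1 n) ⟨
    2 * 2 ^ ⌊log₂ ⌊ n /2⌋ ⌋           ≤⟨ *-monoʳ-≤ 2 (rec (⌊n/2⌋<n (suc n-2)) (s≤s z≤n)) ⟩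
    2 * ⌊ n /2⌋                       ≡⟨ cong (⌊ n /2⌋ +_) (+-identityʳ ⌊ n /2⌋) ⟩
    ⌊ n /2⌋ + ⌊ n /2⌋                 ≤⟨ +-monoʳ-≤ ⌊ n /2⌋ (⌊n/2⌋≤⌈n/2⌉ n) ⟩
    ⌊ n /2⌋ + ⌈ n /2⌉                 ≡⟨ ⌊n/2⌋+⌈n/2⌉≡n n ⟩
    n                                 ∎
    where open ≤-Reasoning

-- The offset 3 makes the induction step work for every m: 2 x² ≥ (x + 1)² holds from x = 3 on and
-- fails at x = 2.
square≤exp : ∀ m → (3 + m) * (3 + m) ≤ 16 * 2 ^ m
square≤exp zero    = m≤m+n 9 7
square≤exp (suc m) = begin
  (4 + m) * (4 + m)                   ≤⟨ m≤m+n _ (2 + m * 4 + m * m) ⟩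
  (4 + m) * (4 + m) + (2 + m * 4 + m * m) ≡⟨ expand m ⟩
  2 * ((3 + m) * (3 + m))             ≤⟨ *-monoʳ-≤ 2 (square≤exp m) ⟩
  2 * (16 * 2 ^ m)                    ≡⟨ swap (2 ^ m) ⟩
  16 * (2 * 2 ^ m)                    ∎
  where
  open ≤-Reasoning
  expand : ∀ m → (4 + m) * (4 + m) + (2 + m * 4 + m * m) ≡ 2 * ((3 + m) * (3 + m))
  expand = solve-∀
  swap : ∀ x → 2 * (16 * x) ≡ 16 * (2 * x)
  swap = solve-∀

-- X ≤ K n^(2-1/Q), raised to the power Q and multiplied by n.
record Saves (Q n K X : ℕ) : Set where
  constructor saved
  field bound : X ^ Q * n ≤ (K * (n * n)) ^ Q

open Saves public

saves-mono : ∀ {Q n K X Y} → X ≤ Y → Saves Q n K Y → Saves Q n K X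
saves-mono {Q} {n} h s = saved (≤-trans (*-monoˡ-≤ n (^-monoˡ-≤ Q h)) (bound s))

^-distribʳ-* : ∀ Q a b → (a * b) ^ Q ≡ a ^ Q * b ^ Q
^-distribʳ-* zero    a b = refl
^-distribʳ-* (suc Q) a b = trans (cong (a * b *_) (^-distribʳ-* Q a b)) (interchange a b (a ^ Q) (b ^ Q))
  where
  interchange : ∀ a b x y → a * b * (x * y) ≡ a * x * (b * y)
  interchange = solve-∀

saves-* : ∀ {Q n K X} c → Saves Q n K X → Saves Q n (c * K) (c * X)
saves-* {Q} {n} {K} {X} c s = saved (begin
  (c * X) ^ Q * n                ≡⟨ cong (_* n) (^-distribʳ-* Q c X) ⟩
  c ^ Q * X ^ Q * n              ≡⟨ *-assoc (c ^ Q) (X ^ Q) n ⟩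
  c ^ Q * (X ^ Q * n)            ≤⟨ *-monoʳ-≤ (c ^ Q) (bound s) ⟩
  c ^ Q * (K * (n * n)) ^ Q      ≡⟨ ^-distribʳ-* Q c (K * (n * n)) ⟨
  (c * (K * (n * n))) ^ Q        ≡⟨ cong (_^ Q) (*-assoc c K (n * n)) ⟨
  (c * K * (n * n)) ^ Q          ∎)
  where open ≤-Reasoning

saves-K : ∀ {Q n K K′ X} → K ≤ K′ → Saves Q n K X → Saves Q n K′ X
saves-K {Q} {n} h s = saved (≤-trans (bound s) (^-monoˡ-≤ Q (*-monoˡ-≤ (n * n) h)))

saves-⊔ : ∀ {Q n K X Y} → Saves Q n K X → Saves Q n K Y → Saves Q n K (X ⊔ Y)
saves-⊔ {Q} {n} {K} {X} {Y} s s′ with ⊔-sel X Y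
... | inj₁ e = subst (Saves Q n K) (sym e) s
... | inj₂ e = subst (Saves Q n K) (sym e) s′

-- Passing through the maximum, X + Y ≤ 2 (X ⊔ Y), avoids expanding the power of a sum. The
-- constants need not be sharp.
saves-+ : ∀ {Q n K K′ X Y} → Saves Q n K X → Saves Q n K′ Y → Saves Q n (2 * (K + K′)) (X + Y)
saves-+ {Q} {n} {K} {K′} {X} {Y} s s′ = saves-mono double≥
  (saves-* 2 (saves-⊔ (saves-K (m≤m+n K K′) s) (saves-K (m≤n+m K′ K) s′)))
  where
  double≥ : X + Y ≤ 2 * (X ⊔ Y)
  double≥ = ≤-trans (+-mono-≤ (m≤m⊔n X Y) (m≤n⊔m X Y)) (≤-reflexive (cong (X ⊔ Y +_) (sym (+-identityʳ _))))

-- The hypothesis says that X is at most K n² divided by the e-th root of y, and that root is at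
-- least n^(1/(e r)).
saves-raise : ∀ {e r n K X y} → X ^ e * y ≤ (K * (n * n)) ^ e → n ≤ y ^ r → Saves (e * r) n K X
saves-raise {e} {r} {n} {K} {X} {y} h n≤ = saved (begin
  X ^ (e * r) * n               ≤⟨ *-monoʳ-≤ (X ^ (e * r)) n≤ ⟩
  X ^ (e * r) * y ^ r           ≡⟨ cong (_* y ^ r) (^-*-assoc X e r) ⟨
  (X ^ e) ^ r * y ^ r           ≡⟨ ^-distribʳ-* r (X ^ e) y ⟨
  (X ^ e * y) ^ r               ≤⟨ ^-monoˡ-≤ r h ⟩
  ((K * (n * n)) ^ e) ^ r       ≡⟨ ^-*-assoc (K * (n * n)) e r ⟩
  (K * (n * n)) ^ (e * r)       ∎)
  where open ≤-Reasoning

-- M counts the iterations that determine s, and C m is the dimension of a group.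
runtime : (s g m M C R T : ℕ) → ℕ
runtime s g m M C R T = 6 + (M * 9 + 5 + (13 + (g * (s * (C * m)) * 20 + 3 +
  (g * g * (s * (C * m) * 14 + (R + T * 2) + 18) + g * s * (s * s * (C * m * 10 + 17) + 3) + 3 + (1 + (g * s * 10 + 3 + 1))))))

-- The sizes of the reduction: groups of size s ≈ n^(1/4), g groups, m ≈ log s.
module Sizes (n s g m : ℕ) (s>0 : 0 < s) (m>0 : 0 < m) (g>0 : 0 < g)
             (n≤s⁴ : n ≤ s * s * (s * s)) (s⁴≤ : s * s * (s * s) ≤ 16 * n)
             (gs≤ : g * s ≤ 3 * n) (m²≤ : m * m ≤ 16 * s) where

  private instance
    s≢0 : NonZero s
    s≢0 = >-nonZero s>0

  s^4 : s * s * (s * s) ≡ s ^ 4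
  s^4 = fourth s
    where
    fourth : ∀ s → s * s * (s * s) ≡ s * (s * (s * (s * 1)))
    fourth = solve-∀

  n≤s^ : ∀ r → n ≤ s ^ (4 * suc r)
  n≤s^ r = ≤-trans (≤-trans n≤s⁴ (≤-reflexive s^4)) (^-monoʳ-≤ s (m≤m*n 4 (suc r)))

  -- A saving of the square root of s, squared to stay in ℕ. As s ≥ n^(1/4), it is worth n^(1/8). It
  -- is weakened to n^(1/(8 (r + 1))) so that all three parts of the running time share one
  -- exponent.
  saves-square : ∀ {X K} r → X * X * s ≤ K * (n * n) * (K * (n * n)) → Saves (suc r * 8) n K X
  saves-square {X} {K} r h = subst (λ Q → Saves Q n K X) (exponent r)
    (saves-raise {2} {4 * suc r} {n} {K} {X} {s} (≤-trans (≤-reflexive (cong (λ x → X * x * s) (*-identityʳ X)))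
      (≤-trans h (≤-reflexive (cong (K * (n * n) *_) (sym (*-identityʳ _)))))) (n≤s^ r))
    where
    exponent : ∀ r → 2 * (4 * suc r) ≡ suc r * 8
    exponent = solve-∀

  -- The term is about n² m / s, and `m²≤` leaves a saving of the square root of s. The constant
  -- comes from 3⁴ · 16 = 36².
  group-pairs : ∀ r → Saves (suc r * 8) n 36 (g * g * (s * m))
  group-pairs r = saves-square {g * g * (s * m)} {36} r (*-cancelʳ-≤ _ _ s (begin
    g * g * (s * m) * (g * g * (s * m)) * s * s     ≡⟨ lhs g s m ⟩
    g * s * (g * s) * (g * s * (g * s)) * (m * m)   ≤⟨ *-mono-≤ (*-mono-≤ (*-mono-≤ gs≤ gs≤) (*-mono-≤ gs≤ gs≤)) m²≤ ⟩
    3 * n * (3 * n) * (3 * n * (3 * n)) * (16 * s)  ≡⟨ rhs n s ⟩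
    36 * (n * n) * (36 * (n * n)) * s               ∎))
    where
    open ≤-Reasoning
    lhs : ∀ g s m → g * g * (s * m) * (g * g * (s * m)) * s * s ≡ g * s * (g * s) * (g * s * (g * s)) * (m * m)
    lhs = solve-∀
    rhs : ∀ n s → 3 * n * (3 * n) * (3 * n * (3 * n)) * (16 * s) ≡ 36 * (n * n) * (36 * (n * n)) * s
    rhs = solve-∀

  -- The term is about n s² m, of order at most n^(13/8), so the estimates can be generous: 9 · 16 ·
  -- 16 = 2304 and 2304 · 16 = 192².
  brute-force : ∀ r → Saves (suc r * 8) n 192 (g * s * (s * s * m))
  brute-force r = saves-square {g * s * (s * s * m)} {192} r (begin
    g * s * (s * s * m) * (g * s * (s * s * m)) * s           ≡⟨ lhs g s m ⟩
    g * s * (g * s) * (m * m) * (s * s * (s * s)) * s         ≤⟨ *-monoˡ-≤ s (*-mono-≤ (*-mono-≤ (*-mono-≤ gs≤ gs≤) m²≤) s⁴≤) ⟩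
    3 * n * (3 * n) * (16 * s) * (16 * n) * s                 ≡⟨ mid n s ⟩
    2304 * (n * n * n) * (s * s)                              ≤⟨ *-monoʳ-≤ (2304 * (n * n * n)) s²≤ ⟩
    2304 * (n * n * n) * (16 * n)                             ≡⟨ rhs n ⟩
    192 * (n * n) * (192 * (n * n))                           ∎)
    where
    open ≤-Reasoning
    s²≤ : s * s ≤ 16 * n
    s²≤ = ≤-trans (m≤m*n (s * s) (s * s) ⦃ m*n≢0 s s ⦄) s⁴≤
    lhs : ∀ g s m → g * s * (s * s * m) * (g * s * (s * s * m)) * s ≡ g * s * (g * s) * (m * m) * (s * s * (s * s)) * s
    lhs = solve-∀
    mid : ∀ n s → 3 * n * (3 * n) * (16 * s) * (16 * n) * s ≡ 2304 * (n * n * n) * (s * s)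
    mid = solve-∀
    rhs : ∀ n → 2304 * (n * n * n) * (16 * n) ≡ 192 * (n * n) * (192 * (n * n))
    rhs = solve-∀

  -- The s² in the bound on T combines with g² to (g s)² ≤ 9 n². The numerator p is given away in
  -- `s ≤ s ^ p`, which is why the final exponent depends on the denominator alone.
  oracle-calls : ∀ {T K p} r → 0 < p → T ^ suc r * s ^ p ≤ K ^ suc r * s ^ (2 * suc r) →
    Saves (suc r * 8) n (K * 9) (g * g * T)
  oracle-calls {T} {K} {p} r p>0 h = saves-raise {suc r} {8} {n} {K * 9} {g * g * T} {s} (begin
    (g * g * T) ^ suc r * s
      ≤⟨ *-monoʳ-≤ ((g * g * T) ^ suc r) (≤-trans (≤-reflexive (sym (*-identityʳ s))) (^-monoʳ-≤ s p>0)) ⟩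
    (g * g * T) ^ suc r * s ^ p                      ≡⟨ cong (_* s ^ p) (^-distribʳ-* (suc r) (g * g) T) ⟩
    (g * g) ^ suc r * T ^ suc r * s ^ p              ≡⟨ *-assoc ((g * g) ^ suc r) _ _ ⟩
    (g * g) ^ suc r * (T ^ suc r * s ^ p)            ≤⟨ *-monoʳ-≤ ((g * g) ^ suc r) h ⟩
    (g * g) ^ suc r * (K ^ suc r * s ^ (2 * suc r))  ≡⟨ cong (λ x → (g * g) ^ suc r * (K ^ suc r * x)) (^-*-assoc s 2 (suc r)) ⟨
    (g * g) ^ suc r * (K ^ suc r * (s ^ 2) ^ suc r)  ≡⟨ cong ((g * g) ^ suc r *_) (^-distribʳ-* (suc r) K (s ^ 2)) ⟨
    (g * g) ^ suc r * (K * s ^ 2) ^ suc r            ≡⟨ ^-distribʳ-* (suc r) (g * g) (K * s ^ 2) ⟨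
    (g * g * (K * s ^ 2)) ^ suc r                    ≡⟨ cong (_^ suc r) (regroup g K s) ⟩
    (K * (g * s * (g * s))) ^ suc r                  ≤⟨ ^-monoˡ-≤ (suc r) (*-monoʳ-≤ K (*-mono-≤ gs≤ gs≤)) ⟩
    (K * (3 * n * (3 * n))) ^ suc r                  ≡⟨ cong (_^ suc r) (nine K n) ⟩
    (K * 9 * (n * n)) ^ suc r                        ∎)
    -- The fourth power of s already exceeds n; the eighth is taken to meet the common exponent.
    (≤-trans (≤-trans n≤s⁴ (≤-reflexive s^4)) (^-monoʳ-≤ s (m≤m+n 4 4)))
    where
    open ≤-Reasoning
    regroup : ∀ g K s → g * g * (K * (s * (s * 1))) ≡ K * (g * s * (g * s))
    regroup = solve-∀
    nine : ∀ K n → K * (3 * n * (3 * n)) ≡ K * 9 * (n * n)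
    nine = solve-∀

  module Total (M C R T : ℕ) (M≤m : M ≤ m) where

    X₁ X₂ X₃ : ℕ
    X₁ = g * g * T
    X₂ = g * g * (s * m)
    X₃ = g * s * (s * s * m)

    private
      instance
        g≢0 : NonZero g
        g≢0 = >-nonZero g>0
        m≢0 : NonZero m
        m≢0 = >-nonZero m>0
        gg≢0 : NonZero (g * g)
        gg≢0 = m*n≢0 g g
        sm≢0 : NonZero (s * m)
        sm≢0 = m*n≢0 s m
        ss≢0 : NonZero (s * s)
        ss≢0 = m*n≢0 s s
        ssm≢0 : NonZero (s * s * m)
        ssm≢0 = m*n≢0 (s * s) m

      1≤X₂ : 1 ≤ X₂
      1≤X₂ = *-mono-≤ {1} {g * g} {1} {s * m} (*-mono-≤ {1} {g} {1} {g} g>0 g>0) (*-mono-≤ {1} {s} {1} {m} s>0 m>0)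

      M≤X₂ : M ≤ X₂
      M≤X₂ = ≤-trans M≤m (≤-trans (m≤n*m m s) (m≤n*m (s * m) (g * g)))

      gg≤X₂ : g * g ≤ X₂
      gg≤X₂ = m≤m*n (g * g) (s * m)

      gsm≤X₂ : g * (s * m) ≤ X₂
      gsm≤X₂ = *-monoˡ-≤ (s * m) (m≤m*n g g)

      gs≤X₂ : g * s ≤ X₂
      gs≤X₂ = ≤-trans (*-monoʳ-≤ g (m≤m*n s m)) gsm≤X₂

      gs≤X₃ : g * s ≤ X₃
      gs≤X₃ = m≤m*n (g * s) (s * s * m)

      gsss≤X₃ : g * s * (s * s) ≤ X₃
      gsss≤X₃ = *-monoʳ-≤ (g * s) (m≤m*n (s * s) m)

    -- All lower-order terms are absorbed into X₂ or X₃, whose factors are at least 1. The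
    -- coefficients add up as 34 = 20 + 14, 54 = 35 + 9 + 10 and 20 = 17 + 3.
    total≤ : runtime s g m M C R T ≤ 2 * X₁ + ((C * 34 + (R + 18) + 54) * X₂ + (C * 10 + 20) * X₃)
    total≤ = begin
      runtime s g m M C R T ≡⟨ collect M C R T g s m ⟩
      2 * X₁ + (35 * 1 + 9 * M + C * 20 * (g * (s * m)) + C * 14 * X₂ + (R + 18) * (g * g) + 10 * (g * s)
        + (C * 10 * X₃ + 17 * (g * s * (s * s)) + 3 * (g * s)))
        ≤⟨ +-monoʳ-≤ (2 * X₁) (+-mono-≤
             (+-mono-≤ (+-mono-≤ (+-monoˡ-≤ (C * 14 * X₂)
                 (+-mono-≤ (+-mono-≤ (*-monoʳ-≤ 35 1≤X₂) (*-monoʳ-≤ 9 M≤X₂)) (*-monoʳ-≤ (C * 20) gsm≤X₂)))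
               (*-monoʳ-≤ (R + 18) gg≤X₂)) (*-monoʳ-≤ 10 gs≤X₂))
             (+-mono-≤ (+-monoʳ-≤ (C * 10 * X₃) (*-monoʳ-≤ 17 gsss≤X₃)) (*-monoʳ-≤ 3 gs≤X₃))) ⟩
      2 * X₁ + (35 * X₂ + 9 * X₂ + C * 20 * X₂ + C * 14 * X₂ + (R + 18) * X₂ + 10 * X₂
        + (C * 10 * X₃ + 17 * X₃ + 3 * X₃))
        ≡⟨ combine C R X₁ X₂ X₃ ⟩
      2 * X₁ + ((C * 34 + (R + 18) + 54) * X₂ + (C * 10 + 20) * X₃) ∎
      where
      open ≤-Reasoning
      collect : ∀ M C R T g s m →
        6 + (M * 9 + 5 + (13 + (g * (s * (C * m)) * 20 + 3 +
          (g * g * (s * (C * m) * 14 + (R + T * 2) + 18) + g * s * (s * s * (C * m * 10 + 17) + 3) + 3 + (1 + (g * s * 10 + 3 + 1))))))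
        ≡ 2 * (g * g * T) + (35 * 1 + 9 * M + C * 20 * (g * (s * m)) + C * 14 * (g * g * (s * m)) + (R + 18) * (g * g) + 10 * (g * s)
        + (C * 10 * (g * s * (s * s * m)) + 17 * (g * s * (s * s)) + 3 * (g * s)))
      collect = solve-∀
      combine : ∀ C R x y z → 2 * x + (35 * y + 9 * y + C * 20 * y + C * 14 * y + (R + 18) * y + 10 * y
        + (C * 10 * z + 17 * z + 3 * z)) ≡ 2 * x + ((C * 34 + (R + 18) + 54) * y + (C * 10 + 20) * z)
      combine = solve-∀

    saves-total : ∀ {K p} r → 0 < p → T ^ suc r * s ^ p ≤ K ^ suc r * s ^ (2 * suc r) →
      Saves (suc r * 8) n (2 * (2 * (K * 9) + 2 * ((C * 34 + (R + 18) + 54) * 36 + (C * 10 + 20) * 192))) (runtime s g m M C R T)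
    saves-total {K} r p>0 h = saves-mono total≤
      (saves-+ (saves-* 2 (oracle-calls {K = K} r p>0 h))
        (saves-+ (saves-* (C * 34 + (R + 18) + 54) (group-pairs r)) (saves-* (C * 10 + 20) (brute-force r))))

-- Choice of the parameters and assembly of the reduction

disjoint-decided : ∀ {p c k T F G s} .⦃ _ : NonZero s ⦄ → Solves OrthogonalVectors c p k T →
  Decides p (wordSize k s) s ⌊ c ·log₂ s ⌋ (T s) F G
disjoint-decided {c = c} {F = F} {G} {s} solve with solve s (matrix F) (matrix G)
... | t , s′ , t≤ , r , ans = record { steps≤ = t≤ ; run = r ; verdict = decided ans }
  where
  d = ⌊ c ·log₂ s ⌋
  decided : Answers s′ (OrthogonalVectors (matrix {s} {d} F) (matrix G)) →
    (regs s′ 0 ≡ 1 × ∃[ u ] ∃[ v ] u < s × v < s × disjoint F G (u * d) (v * d) d ≡ true) ⊎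
    (regs s′ 0 ≡ 0 × (∀ {u v} → u < s → v < s → disjoint F G (u * d) (v * d) d ≡ false))
  decided (inj₁ (e , a , b , a∈ , b∈ , a·b)) with ∈-matrix⁻ F a∈ | ∈-matrix⁻ G b∈
  ... | u , u< , refl | v , v< , refl = inj₁ (e , u , v , u< , v< , dot⇒disjoint {F} {G} {u * d} {v * d} {d} a·b)
  decided (inj₂ (e , ¬ov)) = inj₂ (e , λ {u} {v} u< v< → ¬-not λ q →
    ¬ov (row F (u * d) , row G (v * d) , ∈-matrix⁺ F u< , ∈-matrix⁺ G v< , disjoint⇒dot {F} {G} {u * d} {v * d} {d} q))

-- Closed form of the number of doublings: the least M with n < 2 ^ (4 (M + 1)). It appears only in
-- the analysis; the program reaches it through its loop.
M : ℕ → ℕ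
M n = ⌊log₂ n ⌋ / 4

module Exponents (n : ℕ) (n>0 : 0 < n) where

  L = ⌊log₂ n ⌋
  s = 2 ^ suc (M n)

  4M≤L : M n * 4 ≤ L
  4M≤L = m/n*n≤m L 4

  L<4[1+M] : suc L ≤ suc (M n) * 4
  L<4[1+M] = ≤-trans (s≤s (≤-reflexive (m≡m%n+[m/n]*n L 4))) (+-monoˡ-≤ (M n * 4) (m%n<n L 4))

  M≤L : M n ≤ L
  M≤L = m/n≤m L 4

  fourth-power : ∀ m → 2 ^ m * 2 ^ m * (2 ^ m * 2 ^ m) ≡ 2 ^ (m * 4)
  fourth-power m = trans (expand (2 ^ m)) (^-*-assoc 2 m 4)
    where
    expand : ∀ x → x * x * (x * x) ≡ x * (x * (x * (x * 1)))
    expand = solve-∀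

  below : ∀ {m} → m < M n → 2 ^ suc m * 2 ^ suc m * (2 ^ suc m * 2 ^ suc m) ≤ n
  below {m} h = ≤-trans (≤-reflexive (fourth-power (suc m)))
    (≤-trans (^-monoʳ-≤ 2 (≤-trans (*-monoˡ-≤ 4 h) 4M≤L)) (2^log≤n n n>0))

  above : n < s * s * (s * s)
  above = ≤-trans (n<2^[1+log] n) (≤-trans (^-monoʳ-≤ 2 L<4[1+M]) (≤-reflexive (sym (fourth-power (suc (M n))))))

  s⁴≤ : s * s * (s * s) ≤ 16 * n
  s⁴≤ = begin
    s * s * (s * s)          ≡⟨ fourth-power (suc (M n)) ⟩
    2 ^ (4 + M n * 4)        ≡⟨ ^-distribˡ-+-* 2 4 (M n * 4) ⟩
    16 * 2 ^ (M n * 4)       ≤⟨ *-monoʳ-≤ 16 (≤-trans (^-monoʳ-≤ 2 4M≤L) (2^log≤n n n>0)) ⟩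
    16 * n                   ∎
    where open ≤-Reasoning

  s>0 : 0 < s
  s>0 = m^n>0 2 (suc (M n))

  g = quotient n s + 1

  gs≤ : g * s ≤ 3 * n
  gs≤ = begin
    (quotient n s + 1) * s         ≡⟨ *-distribʳ-+ s (quotient n s) 1 ⟩
    quotient n s * s + 1 * s       ≤⟨ +-mono-≤ (≤-trans (m≤m+n _ (remainder n s)) (≤-reflexive (sym (digits n s>0))))
                                               (≤-reflexive (*-identityˡ s)) ⟩
    n + s                          ≤⟨ +-monoʳ-≤ n (≤-trans (^-monoʳ-≤ 2 (s≤s M≤L)) (*-monoʳ-≤ 2 (2^log≤n n n>0))) ⟩
    n + 2 * n                      ∎
    where open ≤-Reasoning

  g>0 : 0 < g
  g>0 = m≤n+m 1 (quotient n s)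

  m²≤ : suc (M n) * suc (M n) ≤ 16 * s
  m²≤ = ≤-trans (*-mono-≤ m≤ m≤) (≤-trans (square≤exp (M n)) (*-monoʳ-≤ 16 (m≤m+n (2 ^ M n) _)))
    where
    m≤ : suc (M n) ≤ 3 + M n
    m≤ = m≤n+m (suc (M n)) 2

  -- Transfers the threshold of the OV time bound, which concerns s, to a threshold on n.
  large : ∀ {N} → N * N * (N * N) ≤ n → N ≤ s
  large {N} h = ≮⇒≥ λ s<N → <⇒≱ above (≤-trans (*-mono-≤ (*-mono-≤ (<⇒≤ s<N) (<⇒≤ s<N)) (*-mono-≤ (<⇒≤ s<N) (<⇒≤ s<N))) h)

  open Sizes n s g (suc (M n)) s>0 (s≤s z≤n) g>0 (<⇒≤ above) s⁴≤ gs≤ m²≤ public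

-- With a the numerator of c, c log n is at most a (L + 1), hence at most 4 a (M + 1). The extra 1
-- makes the inequality strict, which leaves a column for the flag, and ensures that the constant
-- handed to the OV hypothesis is at least 1.
dimension : ℕ → ℕ
dimension a = suc (4 * a)

integer : ℕ → ℚ
integer C = mkℚ (ℤ.+ C) 0 (coprime-sym (1-coprimeTo C))

unitFraction : ℕ → ℚ
unitFraction r = mkℚ (ℤ.+ 1) r (1-coprimeTo (suc r))

-- No rounding occurs for an integer constant and a power of two, so the program obtains the exact
-- dimension by adding C at each doubling.
log-dimension : ∀ C m → ⌊ integer C ·log₂ 2 ^ m ⌋ ≡ C * m
log-dimension C m = trans (n/1≡n _) (trans (cong ⌊log₂_⌋ (^-*-assoc 2 m C)) (trans (⌊log₂[2^n]⌋≡n (m * C)) (*-comm m C)))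

wordSize-2^ : ∀ k m → wordSize k (2 ^ m) ≡ k * suc m
wordSize-2^ k m = cong (λ l → k * suc l) (⌊log₂[2^n]⌋≡n m)

log-< : ∀ c n → 0 < n → ⌊ c ·log₂ n ⌋ < dimension ∣ ↥ c ∣ * suc (M n)
log-< c@record{} n n>0 = begin-strict
  ⌊log₂ n ^ a ⌋ / ↧ₙ c        ≤⟨ m/n≤m ⌊log₂ n ^ a ⌋ (↧ₙ c) ⟩
  ⌊log₂ n ^ a ⌋               ≤⟨ ⌊log₂⌋-mono-≤ (^-monoˡ-≤ a (<⇒≤ (n<2^[1+log] n))) ⟩
  ⌊log₂ (2 ^ suc L) ^ a ⌋     ≡⟨ cong ⌊log₂_⌋ (^-*-assoc 2 (suc L) a) ⟩
  ⌊log₂ 2 ^ (suc L * a) ⌋     ≡⟨ ⌊log₂[2^n]⌋≡n (suc L * a) ⟩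
  suc L * a                   ≤⟨ *-monoˡ-≤ a L<4[1+M] ⟩
  suc (M n) * 4 * a           ≡⟨ rearrange (suc (M n)) a ⟩
  4 * a * suc (M n)           <⟨ m<n+m (4 * a * suc (M n)) (s≤s z≤n) ⟩
  dimension a * suc (M n)     ∎
  where
  open ≤-Reasoning
  open Exponents n n>0
  a = ∣ ↥ c ∣
  rearrange : ∀ m a → m * 4 * a ≡ 4 * a * m
  rearrange = solve-∀

-- `suc r * 8` computes to `suc (7 + r * 8)`, the denominator of the unit fraction.
saves⇒∈O : ∀ {f K} r N → (∀ n → n ≥ N → Saves (suc r * 8) n K (f n)) → f ∈O[n^2- unitFraction (7 + r * 8) ]
saves⇒∈O {f} {K} r N h = K , N , λ n n≥ →
  ≤-trans (≤-reflexive (cong (f n ^ Q *_) (*-identityʳ n))) (≤-trans (bound (h n n≥)) (≤-reflexive (square-power n)))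
  where
  Q = suc r * 8
  square-power : ∀ n → (K * (n * n)) ^ Q ≡ K ^ Q * n ^ (2 * Q)
  square-power n = trans (^-distribʳ-* Q K (n * n))
    (cong (K ^ Q *_) (trans (cong (λ x → (n * x) ^ Q) (sym (*-identityʳ n))) (^-*-assoc n 2 Q)))

numerator>0 : ∀ {ε} → 0ℚ ℚ.< ε → 0 < ∣ ↥ ε ∣
numerator>0 {ε} ε>0 = n≢0⇒n>0 λ z → ℚ.<⇒≢ ε>0 (sym (ℚ.↥p≡0⇒p≡0 ε (ℤ.∣i∣≡0⇒i≡0 z)))

module Reduction (c : ℚ) (p : Program) (k : ℕ) (T : ℕ → ℕ) where

  C = dimension ∣ ↥ c ∣

  -- A sum of the separate demands, in multiples of `suc L` bits: `k * 2` for 2 ^ w, `C` for the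
  -- dimension, and 1 for n, s and the constant 2. The factor `D` in the word length then makes room
  -- for values of higher degree.
  wordFactor : ℕ
  wordFactor = k * 2 + C + 1

  hsProgram : Program
  hsProgram = code (hittingSetBlock p k C) 0

  hsTime : ℕ → ℕ
  hsTime n = runtime s (quotient n s + 1) (suc (M n)) (M n) C (regBound p) (T s)
    where s = 2 ^ suc (M n)

  module _ (solve : Solves OrthogonalVectors (integer C) p k T) (n : ℕ) (n>0 : 0 < n) where

    open Exponents n n>0

    W B : ℕ
    W = wordSize (wordFactor * D) n
    B = 2 ^ (wordFactor * suc L)

    2^W≡B^D : 2 ^ W ≡ B ^ D
    2^W≡B^D = trans (cong (2 ^_) (swap wordFactor D (suc L))) (sym (^-*-assoc 2 (wordFactor * suc L) D))
      where
      swap : ∀ f d l → f * d * l ≡ f * l * d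
      swap = solve-∀

    exponent : ∀ {e x} → e ≤ wordFactor → x ≤ e * suc L → 2 ^ x ≤ B
    exponent h h′ = ^-monoʳ-≤ 2 (≤-trans h′ (*-monoˡ-≤ (suc L) h))

    1≤F : 1 ≤ wordFactor
    1≤F = m≤n+m 1 (k * 2 + C)

    2k≤F : k * 2 ≤ wordFactor
    2k≤F = ≤-trans (m≤m+n (k * 2) C) (m≤m+n (k * 2 + C) 1)

    C≤F : C ≤ wordFactor
    C≤F = ≤-trans (m≤n+m C (k * 2)) (m≤m+n (k * 2 + C) 1)

    2≤B : 2 ≤ B
    2≤B = exponent {1} {1} 1≤F (s≤s z≤n)

    w≤ : k * (2 + M n) ≤ k * 2 * suc L
    w≤ = ≤-trans
      (*-monoʳ-≤ k (≤-trans (+-monoʳ-≤ 2 (≤-trans M≤L (m≤m+n L (L + 0)))) (≤-reflexive (twice L))))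
      (≤-reflexive (sym (*-assoc k 2 (suc L))))
      where
      twice : ∀ l → 2 + (l + (l + 0)) ≡ 2 * suc l
      twice = solve-∀

    2^w≤B : 2 ^ (k * (2 + M n)) ≤ B
    2^w≤B = exponent {k * 2} 2k≤F w≤

    w≤W : k * (2 + M n) ≤ W
    w≤W = ≤-trans w≤ (*-monoˡ-≤ (suc L) (≤-trans 2k≤F (m≤m*n wordFactor D)))

    s≤B : s ≤ B
    s≤B = exponent {1} 1≤F (≤-trans (s≤s M≤L) (≤-reflexive (sym (*-identityˡ (suc L)))))

    dd≤B : C * suc (M n) ≤ B
    dd≤B = ≤-trans (<⇒≤ (n<2^n (C * suc (M n)))) (exponent {C} C≤F (*-monoʳ-≤ C (s≤s M≤L)))

    n≤B : n ≤ B
    n≤B = ≤-trans (<⇒≤ (n<2^[1+log] n)) (exponent {1} 1≤F (≤-reflexive (sym (*-identityˡ (suc L)))))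

    oracle : ∀ F G → Decides p (k * (2 + M n)) s (C * suc (M n)) (T s) F G
    oracle F G = subst₂ (λ w d → Decides p w s d (T s) F G) (wordSize-2^ k (suc (M n))) (log-dimension C (suc (M n)))
      (disjoint-decided {p} {integer C} {k} {T} ⦃ m^n≢0 2 (suc (M n)) ⦄ solve)

    solvesHS : (A₀ B₀ : Vec (Vec Bool ⌊ c ·log₂ n ⌋) n) → ∃₂ λ t s′ → t ≤ hsTime n
      × W , hsProgram ⊢ input W A₀ B₀ ⇓[ t ] s′ × Answers s′ (HittingSet A₀ B₀)
    solvesHS A₀ B₀ = subst₂ (λ A₁ B₁ → ∃₂ λ t s′ → t ≤ hsTime n
      × W , hsProgram ⊢ input W A₁ B₁ ⇓[ t ] s′ × Answers s′ (HittingSet A₁ B₁))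
      (matrix-flatten A₀) (matrix-flatten B₀)
      (Algorithm.Correct.solves W B 2^W≡B^D 2≤B n ⌊ c ·log₂ n ⌋ (M n) k C
        n>0 (log-< c n n>0) w≤W s≤B 2^w≤B dd≤B below above p (T s) oracle (flatten A₀) (flatten B₀)
        n≤B (≤-trans (^-monoʳ-≤ 2 (*-monoʳ-≤ k (m≤m+n 2 (M n)))) 2^w≤B)
        (≤-trans (m≤m*n C (suc (M n))) dd≤B)
        (≤-trans (^-monoʳ-≤ 2 (m≤m*n k (2 + M n))) 2^w≤B))

  hsTime-saves : ∀ {ε} → 0ℚ ℚ.< ε → T ∈O[n^2- ε ] → hsTime ∈O[n^2- unitFraction (7 + ℚ.denominator-1 ε * 8) ]
  -- The fourth power of n₀ forces s ≥ n₀, and the successor ensures n > 0.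
  hsTime-saves {ε@record{}} ε>0 (K , n₀ , T≤) = saves⇒∈O {hsTime} (ℚ.denominator-1 ε) (suc (n₀ * n₀ * (n₀ * n₀))) λ n n≥ →
    let n>0 = ≤-trans (s≤s z≤n) n≥
        open Exponents n n>0
    in Total.saves-total (M n) C (regBound p) (T s) (n≤1+n (M n)) {K} {∣ ↥ ε ∣} (ℚ.denominator-1 ε) (numerator>0 ε>0)
         (T≤ s (large (≤-trans (n≤1+n (n₀ * n₀ * (n₀ * n₀))) n≥)))

subquadratic : TrulySubquadratic OrthogonalVectors → TrulySubquadratic HittingSet
subquadratic (ε , ε>0 , ov) = unitFraction (7 + ℚ.denominator-1 ε * 8) , ℚ.*<* (ℤ.+<+ (s≤s z≤n)) , λ c _ →
  let open Reduction c
      C = dimension ∣ ↥ c ∣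
      p , k , T , T≤ , solve = ov (integer C) (ℚ.*≤* (ℤ.+≤+ (s≤s z≤n)))
  in hsProgram p k T , wordFactor p k T * D , hsTime p k T , hsTime-saves p k T ε>0 T≤ ,
     λ n A B → solvesHS p k T solve n (>-nonZero⁻¹ n) A B

proposition2 : ¬ OVConjecture → ¬ HSConjecture
proposition2 ¬ov hs = ¬ov λ ov → hs (subquadratic ov)
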